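{- Let $q$ be a prime power. The $1$-dimensional affine group $AGL_1(q)$ (the group of transformations $t\mapsto at+b$ of the field $\mathbb F_q$, $a,b\in\mathbb F_q$, $a\neq 0$) is a chirality group if and only if $q=2^e$ with $e$ odd.
   Context: Let $\Delta=\langle r_0,r_1,r_2\mid r_0^2=r_1^2=r_2^2=1\rangle$ and let $\Delta^+$ be its index-$2$ subgroup of even-length words, generated by $\rho=r_1r_2$ and $\lambda=r_2r_0$. An (oriented) hypermap is a triple $(D,R,L)$ with $D$ a finite set and $R,L$ permutations of $D$ generating a group transitive on $D$ (the monodromy group). It is orientably regular if its automorphism group (permutations of $D$ commuting with $R$ and $L$) acts regularly on $D$; orientably regular hypermaps correspond (up to isomorphism) bijectively to normal subgroups $H$ of finite index in $\Delta^+$ (hypermap subgroups), the hypermap being $(\Delta^+/H,\rho,\lambda)$ acting by left multiplication. For $H\trianglelefteq\Delta^+$ put $H^r=r_2Hr_2$. The chirality group of the hypermap is $HH^r/H$ (isomorphic to $H/(H\cap H^r)$). A group $G$ is called a chirality group if $G$ is isomorphic to the chirality group of some orientably regular hypermap. -}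

module Defs where

open import Level using (0ℓ; _⊔_) renaming (suc to lsuc)
open import Data.Nat using (ℕ; suc; _+_; _^_; _≤_)
open import Data.Nat.Primality using (Prime)
open import Data.Fin using (Fin; zero; suc)
open import Data.List using (List; []; _∷_; _++_; reverse; length)
open import Data.List.Relation.Unary.Any using (Any)
open import Data.Product using (Σ; _×_; _,_; proj₁; proj₂)
open import Relation.Nullary using (¬_)
open import Relation.Binary.PropositionalEquality using (_≡_)
open import Relation.Binary.Construct.Closure.Equivalence using (EqClosure)
open import Algebra.Bundles using (CommutativeRing)
open import Algebra.Bundles.Raw using (RawMagma)
open import Function.Bundles using (_⇔_)

Even : ℕ → Set
Even n = Σ ℕ λ k → n ≡ k + k

Odd : ℕ → Set
Odd n = Σ ℕ λ k → n ≡ suc (k + k)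

IsPrimePower : ℕ → Set
IsPrimePower q = Σ ℕ λ p → Σ ℕ λ e → Prime p × 1 ≤ e × q ≡ p ^ e

record Field c ℓ : Set (lsuc (c ⊔ ℓ)) where
  field
    commutativeRing : CommutativeRing c ℓ
  open CommutativeRing commutativeRing public
  field
    0≉1     : ¬ (0# ≈ 1#)
    inverse : (x : Carrier) → ¬ (x ≈ 0#) → Σ Carrier λ y → x * y ≈ 1#

module _ (F : Field 0ℓ 0ℓ) where
  open Field F hiding (_+_)
  open Field F using () renaming (_+_ to _⊕_)

  private
    nz-mul : (a b : Carrier) → ¬ (a ≈ 0#) → ¬ (b ≈ 0#) → ¬ ((a * b) ≈ 0#)
    nz-mul a b a≉0 b≉0 ab≈0 = b≉0 b≈0
      where
      open import Relation.Binary.Reasoning.Setoid setoid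
      a' = proj₁ (inverse a a≉0)
      aa'≈1 = proj₂ (inverse a a≉0)
      b≈0 : b ≈ 0#
      b≈0 = begin
        b                ≈⟨ sym (*-identityˡ b) ⟩
        1# * b           ≈⟨ *-congʳ (sym aa'≈1) ⟩
        (a * a') * b     ≈⟨ *-congʳ (*-comm a a') ⟩
        (a' * a) * b     ≈⟨ *-assoc a' a b ⟩
        a' * (a * b)     ≈⟨ *-congˡ ab≈0 ⟩
        a' * 0#          ≈⟨ zeroʳ a' ⟩
        0#               ∎

  -- The 1-dimensional affine group AGL₁(F): pairs (a , b) with a ≠ 0,
  -- representing t ↦ a t + b, with composition
  -- (t ↦ a t + b) ∘ (t ↦ c t + d) = (t ↦ (a c) t + (a d + b)).
  AGL₁ : RawMagma 0ℓ 0ℓ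
  AGL₁ = record
    { Carrier = Σ (Carrier × Carrier) (λ ab → ¬ (proj₁ ab ≈ 0#))
    ; _≈_     = λ x y → (proj₁ (proj₁ x) ≈ proj₁ (proj₁ y))
                      × (proj₂ (proj₁ x) ≈ proj₂ (proj₁ y))
    ; _∙_     = λ { ((a , b) , a≉0) ((c , d) , c≉0) →
                    ((a * c) , ((a * d) ⊕ b)) , nz-mul a c a≉0 c≉0 }
    }

-- The extended triangle group Δ = ⟨r₀,r₁,r₂ | r₀² = r₁² = r₂² = 1⟩:
-- elements are words in the letters r₀ r₁ r₂ (Fin 3), with equality the
-- equivalence closure of deleting a factor r_i r_i.  The inverse of a
-- word is its reverse.

Word : Set
Word = List (Fin 3)

r₂ : Fin 3
r₂ = suc (suc zero)

data Cancel : Word → Word → Set where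
  cancel : ∀ x i y → Cancel (x ++ (i ∷ i ∷ y)) (x ++ y)

infix 4 _≈Δ_
_≈Δ_ : Word → Word → Set
_≈Δ_ = EqClosure Cancel

InΔ⁺ : Word → Set
InΔ⁺ w = Even (length w)

record HypermapSubgroup (H : Word → Set) : Set where
  field
    resp     : ∀ {u v} → u ≈Δ v → H u → H v
    ⊆Δ⁺      : ∀ {u} → H u → InΔ⁺ u
    has-unit : H []
    mul      : ∀ {u v} → H u → H v → H (u ++ v)
    inv      : ∀ {u} → H u → H (reverse u)
    normal   : ∀ {g u} → InΔ⁺ g → H u → H (g ++ (u ++ reverse g))
    finite-index : Σ (List Word) λ reps →
                     ∀ w → InΔ⁺ w → Any (λ r → InΔ⁺ r × H (reverse r ++ w)) reps

_ʳ : (Word → Set) → Word → Set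
(H ʳ) k = Σ Word λ h → H h × (k ≈Δ (r₂ ∷ (h ++ (r₂ ∷ []))))

_·ʳ : (Word → Set) → Word → Set
(H ·ʳ) w = Σ Word λ h → Σ Word λ k → H h × (H ʳ) k × (w ≈Δ (h ++ k))

-- An isomorphism from the chirality group H Hʳ / H onto a group G
-- (G given as a raw magma; its group operation is the only structure
-- an isomorphism must preserve).  The map f is defined on the words of
-- H Hʳ; cosets modulo H correspond exactly to elements of G.
record ChiralityIso (H : Word → Set) (G : RawMagma 0ℓ 0ℓ) : Set where
  open RawMagma G
  field
    f         : (w : Word) → (H ·ʳ) w → Carrier
    ker       : ∀ u v (pu : (H ·ʳ) u) (pv : (H ·ʳ) v) →
                  (f u pu ≈ f v pv) ⇔ H (reverse u ++ v)
    hom       : ∀ u v (pu : (H ·ʳ) u) (pv : (H ·ʳ) v) (puv : (H ·ʳ) (u ++ v)) →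
                  f (u ++ v) puv ≈ (f u pu ∙ f v pv)
    surjective : ∀ g → Σ Word λ w → Σ ((H ·ʳ) w) λ p → f w p ≈ g

-- G is a chirality group: isomorphic to the chirality group H Hʳ / H
-- of some orientably regular hypermap (hypermap subgroup H).
IsChiralityGroup : RawMagma 0ℓ 0ℓ → Set₁
IsChiralityGroup G = Σ (Word → Set) λ H → HypermapSubgroup H × ChiralityIso H G

{-# OPTIONS --safe #-}
-- Necessity.  For h in H put F h = f (r₂ h r₂); this maps H onto X = AGL₁(q), and conjugation makes
-- Δ⁺ act on X by automorphisms, r₂ H r₂ acting trivially and H by inner automorphisms.  Such an
-- automorphism preserves the translations b ∈ 𝔽_q (the solutions of x^q = 1) and acts on them by a map β with
-- β(ab) = τ(a) β(b), where τ is the automorphism induced on the linear parts 𝔽_q^*.  If ℓ ∈ {2, 3} divides q − 1,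
-- then τ acts on the ℓ-th roots of unity as ± 1, and (β(1)^((q−1)/ℓ), ±) is a homomorphism from Δ⁺ to a
-- generalised dihedral group.  The kernel of such a homomorphism is invariant under conjugation by r₂, so it
-- contains H along with r₂ H r₂; but an h with F h = (t ↦ a t) is sent to a^((q−1)/ℓ), which is ≠ 1 for some a.
-- Here ℓ = 2 excludes odd q and ℓ = 3 excludes even exponents.
--
-- Sufficiency.  For q = 2^e with e ≥ 3 odd take the group AΓL₁(q) generated by x : t ↦ t² + 1 and y : t ↦ g t,
-- where g is a primitive element.  Modulo translations x y x⁻¹ = y², and mirroring this relation gives
-- y³ = 1; as 3 is prime to q − 1, the chirality group is all of AGL₁(q).
-- For q = 2 take t ↦ 3 t and t ↦ t + 1 on ℤ/16.
module Submission where

open import Defs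
open import Level using (0ℓ)
open import Algebra.Bundles using (AbelianGroup; CommutativeRing; Group; Magma; RawRing)
open import Algebra.Bundles.Raw using (RawMagma)
open import Data.Bool using (Bool; true; false)
open import Data.Empty using (⊥; ⊥-elim)
open import Data.Fin as Fin using (Fin; zero; suc; toℕ; punchIn)
open import Data.Fin.Permutation using (Permutation′; permutation; _⟨$⟩ʳ_)
import Data.Fin.Properties as Finₚ
open import Data.List
  using (List; []; _∷_; _++_; reverse; length; replicate; tabulate; take; drop; allFin; cartesianProductWith)
open import Data.List.Membership.Propositional using (_∈_; lose)
open import Data.List.Membership.Propositional.Properties using (∈-cartesianProductWith⁺; ∈-allFin)
import Data.List.Properties as Listₚ
open import Data.List.Properties using (length-tabulate; length-replicate)
open import Data.List.Relation.Unary.All as All using (All; []; _∷_)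
import Data.List.Relation.Unary.All.Properties as Allₚ
open import Data.List.Relation.Unary.AllPairs using (AllPairs; []; _∷_)
import Data.List.Relation.Unary.AllPairs.Properties as AllPairsₚ
open import Data.List.Relation.Unary.Any using (here; there)
open import Data.Maybe using (Maybe; just; nothing)
open import Data.Nat using (ℕ; zero; suc; z≤n; s≤s)
import Data.Nat as ℕ
open import Data.Nat.Coprimality as Coprime using (Coprime; coprime-Bézout; coprime-divisor; gcd≡1⇒coprime)
open import Data.Nat.DivMod using (_mod_)
open import Data.Nat.Divisibility using (_∣_; _∣?_; divides; 1∣_; ∣1⇒≡1; ∣⇒≤; ∣-refl; ∣-trans;
  ∣m+n∣m⇒∣n; ∣n⇒∣m*n; m∣m*n; *-monoˡ-∣)
open import Data.Nat.GCD using (gcd[m,n]∣m; gcd[m,n]∣n; module Bézout)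
open import Data.Nat.Primality using (Prime; prime⇒irreducible; prime⇒nonTrivial)
open import Data.Nat.Primality.Factorisation using (factorise)
import Data.Nat.Properties as ℕₚ
open import Data.Nat.Tactic.RingSolver using (solve-∀)
open import Data.Product using (Σ; Σ-syntax; _×_; _,_; proj₁; proj₂)
open import Data.Product.Relation.Binary.Pointwise.NonDependent using (×-setoid)
open import Data.Sign as Sign using (Sign; opposite)
import Data.Sign.Properties as Signₚ
open import Data.Sum using (_⊎_; inj₁; inj₂)
open import Data.Vec using (Vec; lookup)
open import Function using (_∘_)
open import Function.Bundles using (_⇔_; Bijection; Inverse; mk⇔; mk↔ₛ′; module Equivalence)
open import Function.Construct.Identity using (bijection)
open import Relation.Binary using (Setoid; Decidable; tri<; tri≈; tri>)
import Relation.Binary.Construct.Closure.Equivalence as EqC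
open import Relation.Binary.PropositionalEquality using (_≡_; _≢_; subst)
import Relation.Binary.PropositionalEquality as ≡
open import Relation.Nullary using (¬_; Dec; yes; no)
open import Relation.Nullary.Decidable using (map′; True; toWitness; from-yes; _×-dec_; _⊎-dec_; _→-dec_)

-- The values β(1) form only a crossed homomorphism for the action τ. Raising them to the power (q -
-- 1)/ℓ moves them into the ℓ-th roots of unity; for ℓ = 2 and ℓ = 3 these have no automorphisms
-- besides ± 1, so the crossed homomorphism becomes a homomorphism to a dihedral group. Such a
-- target is useful because, for any two elements of a generalised dihedral group, some automorphism
-- of the group they generate inverts both; hence no dihedral quotient of Δ⁺ can tell `H` from its
-- mirror image. If q = 2^e with e odd, then q - 1 is prime to 6. This is why neither obstruction
-- applies, and also why the sixth power of a primitive element, which is the linear part produced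
-- by the construction, is again primitive. For q = 2 that construction collapses: g = 1, and the
-- factors g + 1, g³ + 1, g⁴ + 1 of the translation it yields all vanish. Hence the separate example
-- on ℤ/16. Hypermap subgroups are built as kernels of permutation actions on a doubled set, so that
-- no quotient group has to be formed and finite index follows from the pigeonhole principle.

-- The coefficient (m , n) stands for the integer m − n.
module RingSolver (R : CommutativeRing 0ℓ 0ℓ) where
  open CommutativeRing R
  open import Algebra.Solver.Ring.AlmostCommutativeRing using (_-Raw-AlmostCommutative⟶_; fromCommutativeRing)
  open import Algebra.Properties.Semiring.Mult semiring using (×-homo-+; ×1-homo-*) renaming (_×_ to _·_)
  open import Algebra.Properties.Ring (CommutativeRing.ring R) using (-‿+-comm; -‿distribˡ-*; -‿distribʳ-*; -‿involutive; -0#≈0#)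
  import Algebra.Solver.Ring.NaturalCoefficients.Default commutativeSemiring as ℕSolver
  open import Relation.Binary.Reasoning.Setoid setoid

  private
    open ℕSolver using (_:=_; _:+_; _:*_) renaming (solve to ℕsolve)
    Coeff : RawRing 0ℓ 0ℓ
    Coeff = record
      { Carrier = ℕ × ℕ
      ; _≈_ = _≡_
      ; _+_ = λ { (m , n) (m′ , n′) → m ℕ.+ m′ , n ℕ.+ n′ }
      ; _*_ = λ { (m , n) (m′ , n′) → m ℕ.* m′ ℕ.+ n ℕ.* n′ , m ℕ.* n′ ℕ.+ n ℕ.* m′ }
      ; -_ = λ { (m , n) → n , m }
      ; 0# = 0 , 0
      ; 1# = 1 , 0
      }

    ⟦_⟧′ : ℕ × ℕ → Carrier
    ⟦ m , n ⟧′ = m · 1# - n · 1#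

    morphism : Coeff -Raw-AlmostCommutative⟶ fromCommutativeRing R
    morphism = record
      { ⟦_⟧ = ⟦_⟧′
      ; +-homo = λ { (m , n) (m′ , n′) → begin
          (m ℕ.+ m′) · 1# - (n ℕ.+ n′) · 1#
            ≈⟨ +-cong (×-homo-+ 1# m m′) (-‿cong (×-homo-+ 1# n n′)) ⟩
          m · 1# + m′ · 1# - (n · 1# + n′ · 1#)
            ≈⟨ +-congˡ (-‿+-comm _ _) ⟨
          m · 1# + m′ · 1# + (- (n · 1#) - n′ · 1#)
            ≈⟨ ℕsolve 4 (λ a b c d → a :+ b :+ (c :+ d) := a :+ c :+ (b :+ d)) refl _ _ _ _ ⟩
          m · 1# - n · 1# + (m′ · 1# - n′ · 1#) ∎ }
      ; *-homo = λ { (m , n) (m′ , n′) → begin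
          (m ℕ.* m′ ℕ.+ n ℕ.* n′) · 1# - (m ℕ.* n′ ℕ.+ n ℕ.* m′) · 1#
            ≈⟨ +-cong (homo m m′ n n′) (-‿cong (homo m n′ n m′)) ⟩
          m · 1# * m′ · 1# + n · 1# * n′ · 1# - (m · 1# * n′ · 1# + n · 1# * m′ · 1#)
            ≈⟨ +-cong (+-congˡ (sym (trans (sym (-‿distribˡ-* _ _))
                 (trans (-‿cong (sym (-‿distribʳ-* _ _))) (-‿involutive _)))))
               (trans (sym (-‿+-comm _ _)) (+-cong (-‿distribʳ-* _ _) (-‿distribˡ-* _ _))) ⟩
          m · 1# * m′ · 1# + - (n · 1#) * - (n′ · 1#) + (m · 1# * - (n′ · 1#) + - (n · 1#) * m′ · 1#)
            ≈⟨ ℕsolve 4 (λ a b c d → a :* c :+ b :* d :+ (a :* d :+ b :* c) := (a :+ b) :* (c :+ d)) refl _ _ _ _ ⟩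
          (m · 1# - n · 1#) * (m′ · 1# - n′ · 1#) ∎ }
      ; -‿homo = λ { (m , n) → begin
          n · 1# - m · 1#          ≈⟨ +-comm _ _ ⟩
          - (m · 1#) + n · 1#      ≈⟨ +-congˡ (-‿involutive _) ⟨
          - (m · 1#) - - (n · 1#)  ≈⟨ -‿+-comm _ _ ⟩
          - (m · 1# - n · 1#)      ∎ }
      ; 0-homo = -‿inverseʳ 0#
      ; 1-homo = trans (+-congˡ -0#≈0#) (trans (+-identityʳ _) (+-identityʳ 1#))
      }
      where
      homo : ∀ a b c d → (a ℕ.* b ℕ.+ c ℕ.* d) · 1# ≈ a · 1# * b · 1# + c · 1# * d · 1#
      homo a b c d = trans (×-homo-+ 1# (a ℕ.* b) (c ℕ.* d)) (+-cong (×1-homo-* a b) (×1-homo-* c d))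

    -- Different pairs may denote the same integer, so coefficients are compared through cross sums.
    ⟦⟧-cong : ∀ x y → Maybe (⟦ x ⟧′ ≈ ⟦ y ⟧′)
    ⟦⟧-cong (m , n) (m′ , n′) with m ℕ.+ n′ ℕ.≟ m′ ℕ.+ n
    ... | no _ = nothing
    ... | yes eq = just (begin
      m · 1# - n · 1#                           ≈⟨ add-both _ _ (n′ · 1#) ⟩
      m · 1# + n′ · 1# - (n · 1# + n′ · 1#)
        ≈⟨ +-cong (trans (sym (×-homo-+ 1# m n′)) (trans (reflexive (≡.cong (_· 1#) eq)) (×-homo-+ 1# m′ n)))
                  (-‿cong (+-comm _ _)) ⟩
      m′ · 1# + n · 1# - (n′ · 1# + n · 1#)     ≈⟨ add-both _ _ (n · 1#) ⟨
      m′ · 1# - n′ · 1#                         ∎)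
      where
      add-both : ∀ a b c → a - b ≈ a + c - (b + c)
      add-both a b c = begin
        a - b                 ≈⟨ +-identityʳ _ ⟨
        a - b + 0#            ≈⟨ +-congˡ (-‿inverseʳ c) ⟨
        a - b + (c - c)       ≈⟨ ℕsolve 4 (λ a b c d → a :+ b :+ (c :+ d) := a :+ c :+ (b :+ d)) refl _ _ _ _ ⟩
        a + c + (- b - c)     ≈⟨ +-congˡ (-‿+-comm b c) ⟩
        a + c - (b + c)       ∎

  open import Algebra.Solver.Ring Coeff (fromCommutativeRing R) morphism ⟦⟧-cong public
    using (solve; _:=_; _:+_; _:*_; _:-_; :-_)

-- Group identities by free reduction

module GroupSolver (G : Group 0ℓ 0ℓ) where
  open Group G
  open import Algebra.Properties.Group G using (⁻¹-involutive; ⁻¹-anti-homo-∙; ε⁻¹≈ε)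
  open import Relation.Binary.Reasoning.Setoid setoid

  infixl 7 _:∙_
  infix 8 _:⁻¹
  data Expr (n : ℕ) : Set where
    var : Fin n → Expr n
    :ε : Expr n
    _:∙_ : Expr n → Expr n → Expr n
    _:⁻¹ : Expr n → Expr n

  private
    ⟦_⟧ : ∀ {n} → Expr n → Vec Carrier n → Carrier
    ⟦ var i ⟧ ρ = lookup ρ i
    ⟦ :ε ⟧ ρ = ε
    ⟦ e :∙ f ⟧ ρ = ⟦ e ⟧ ρ ∙ ⟦ f ⟧ ρ
    ⟦ e :⁻¹ ⟧ ρ = ⟦ e ⟧ ρ ⁻¹

    letter : ∀ {n} → Bool → Fin n → Vec Carrier n → Carrier
    letter true i ρ = lookup ρ i
    letter false i ρ = lookup ρ i ⁻¹

    ⟦_⟧ₗ : ∀ {n} → List (Bool × Fin n) → Vec Carrier n → Carrier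
    ⟦ [] ⟧ₗ ρ = ε
    ⟦ (b , i) ∷ l ⟧ₗ ρ = letter b i ρ ∙ ⟦ l ⟧ₗ ρ

    -- Normal forms are reduced words of the free group; a letter put in front of a reduced word can
    -- cancel only with its head.
    push : ∀ {n} → Bool → Fin n → List (Bool × Fin n) → List (Bool × Fin n)
    push b i [] = (b , i) ∷ []
    push b i ((c , j) ∷ l) with i Finₚ.≟ j
    push true i ((false , j) ∷ l) | yes _ = l
    push false i ((true , j) ∷ l) | yes _ = l
    ... | _ = (b , i) ∷ (c , j) ∷ l

    cancelˡ : ∀ x y → x ∙ (x ⁻¹ ∙ y) ≈ y
    cancelˡ x y = trans (sym (assoc _ _ _)) (trans (∙-congʳ (inverseʳ x)) (identityˡ y))

    cancelˡ′ : ∀ x y → x ⁻¹ ∙ (x ∙ y) ≈ y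
    cancelˡ′ x y = trans (sym (assoc _ _ _)) (trans (∙-congʳ (inverseˡ x)) (identityˡ y))

    push-correct : ∀ {n} b (i : Fin n) l ρ → ⟦ push b i l ⟧ₗ ρ ≈ letter b i ρ ∙ ⟦ l ⟧ₗ ρ
    push-correct b i [] ρ = refl
    push-correct b i ((c , j) ∷ l) ρ with i Finₚ.≟ j
    push-correct true i ((false , j) ∷ l) ρ | yes ≡.refl = sym (cancelˡ _ _)
    push-correct false i ((true , j) ∷ l) ρ | yes ≡.refl = sym (cancelˡ′ _ _)
    push-correct true i ((true , j) ∷ l) ρ | yes _ = refl
    push-correct false i ((false , j) ∷ l) ρ | yes _ = refl
    push-correct true i ((true , j) ∷ l) ρ | no _ = refl
    push-correct true i ((false , j) ∷ l) ρ | no _ = refl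
    push-correct false i ((true , j) ∷ l) ρ | no _ = refl
    push-correct false i ((false , j) ∷ l) ρ | no _ = refl

    -- The Boolean tells whether e or its inverse is written in front of l.
    normalise : ∀ {n} → Bool → Expr n → List (Bool × Fin n) → List (Bool × Fin n)
    normalise b (var i) l = push b i l
    normalise b :ε l = l
    normalise true (e :∙ f) l = normalise true e (normalise true f l)
    normalise false (e :∙ f) l = normalise false f (normalise false e l)
    normalise true (e :⁻¹) l = normalise false e l
    normalise false (e :⁻¹) l = normalise true e l

    signed : Bool → Carrier → Carrier
    signed true x = x
    signed false x = x ⁻¹

    normalise-correct : ∀ {n} b (e : Expr n) l ρ →
      ⟦ normalise b e l ⟧ₗ ρ ≈ signed b (⟦ e ⟧ ρ) ∙ ⟦ l ⟧ₗ ρ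
    normalise-correct true (var i) l ρ = push-correct true i l ρ
    normalise-correct false (var i) l ρ = push-correct false i l ρ
    normalise-correct true :ε l ρ = sym (identityˡ _)
    normalise-correct false :ε l ρ = sym (trans (∙-congʳ ε⁻¹≈ε) (identityˡ _))
    normalise-correct true (e :∙ f) l ρ = begin
      ⟦ normalise true e (normalise true f l) ⟧ₗ ρ ≈⟨ normalise-correct true e _ ρ ⟩
      ⟦ e ⟧ ρ ∙ ⟦ normalise true f l ⟧ₗ ρ ≈⟨ ∙-congˡ (normalise-correct true f l ρ) ⟩
      ⟦ e ⟧ ρ ∙ (⟦ f ⟧ ρ ∙ ⟦ l ⟧ₗ ρ) ≈⟨ assoc _ _ _ ⟨
      ⟦ e ⟧ ρ ∙ ⟦ f ⟧ ρ ∙ ⟦ l ⟧ₗ ρ ∎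
    normalise-correct false (e :∙ f) l ρ = begin
      ⟦ normalise false f (normalise false e l) ⟧ₗ ρ ≈⟨ normalise-correct false f _ ρ ⟩
      ⟦ f ⟧ ρ ⁻¹ ∙ ⟦ normalise false e l ⟧ₗ ρ ≈⟨ ∙-congˡ (normalise-correct false e l ρ) ⟩
      ⟦ f ⟧ ρ ⁻¹ ∙ (⟦ e ⟧ ρ ⁻¹ ∙ ⟦ l ⟧ₗ ρ) ≈⟨ assoc _ _ _ ⟨
      ⟦ f ⟧ ρ ⁻¹ ∙ ⟦ e ⟧ ρ ⁻¹ ∙ ⟦ l ⟧ₗ ρ ≈⟨ ∙-congʳ (⁻¹-anti-homo-∙ _ _) ⟨
      (⟦ e ⟧ ρ ∙ ⟦ f ⟧ ρ) ⁻¹ ∙ ⟦ l ⟧ₗ ρ ∎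
    normalise-correct true (e :⁻¹) l ρ = normalise-correct false e l ρ
    normalise-correct false (e :⁻¹) l ρ =
      trans (normalise-correct true e l ρ) (∙-congʳ (sym (⁻¹-involutive _)))

    ⟦_⇓⟧ : ∀ {n} → Expr n → Vec Carrier n → Carrier
    ⟦ e ⇓⟧ ρ = ⟦ normalise true e [] ⟧ₗ ρ

    correct : ∀ {n} (e : Expr n) ρ → ⟦ e ⇓⟧ ρ ≈ ⟦ e ⟧ ρ
    correct e ρ = trans (normalise-correct true e [] ρ) (identityʳ _)

  open import Relation.Binary.Reflection setoid var ⟦_⟧ ⟦_⇓⟧ correct public
    using (solve) renaming (_⊜_ to _:=_)

-- Finite fields

module FiniteSetoid (S : Setoid 0ℓ 0ℓ) {n : ℕ} (card : Bijection S (≡.setoid (Fin n))) where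
  open Setoid S
  open Bijection card public using (to) renaming (cong to to-cong; injective to to-injective; surjective to to-surjective)

  from : Fin n → Carrier
  from i = proj₁ (to-surjective i)

  to∘from : ∀ i → to (from i) ≡ i
  to∘from i = proj₂ (to-surjective i) (Setoid.refl S)

  from∘to : ∀ x → from (to x) ≈ x
  from∘to x = to-injective (to∘from (to x))

  from-injective : ∀ {i j} → from i ≈ from j → i ≡ j
  from-injective {i} {j} eq = ≡.trans (≡.sym (to∘from i)) (≡.trans (to-cong eq) (to∘from j))

  infix 4 _≟_
  abstract
   _≟_ : Decidable _≈_
   x ≟ y = map′ to-injective to-cong (to x Finₚ.≟ to y)

  -- Finite search replaces excluded middle here; `∃x^m≉1` uses it to turn a bound on the number of
  -- roots into an explicit non-root.
  all-or-counterexample : {P : Carrier → Set} → (∀ x → Dec (P x)) →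
    (∀ {x y} → x ≈ y → P x → P y) → (∀ x → P x) ⊎ (Σ[ x ∈ Carrier ] ¬ P x)
  all-or-counterexample P? resp with Finₚ.all? (P? ∘ from)
  ... | yes p = inj₁ (λ x → resp (from∘to x) (p (to x)))
  ... | no ¬p with Finₚ.¬∀⟶∃¬ _ _ (P? ∘ from) ¬p
  ...   | i , ¬pi = inj₂ (from i , ¬pi)

  -- Carries a bijection of the set over to its indices, where sums and products over all elements
  -- can be permuted.
  reindex : (g g⁻¹ : Carrier → Carrier) → (∀ {x y} → x ≈ y → g x ≈ g y) →
    (∀ {x y} → x ≈ y → g⁻¹ x ≈ g⁻¹ y) → (∀ x → g (g⁻¹ x) ≈ x) → (∀ x → g⁻¹ (g x) ≈ x) →
    Permutation′ n
  reindex g g⁻¹ g-cong g⁻¹-cong gg⁻¹ g⁻¹g =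
    permutation (to ∘ g ∘ from) (to ∘ g⁻¹ ∘ from)
      (λ i → ≡.trans (to-cong (trans (g-cong (from∘to _)) (gg⁻¹ _))) (to∘from i))
      (λ i → ≡.trans (to-cong (trans (g⁻¹-cong (from∘to _)) (g⁻¹g _))) (to∘from i))

module FieldProperties (F : Field 0ℓ 0ℓ) where
  open Field F hiding (zero)
  open import Algebra.Properties.CommutativeSemiring.Exp commutativeSemiring public
  open RingSolver commutativeRing public
  open import Relation.Binary.Reasoning.Setoid setoid


  *-cancelˡ : ∀ x {y z} → ¬ (x ≈ 0#) → x * y ≈ x * z → y ≈ z
  *-cancelˡ x {y} {z} x≉0 eq = begin
    y             ≈⟨ *-identityˡ y ⟨
    1# * y        ≈⟨ *-congʳ xx⁻¹ ⟨
    x * x⁻¹ * y   ≈⟨ lem x x⁻¹ y ⟩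
    x⁻¹ * (x * y) ≈⟨ *-congˡ eq ⟩
    x⁻¹ * (x * z) ≈⟨ lem x x⁻¹ z ⟨
    x * x⁻¹ * z   ≈⟨ *-congʳ xx⁻¹ ⟩
    1# * z        ≈⟨ *-identityˡ z ⟩
    z             ∎
    where
    x⁻¹ = proj₁ (inverse x x≉0)
    xx⁻¹ = proj₂ (inverse x x≉0)
    lem : ∀ a b c → a * b * c ≈ b * (a * c)
    lem = solve 3 (λ a b c → a :* b :* c := b :* (a :* c)) refl

  *-nonzero : ∀ {x y} → ¬ (x ≈ 0#) → ¬ (y ≈ 0#) → ¬ (x * y ≈ 0#)
  *-nonzero {x} x≉0 y≉0 xy≈0 = y≉0 (*-cancelˡ x x≉0 (trans xy≈0 (sym (zeroʳ x))))

  ^-nonzero : ∀ {x} n → ¬ (x ≈ 0#) → ¬ (x ^ n ≈ 0#)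
  ^-nonzero zero x≉0 = 0≉1 ∘ sym
  ^-nonzero (suc n) x≉0 = *-nonzero x≉0 (^-nonzero n x≉0)

  1≉0 : ¬ (1# ≈ 0#)
  1≉0 = 0≉1 ∘ sym

  1^n≈1 : ∀ n → 1# ^ n ≈ 1#
  1^n≈1 zero = refl
  1^n≈1 (suc n) = trans (*-identityˡ _) (1^n≈1 n)

  -‿≈0⇒≈ : ∀ {x y} → x - y ≈ 0# → x ≈ y
  -‿≈0⇒≈ {x} {y} eq = begin
    x         ≈⟨ lem x y ⟩
    x - y + y ≈⟨ +-congʳ eq ⟩
    0# + y    ≈⟨ +-identityˡ y ⟩
    y         ∎
    where
    lem : ∀ a b → a ≈ a - b + b
    lem = solve 2 (λ a b → a := a :- b :+ b) refl

  ≈⇒-‿≈0 : ∀ {x y} → x ≈ y → x - y ≈ 0#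
  ≈⇒-‿≈0 {x} {y} eq = trans (+-congʳ eq) (-‿inverseʳ y)

  -- A list c₀ ∷ … ∷ cₙ₋₁ stands for the monic polynomial xⁿ + cₙ₋₁ xⁿ⁻¹ + … + c₀.
  eval : List Carrier → Carrier → Carrier
  eval [] x = 1#
  eval (c ∷ cs) x = c + x * eval cs x

  -- Horner's scheme: the coefficients of the quotient by x - r are the intermediate values at r.
  -- The quotient is again monic, of degree one less, and `eval (c ∷ cs) r` is the remainder.
  quot : Carrier → Carrier → List Carrier → List Carrier
  quot r c [] = []
  quot r c (d ∷ ds) = eval (d ∷ ds) r ∷ quot r d ds

  length-quot : ∀ r c cs → length (quot r c cs) ≡ length cs
  length-quot r c [] = ≡.refl
  length-quot r c (d ∷ ds) = ≡.cong suc (length-quot r d ds)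

  eval-quot : ∀ r c cs x → eval (c ∷ cs) x - eval (c ∷ cs) r ≈ (x - r) * eval (quot r c cs) x
  eval-quot r c [] x = lem c x r 1#
    where
    -- `o` stands for `1#`; the identity holds for any value of it, so it enters as a variable.
    lem : ∀ c x r o → c + x * o - (c + r * o) ≈ (x - r) * o
    lem = solve 4 (λ c x r o → c :+ x :* o :- (c :+ r :* o) := (x :- r) :* o) refl
  eval-quot r c (d ∷ ds) x = begin
    c + x * m - (c + r * m′)              ≈⟨ lem₁ c x m r m′ ⟩
    (x - r) * m′ + x * (m - m′)           ≈⟨ +-congˡ (*-congˡ (eval-quot r d ds x)) ⟩
    (x - r) * m′ + x * ((x - r) * k)      ≈⟨ lem₂ x r m′ k ⟩
    (x - r) * (m′ + x * k)                ∎
    where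
    m = eval (d ∷ ds) x
    m′ = eval (d ∷ ds) r
    k = eval (quot r d ds) x
    lem₁ : ∀ c x m r m′ → c + x * m - (c + r * m′) ≈ (x - r) * m′ + x * (m - m′)
    lem₁ = solve 5 (λ c x m r m′ → c :+ x :* m :- (c :+ r :* m′) := (x :- r) :* m′ :+ x :* (m :- m′)) refl
    lem₂ : ∀ x r m k → (x - r) * m + x * ((x - r) * k) ≈ (x - r) * (m + x * k)
    lem₂ = solve 4 (λ x r m k → (x :- r) :* m :+ x :* ((x :- r) :* k) := (x :- r) :* (m :+ x :* k)) refl

  -- Divide by x - r for the first root r: every other root differs from r, so cancelling x - r
  -- shows it to be a root of the quotient.
  roots-≤-degree : ∀ p xs → AllPairs (λ x y → ¬ (x ≈ y)) xs →
    All (λ x → eval p x ≈ 0#) xs → length xs ℕ.≤ length p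
  roots-≤-degree p [] _ _ = z≤n
  roots-≤-degree [] (x ∷ xs) _ (1≈0 ∷ _) = ⊥-elim (0≉1 (sym 1≈0))
  roots-≤-degree (c ∷ cs) (r ∷ xs) (r≉xs ∷ distinct) (pr ∷ pxs) =
    s≤s (subst (length xs ℕ.≤_) (length-quot r c cs)
      (roots-≤-degree (quot r c cs) xs distinct (All.zipWith root (r≉xs , pxs))))
    where
    root : ∀ {x} → (¬ (r ≈ x)) × (eval (c ∷ cs) x ≈ 0#) → eval (quot r c cs) x ≈ 0#
    root {x} (r≉x , px) = *-cancelˡ (x - r) (r≉x ∘ sym ∘ -‿≈0⇒≈) (begin
      (x - r) * eval (quot r c cs) x      ≈⟨ eval-quot r c cs x ⟨
      eval (c ∷ cs) x - eval (c ∷ cs) r   ≈⟨ ≈⇒-‿≈0 (trans px (sym pr)) ⟩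
      0#                                  ≈⟨ zeroʳ _ ⟨
      (x - r) * 0#                        ∎)

  eval-replicate : ∀ n x → eval (replicate n 0#) x ≈ x ^ n
  eval-replicate zero x = refl
  eval-replicate (suc n) x = trans (+-identityˡ _) (*-congˡ (eval-replicate n x))

  roots-of-unity-≤ : ∀ n xs → AllPairs (λ x y → ¬ (x ≈ y)) xs →
    All (λ x → x ^ suc n ≈ 1#) xs → length xs ℕ.≤ suc n
  roots-of-unity-≤ n xs distinct roots =
    subst (length xs ℕ.≤_) (≡.cong suc (length-replicate n))
      -- The list encodes x^(n+1) - 1; the leading coefficient is implicit.
      (roots-≤-degree (- 1# ∷ replicate n 0#) xs distinct (All.map root roots))
    where
    root : ∀ {x} → x ^ suc n ≈ 1# → eval (- 1# ∷ replicate n 0#) x ≈ 0#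
    root {x} eq = begin
      - 1# + x * eval (replicate n 0#) x ≈⟨ +-congˡ (*-congˡ (eval-replicate n x)) ⟩
      - 1# + x ^ suc n                   ≈⟨ +-congˡ eq ⟩
      - 1# + 1#                          ≈⟨ -‿inverseˡ 1# ⟩
      0#                                 ∎

module FiniteField (F : Field 0ℓ 0ℓ) (n : ℕ)
  (card : Bijection (Field.setoid F) (≡.setoid (Fin (suc n)))) where
  open Field F hiding (zero)
  open FieldProperties F
  open FiniteSetoid setoid card public
  open import Relation.Binary.Reasoning.Setoid setoid
  open import Algebra.Properties.CommutativeMonoid.Sum +-commutativeMonoid as Sum using (sum)
  open import Algebra.Properties.CommutativeMonoid.Sum *-commutativeMonoid as Prod using () renaming (sum to prod)
  open import Algebra.Properties.Monoid.Mult +-monoid using () renaming (_×_ to _·_)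
  open import Algebra.Properties.Group +-group using (identityʳ-unique)

  -- Adding x permutes the field, so it leaves the sum of all elements unchanged, while changing it
  -- formally by q · x.
  q·x≈0 : ∀ x → suc n · x ≈ 0#
  q·x≈0 x = identityʳ-unique (sum from) _ (begin
    sum from + suc n · x           ≈⟨ +-congˡ (Sum.sum-replicate (suc n)) ⟨
    sum from + sum {suc n} (λ _ → x) ≈⟨ Sum.∑-distrib-+ from (λ _ → x) ⟨
    sum (λ i → from i + x)         ≈⟨ Sum.sum-cong-≋ (λ i → sym (from∘to (from i + x))) ⟩
    sum (λ i → from (π ⟨$⟩ʳ i))    ≈⟨ Sum.sum-permute from π ⟨
    sum from                       ∎)
    where
    lem₁ : ∀ x y → y - x + x ≈ y
    lem₁ = solve 2 (λ x y → y :- x :+ x := y) refl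
    lem₂ : ∀ x y → y + x - x ≈ y
    lem₂ = solve 2 (λ x y → y :+ x :- x := y) refl
    π = reindex (_+ x) (_- x) +-congʳ +-congʳ (lem₁ x) (lem₂ x)

  private
    -- Lets a product over the nonzero elements run over all indices: the factor belonging to 0
    -- becomes 1.
    orOne : Carrier → Carrier → Carrier
    orOne y x with x ≟ 0#
    ... | yes _ = 1#
    ... | no _ = y

    orOne-zero : ∀ y {x} → x ≈ 0# → orOne y x ≈ 1#
    orOne-zero y {x} x≈0 with x ≟ 0#
    ... | yes _ = refl
    ... | no x≉0 = ⊥-elim (x≉0 x≈0)

    orOne-nonzero : ∀ y {x} → ¬ (x ≈ 0#) → orOne y x ≈ y
    orOne-nonzero y {x} x≉0 with x ≟ 0#
    ... | yes x≈0 = ⊥-elim (x≉0 x≈0)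
    ... | no _ = refl

    orOne-≉0 : ∀ x → ¬ (orOne x x ≈ 0#)
    orOne-≉0 x with x ≟ 0#
    ... | yes _ = 1≉0
    ... | no x≉0 = x≉0

    orOne-* : ∀ a → ¬ (a ≈ 0#) → ∀ x → orOne (a * x) (a * x) ≈ orOne a x * orOne x x
    orOne-* a a≉0 x with x ≟ 0#
    ... | yes x≈0 = trans (orOne-zero (a * x) (trans (*-congˡ x≈0) (zeroʳ a))) (sym (*-identityˡ 1#))
    ... | no x≉0 = orOne-nonzero (a * x) (*-nonzero a≉0 x≉0)

    orOne-cong : ∀ {x y} → x ≈ y → orOne x x ≈ orOne y y
    orOne-cong {x} {y} x≈y with x ≟ 0#
    ... | yes x≈0 = sym (orOne-zero y (trans (sym x≈y) x≈0))
    ... | no x≉0 = trans x≈y (sym (orOne-nonzero y (x≉0 ∘ trans x≈y)))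

    prod-nonzero : ∀ {m} (f : Fin m → Carrier) → (∀ i → ¬ (f i ≈ 0#)) → ¬ (prod f ≈ 0#)
    prod-nonzero {zero} f nz = 1≉0
    prod-nonzero {suc m} f nz = *-nonzero (nz zero) (prod-nonzero (f ∘ suc) (nz ∘ suc))

  -- Multiplication by a permutes the nonzero elements, so their product P satisfies P · a^(q-1) =
  -- P, and P can be cancelled.
  x^[q-1]≈1 : ∀ a → ¬ (a ≈ 0#) → a ^ n ≈ 1#
  x^[q-1]≈1 a a≉0 = *-cancelˡ P P≉0 (begin
    P * a ^ n                              ≈⟨ *-comm _ _ ⟩
    a ^ n * P                              ≈⟨ *-congʳ prod-orOne ⟨
    prod (λ i → orOne a (from i)) * P      ≈⟨ Prod.∑-distrib-+ (λ i → orOne a (from i)) (λ i → orOne (from i) (from i)) ⟨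
    prod (λ i → orOne a (from i) * orOne (from i) (from i))
      ≈⟨ Prod.sum-cong-≋ (λ i → sym (trans (orOne-cong (from∘to _)) (orOne-* a a≉0 (from i)))) ⟩
    prod (λ i → orOne (from (π ⟨$⟩ʳ i)) (from (π ⟨$⟩ʳ i))) ≈⟨ Prod.sum-permute (λ i → orOne (from i) (from i)) π ⟨
    P                                      ≈⟨ *-identityʳ P ⟨
    P * 1#                                 ∎)
    where
    a⁻¹ = proj₁ (inverse a a≉0)
    aa⁻¹ = proj₂ (inverse a a≉0)
    P = prod (λ i → orOne (from i) (from i))
    P≉0 : ¬ (P ≈ 0#)
    P≉0 = prod-nonzero _ (λ i → orOne-≉0 (from i))
    lem₁ : ∀ x → a * (a⁻¹ * x) ≈ x
    lem₁ x = trans (sym (*-assoc _ _ _)) (trans (*-congʳ aa⁻¹) (*-identityˡ x))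
    lem₂ : ∀ x → a⁻¹ * (a * x) ≈ x
    lem₂ x = trans (sym (*-assoc _ _ _)) (trans (*-congʳ (trans (*-comm _ _) aa⁻¹)) (*-identityˡ x))
    π = reindex (a *_) (a⁻¹ *_) *-congˡ *-congˡ lem₁ lem₂
    i₀ = to 0#
    prod-orOne : prod (λ i → orOne a (from i)) ≈ a ^ n
    prod-orOne = begin
      prod (λ i → orOne a (from i)) ≈⟨ Prod.sum-remove {i = i₀} (λ i → orOne a (from i)) ⟩
      orOne a (from i₀) * prod (λ i → orOne a (from (punchIn i₀ i)))
        ≈⟨ *-cong (orOne-zero a (from∘to 0#)) (Prod.sum-cong-≋ λ i → orOne-nonzero a
             (λ eq → Finₚ.punchInᵢ≢i i₀ i (from-injective (trans eq (sym (from∘to 0#)))))) ⟩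
      1# * prod {n} (λ _ → a)    ≈⟨ *-identityˡ _ ⟩
      prod {n} (λ _ → a)         ≈⟨ Prod.sum-replicate n ⟩
      a ^ n                      ∎

  x^q≈x : ∀ x → x ^ suc n ≈ x
  x^q≈x x with x ≟ 0#
  ... | yes x≈0 = trans (*-congʳ x≈0) (trans (zeroˡ _) (sym x≈0))
  ... | no x≉0 = trans (*-congˡ (x^[q-1]≈1 x x≉0)) (*-identityʳ x)

  ∃x^m≉1 : ∀ m → suc m ℕ.< n → Σ[ x ∈ Carrier ] (¬ (x ≈ 0#)) × (¬ (x ^ suc m ≈ 1#))
  ∃x^m≉1 m m<n with all-or-counterexample {λ x → x ^ suc (suc m) ≈ x} (λ x → x ^ suc (suc m) ≟ x)
      (λ x≈y eq → trans (^-congˡ (suc (suc m)) (sym x≈y)) (trans eq x≈y))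
  ... | inj₂ (x , neq) = x
      , (λ x≈0 → neq (trans (*-congʳ x≈0) (trans (zeroˡ _) (sym x≈0))))
      , (λ eq → neq (trans (*-congˡ eq) (*-identityʳ x)))
  ... | inj₁ all = ⊥-elim (ℕₚ.<⇒≱ m<n (ℕ.s≤s⁻¹ (≡.subst₂ ℕ._≤_ (length-tabulate from)
          (≡.cong (λ k → suc (suc k)) (length-replicate m {0#}))
          -- The polynomial x^(m+2) - x, which includes 0 among its roots, would have q = n + 1 > m
          -- + 2 of them.
          (roots-≤-degree (0# ∷ - 1# ∷ replicate m 0#) (tabulate from)
            (AllPairsₚ.tabulate⁺ (λ i≢j eq → i≢j (from-injective eq)))
            (Allₚ.tabulate⁺ (λ i → root (from i)))))))
    where
    lem : ∀ x y o → x * (- o + y) ≈ x * y - x * o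
    lem = solve 3 (λ x y o → x :* (:- o :+ y) := x :* y :- x :* o) refl
    root : ∀ x → eval (0# ∷ - 1# ∷ replicate m 0#) x ≈ 0#
    root x = begin
      0# + x * (- 1# + x * eval (replicate m 0#) x) ≈⟨ +-congˡ (*-congˡ (+-congˡ (*-congˡ (eval-replicate m x)))) ⟩
      0# + x * (- 1# + x ^ suc m) ≈⟨ +-identityˡ _ ⟩
      x * (- 1# + x ^ suc m) ≈⟨ lem x _ 1# ⟩
      x ^ suc (suc m) - x * 1# ≈⟨ ≈⇒-‿≈0 (trans (all x) (sym (*-identityʳ x))) ⟩
      0# ∎

-- The extended triangle group

pattern 𝟘 = zero
pattern 𝟙 = suc zero
pattern 𝟚 = suc (suc zero)

Cancel-++ : ∀ z t {u v} → Cancel u v → Cancel (z ++ (u ++ t)) (z ++ (v ++ t))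
Cancel-++ z t (cancel x i y) = ≡.subst₂ Cancel (eq (i ∷ i ∷ y)) (eq y) (cancel (z ++ x) i (y ++ t))
  where
  eq : ∀ w → (z ++ x) ++ (w ++ t) ≡ z ++ ((x ++ w) ++ t)
  eq w = ≡.trans (Listₚ.++-assoc z x (w ++ t)) (≡.cong (z ++_) (≡.sym (Listₚ.++-assoc x w t)))

Δ-setoid = EqC.setoid Cancel

Cancel-reverse : ∀ {u v} → Cancel u v → Cancel (reverse u) (reverse v)
Cancel-reverse (cancel x i y) = ≡.subst₂ Cancel
  (≡.sym (≡.trans (Listₚ.reverse-++ x (i ∷ i ∷ y)) (≡.trans (≡.cong (_++ reverse x) (Listₚ.reverse-++ (i ∷ i ∷ []) y))
    (Listₚ.++-assoc (reverse y) _ _))))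
  (≡.sym (Listₚ.reverse-++ x y)) (cancel (reverse y) i (reverse x))

reverse-inverseˡ : ∀ w → reverse w ++ w ≈Δ []
reverse-inverseˡ [] = EqC.reflexive Cancel
reverse-inverseˡ (i ∷ w) = EqC.transitive Cancel
  (subst (_≈Δ reverse w ++ w)
    (≡.sym (≡.trans (≡.cong (_++ i ∷ w) (Listₚ.unfold-reverse i w)) (Listₚ.++-assoc (reverse w) _ _)))
    (EqC.return (cancel (reverse w) i w)))
  (reverse-inverseˡ w)

Δ : Group 0ℓ 0ℓ
Δ = record
  { Carrier = Word
  ; _≈_ = _≈Δ_
  ; _∙_ = _++_
  ; ε = []
  ; _⁻¹ = reverse
  ; isGroup = record
    { isMonoid = record
      { isSemigroup = record
        { isMagma = record
          { isEquivalence = EqC.isEquivalence Cancel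
          ; ∙-cong = λ {u} {v} {w} {t} u≈v w≈t → EqC.transitive Cancel
              (EqC.gmap (_++ w) (Cancel-++ [] w) u≈v)
              (≡.subst₂ _≈Δ_ (≡.cong (v ++_) (Listₚ.++-identityʳ w)) (≡.cong (v ++_) (Listₚ.++-identityʳ t))
                (EqC.gmap (λ s → v ++ (s ++ [])) (Cancel-++ v []) w≈t))
          }
        ; assoc = λ u v w → reflexive (Listₚ.++-assoc u v w)
        }
      ; identity = (λ u → EqC.reflexive Cancel) , (λ u → reflexive (Listₚ.++-identityʳ u))
      }
    ; inverse = reverse-inverseˡ , λ w → subst (λ v → v ++ reverse w ≈Δ []) (Listₚ.reverse-involutive w) (reverse-inverseˡ (reverse w))
    ; ⁻¹-cong = EqC.gmap reverse Cancel-reverse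
    }
  }
  where
  reflexive : ∀ {u v} → u ≡ v → u ≈Δ v
  reflexive ≡.refl = EqC.reflexive Cancel

private
  module Δ = Group Δ

-- Since r₂ is its own reverse, this is conjugation by r₂.
mirror : Word → Word
mirror w = r₂ ∷ (w ++ (r₂ ∷ []))

mirror-mirror : ∀ u → mirror (mirror u) ≈Δ u
mirror-mirror u = solve 2 (λ r u → r :⁻¹ :∙ (r :∙ (u :∙ r :⁻¹) :∙ r) := u) Δ.refl (r₂ ∷ []) u
  where open GroupSolver Δ

even-+ : ∀ {m n} → Even m → Even n → Even (m ℕ.+ n)
even-+ (k , ≡.refl) (l , ≡.refl) = k ℕ.+ l , lem k l
  where
  lem : ∀ k l → k ℕ.+ k ℕ.+ (l ℕ.+ l) ≡ k ℕ.+ l ℕ.+ (k ℕ.+ l)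
  lem = solve-∀

even-++ : ∀ {u v} → InΔ⁺ u → InΔ⁺ v → InΔ⁺ (u ++ v)
even-++ {u} {v} eu ev = subst Even (≡.sym (Listₚ.length-++ u)) (even-+ eu ev)

even-reverse : ∀ {u} → InΔ⁺ u → InΔ⁺ (reverse u)
even-reverse {u} = subst Even (≡.sym (Listₚ.length-reverse u))

even-mirror : ∀ {u} → InΔ⁺ u → InΔ⁺ (mirror u)
even-mirror {u} eu = subst Even (≡.cong suc (≡.sym (≡.trans (Listₚ.length-++ u) (ℕₚ.+-comm (length u) 1))))
  (even-+ (1 , ≡.refl) eu)

even-tail : ∀ {n} → Even (suc (suc n)) → Even n
even-tail (suc k , eq) = k , ℕₚ.suc-injective (ℕₚ.suc-injective (≡.trans eq (≡.cong suc (ℕₚ.+-suc k k))))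

module _ (G : Group 0ℓ 0ℓ) where
  open Group G
  open GroupSolver G
  open import Algebra.Properties.Group G using (inverseʳ-unique)
  open import Relation.Binary.Reasoning.Setoid setoid

  -- In `φ-resp` the two evenness proofs are unrelated; for equal words it therefore says that the
  -- value does not depend on the proof.
  record Δ⁺-Hom : Set where
    field
      φ : ∀ w → InΔ⁺ w → Carrier
      φ-resp : ∀ {u v} eu ev → u ≈Δ v → φ u eu ≈ φ v ev
      φ-++ : ∀ u v eu ev euv → φ (u ++ v) euv ≈ φ u eu ∙ φ v ev

    φ-[] : ∀ e → φ [] e ≈ ε
    φ-[] e = begin
      φ [] e                       ≈⟨ solve 1 (λ x → x := x :⁻¹ :∙ (x :∙ x)) refl _ ⟩
      φ [] e ⁻¹ ∙ (φ [] e ∙ φ [] e)  ≈⟨ ∙-congˡ (φ-++ [] [] e e e) ⟨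
      φ [] e ⁻¹ ∙ φ [] e            ≈⟨ inverseˡ _ ⟩
      ε                            ∎

    φ₂ : Fin 3 → Fin 3 → Carrier
    φ₂ i j = φ (i ∷ j ∷ []) (1 , ≡.refl)

    φ₂-compose : ∀ i j k → φ₂ i j ∙ φ₂ j k ≈ φ₂ i k
    φ₂-compose i j k = trans
      (sym (φ-++ (i ∷ j ∷ []) (j ∷ k ∷ []) (1 , ≡.refl) (1 , ≡.refl) (2 , ≡.refl)))
      (φ-resp (2 , ≡.refl) (1 , ≡.refl) (EqC.return (cancel (i ∷ []) j (k ∷ []))))

    φ₂-diag : ∀ i → φ₂ i i ≈ ε
    φ₂-diag i = trans (φ-resp (1 , ≡.refl) (0 , ≡.refl) (EqC.return (cancel [] i []))) (φ-[] _)

    -- s extends the homomorphism to the full triangle group by r₂ ↦ s.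
    module Extension (s : Carrier) (s² : s ∙ s ≈ ε)
      (s₁² : (φ₂ 𝟙 𝟚 ∙ s) ∙ (φ₂ 𝟙 𝟚 ∙ s) ≈ ε) (s₀² : (s ∙ φ₂ 𝟚 𝟘) ∙ (s ∙ φ₂ 𝟚 𝟘) ≈ ε) where

      -- Forced by r₀ = r₂ (r₂ r₀) and r₁ = (r₁ r₂) r₂. The hypotheses on `s` say that the three
      -- images square to `ε`, which are all the relations of Δ.
      gen : Fin 3 → Carrier
      gen 𝟘 = s ∙ φ₂ 𝟚 𝟘
      gen 𝟙 = φ₂ 𝟙 𝟚 ∙ s
      gen 𝟚 = s

      gen² : ∀ i → gen i ∙ gen i ≈ ε
      gen² 𝟘 = s₀²
      gen² 𝟙 = s₁²
      gen² 𝟚 = s²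

      -- Both sides are the inverse of the image of r_i r_j, so three of the nine products follow
      -- from their transposes.
      gen-φ₂-sym : ∀ i j → gen i ∙ gen j ≈ φ₂ i j → gen j ∙ gen i ≈ φ₂ j i
      gen-φ₂-sym i j eq = begin
        gen j ∙ gen i              ≈⟨ inverseʳ-unique (gen i ∙ gen j) _ (begin
          gen i ∙ gen j ∙ (gen j ∙ gen i)  ≈⟨ solve 3 (λ x y z → x :∙ y :∙ (y :∙ z) := x :∙ (y :∙ y) :∙ z) refl _ _ _ ⟩
          gen i ∙ (gen j ∙ gen j) ∙ gen i  ≈⟨ ∙-congʳ (trans (∙-congˡ (gen² j)) (identityʳ _)) ⟩
          gen i ∙ gen i                    ≈⟨ gen² i ⟩
          ε                                ∎) ⟩
        (gen i ∙ gen j) ⁻¹         ≈⟨ ⁻¹-cong eq ⟩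
        φ₂ i j ⁻¹                  ≈⟨ inverseʳ-unique _ _ (trans (φ₂-compose i j i) (φ₂-diag i)) ⟨
        φ₂ j i                     ∎

      gen-φ₂ : ∀ i j → gen i ∙ gen j ≈ φ₂ i j
      gen-φ₂ 𝟘 𝟘 = trans s₀² (sym (φ₂-diag 𝟘))
      gen-φ₂ 𝟙 𝟙 = trans s₁² (sym (φ₂-diag 𝟙))
      gen-φ₂ 𝟚 𝟚 = trans s² (sym (φ₂-diag 𝟚))
      gen-φ₂ 𝟙 𝟚 = trans (assoc _ _ _) (trans (∙-congˡ s²) (identityʳ _))
      gen-φ₂ 𝟚 𝟘 = trans (sym (assoc _ _ _)) (trans (∙-congʳ s²) (identityˡ _))
      gen-φ₂ 𝟙 𝟘 = begin
        φ₂ 𝟙 𝟚 ∙ s ∙ (s ∙ φ₂ 𝟚 𝟘)   ≈⟨ solve 3 (λ x y z → x :∙ y :∙ (y :∙ z) := x :∙ (y :∙ y) :∙ z) refl _ _ _ ⟩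
        φ₂ 𝟙 𝟚 ∙ (s ∙ s) ∙ φ₂ 𝟚 𝟘   ≈⟨ ∙-congʳ (trans (∙-congˡ s²) (identityʳ _)) ⟩
        φ₂ 𝟙 𝟚 ∙ φ₂ 𝟚 𝟘             ≈⟨ φ₂-compose 𝟙 𝟚 𝟘 ⟩
        φ₂ 𝟙 𝟘                      ∎
      gen-φ₂ 𝟚 𝟙 = gen-φ₂-sym 𝟙 𝟚 (gen-φ₂ 𝟙 𝟚)
      gen-φ₂ 𝟘 𝟚 = gen-φ₂-sym 𝟚 𝟘 (gen-φ₂ 𝟚 𝟘)
      gen-φ₂ 𝟘 𝟙 = gen-φ₂-sym 𝟙 𝟘 (gen-φ₂ 𝟙 𝟘)

      Ψ : Word → Carrier
      Ψ [] = ε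
      Ψ (i ∷ w) = gen i ∙ Ψ w

      Ψ-++ : ∀ u v → Ψ (u ++ v) ≈ Ψ u ∙ Ψ v
      Ψ-++ [] v = sym (identityˡ _)
      Ψ-++ (i ∷ u) v = trans (∙-congˡ (Ψ-++ u v)) (sym (assoc _ _ _))

      -- An even word is read two letters at a time, and on pairs the claim is `gen-φ₂`.
      Ψ≈φ : ∀ w e → Ψ w ≈ φ w e
      Ψ≈φ [] e = sym (φ-[] e)
      Ψ≈φ (i ∷ []) (suc (suc k) , ())
      Ψ≈φ (i ∷ []) (suc zero , ())
      Ψ≈φ (i ∷ j ∷ w) e = begin
        gen i ∙ (gen j ∙ Ψ w)      ≈⟨ assoc _ _ _ ⟨
        gen i ∙ gen j ∙ Ψ w        ≈⟨ ∙-cong (gen-φ₂ i j) (Ψ≈φ w (even-tail e)) ⟩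
        φ₂ i j ∙ φ w (even-tail e) ≈⟨ φ-++ (i ∷ j ∷ []) w _ _ e ⟨
        φ (i ∷ j ∷ w) e            ∎

      -- Once extended to Δ, the homomorphism turns `mirror` into conjugation by `s`, which
      -- preserves triviality.
      kernel-mirror : ∀ w e e′ → φ w e ≈ ε → φ (mirror w) e′ ≈ ε
      kernel-mirror w e e′ eq = begin
        φ (mirror w) e′         ≈⟨ Ψ≈φ (mirror w) e′ ⟨
        s ∙ Ψ (w ++ r₂ ∷ [])    ≈⟨ ∙-congˡ (Ψ-++ w (r₂ ∷ [])) ⟩
        s ∙ (Ψ w ∙ (s ∙ ε))     ≈⟨ ∙-congˡ (∙-cong (trans (Ψ≈φ w e) eq) (identityʳ s)) ⟩
        s ∙ (ε ∙ s)             ≈⟨ ∙-congˡ (identityˡ s) ⟩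
        s ∙ s                   ≈⟨ s² ⟩
        ε                       ∎

-- Generalised dihedral groups

module Dihedral (A : AbelianGroup 0ℓ 0ℓ) where
  open AbelianGroup A
  open import Algebra.Properties.AbelianGroup A using (⁻¹-∙-comm)
  open import Algebra.Properties.Group group using (⁻¹-involutive; ε⁻¹≈ε)

  infix 8 _^ˢ_
  _^ˢ_ : Carrier → Sign → Carrier
  x ^ˢ Sign.+ = x
  x ^ˢ Sign.- = x ⁻¹

  ^ˢ-cong : ∀ s {x y} → x ≈ y → x ^ˢ s ≈ y ^ˢ s
  ^ˢ-cong Sign.+ eq = eq
  ^ˢ-cong Sign.- eq = ⁻¹-cong eq

  ^ˢ-∙ : ∀ s x y → (x ∙ y) ^ˢ s ≈ x ^ˢ s ∙ y ^ˢ s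
  ^ˢ-∙ Sign.+ x y = refl
  ^ˢ-∙ Sign.- x y = sym (⁻¹-∙-comm x y)

  ^ˢ-* : ∀ s t x → x ^ˢ (s Sign.* t) ≈ (x ^ˢ t) ^ˢ s
  ^ˢ-* Sign.+ t x = refl
  ^ˢ-* Sign.- Sign.+ x = refl
  ^ˢ-* Sign.- Sign.- x = sym (⁻¹-involutive x)

  ε^ˢ : ∀ s → ε ^ˢ s ≈ ε
  ε^ˢ Sign.+ = refl
  ε^ˢ Sign.- = ε⁻¹≈ε

  inv : Carrier × Sign → Carrier × Sign
  inv (a , s) = (a ⁻¹) ^ˢ s , s

  Dih : Group 0ℓ 0ℓ
  Dih = record
    { Carrier = Carrier × Sign
    ; _≈_ = λ { (a , s) (b , t) → (a ≈ b) × (s ≡ t) }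
    ; _∙_ = λ { (a , s) (b , t) → a ∙ b ^ˢ s , s Sign.* t }
    ; ε = ε , Sign.+
    ; _⁻¹ = inv
    ; isGroup = record
      { isMonoid = record
        { isSemigroup = record
          { isMagma = record
            { isEquivalence = record
              { refl = refl , ≡.refl
              ; sym = λ { (p , q) → sym p , ≡.sym q }
              ; trans = λ { (p , q) (p′ , q′) → trans p p′ , ≡.trans q q′ }
              }
            ; ∙-cong = λ { {_ , s} (p , ≡.refl) (p′ , ≡.refl) → ∙-cong p (^ˢ-cong s p′) , ≡.refl }
            }
          ; assoc = λ { (a , s) (b , t) (c , u) →
              trans (assoc _ _ _) (∙-congˡ (trans (∙-congˡ (^ˢ-* s t c)) (sym (^ˢ-∙ s _ _))))
              , Signₚ.*-assoc s t u }
          }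
        ; identity = (λ { (a , s) → identityˡ a , ≡.refl })
            , (λ { (a , s) → trans (∙-congˡ (ε^ˢ s)) (identityʳ a) , Signₚ.*-identityʳ s })
        }
      ; inverse = (λ { (a , Sign.+) → inverseˡ a , ≡.refl
                     ; (a , Sign.-) → trans (∙-congʳ (⁻¹-involutive a)) (inverseʳ a) , ≡.refl })
          , (λ { (a , Sign.+) → inverseʳ a , ≡.refl
               ; (a , Sign.-) → trans (∙-congˡ (⁻¹-cong (⁻¹-involutive a))) (inverseʳ a) , ≡.refl })
      ; ⁻¹-cong = λ { {_ , s} (p , ≡.refl) → ^ˢ-cong s (⁻¹-cong p) , ≡.refl }
      }
    }

  private module D = Group Dih

  reflection² : ∀ x → proj₂ x ≡ Sign.- → (x D.∙ x) D.≈ D.ε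
  reflection² (a , .Sign.-) ≡.refl = inverseʳ a , ≡.refl

  -- Any two elements of a generalised dihedral group are simultaneously inverted
  -- by some inner automorphism, so these quotients of Δ⁺ are reflexible.
  kernel-mirror : (h : Δ⁺-Hom Dih) → let open Δ⁺-Hom h in
    ∀ w e e′ → φ w e D.≈ D.ε → φ (mirror w) e′ D.≈ D.ε
  kernel-mirror h = choose (proj₂ x) (proj₂ y) ≡.refl ≡.refl
    where
    open Δ⁺-Hom h
    x y : D.Carrier
    x = φ₂ 𝟙 𝟚
    y = φ₂ 𝟚 𝟘
    choose : ∀ σ τ → proj₂ x ≡ σ → proj₂ y ≡ τ →
      ∀ w e e′ → φ w e D.≈ D.ε → φ (mirror w) e′ D.≈ D.ε
    -- In all four cases `s` is such that s, x s and s y square to `ε`: a reflection if x and y are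
    -- both rotations, the one reflection among them if there is just one, and `ε` if both are
    -- reflections.
    choose Sign.+ Sign.+ σ τ = Extension.kernel-mirror (ε , Sign.-) (reflection² _ ≡.refl)
      (reflection² (x D.∙ _) (≡.cong (Sign._* Sign.-) σ)) (reflection² (_ D.∙ y) (≡.cong (Sign.- Sign.*_) τ))
    choose Sign.- Sign.+ σ τ = Extension.kernel-mirror x (reflection² x σ)
      (D.trans (D.∙-cong (reflection² x σ) (reflection² x σ)) (D.identityˡ _))
      (reflection² (x D.∙ y) (≡.cong₂ Sign._*_ σ τ))
    choose Sign.+ Sign.- σ τ = Extension.kernel-mirror y (reflection² y τ)
      (reflection² (x D.∙ y) (≡.cong₂ Sign._*_ σ τ))
      (D.trans (D.∙-cong (reflection² y τ) (reflection² y τ)) (D.identityˡ _))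
    choose Sign.- Sign.- σ τ = Extension.kernel-mirror D.ε (D.identityˡ _)
      (reflection² (x D.∙ D.ε) (≡.cong (Sign._* Sign.+) σ)) (reflection² (D.ε D.∙ y) τ)

-- Obstructions

-- The chirality group is also H / (H ∩ Hʳ), through h ↦ f (r₂ h r₂); conjugation makes Δ⁺ act on it.
module ConjugationAction (X : Magma 0ℓ 0ℓ) (H : Word → Set)
  (isH : HypermapSubgroup H) (iso : ChiralityIso H (Magma.rawMagma X)) where
  open Magma X
  open HypermapSubgroup isH
  open ChiralityIso iso
  open import Relation.Binary.Reasoning.Setoid setoid
  open GroupSolver Δ

  private
    r : Word
    r = r₂ ∷ []

    resp′ : ∀ {u v} → v ≈Δ u → H u → H v
    resp′ eq = resp (Δ.sym eq)

    conj : Word → Word → Word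
    conj g h = g ++ (h ++ reverse g)

    normal′ : ∀ g {u} → InΔ⁺ g → H u → H (conj g u)
    normal′ g = normal {g}

    f-resp : ∀ u v pu pv → u ≈Δ v → f u pu ≈ f v pv
    f-resp u v pu pv eq = Equivalence.from (ker u v pu pv)
      (resp′ (Δ.trans (Δ.∙-congˡ (Δ.sym eq)) (Δ.inverseˡ u)) has-unit)

    mirror∈ : ∀ h → H h → (H ·ʳ) (mirror h)
    mirror∈ h Hh = [] , mirror h , has-unit , (h , Hh , Δ.refl) , Δ.refl

    mirror-cong : ∀ {u v} → u ≈Δ v → mirror u ≈Δ mirror v
    mirror-cong {u} {v} eq = Δ.∙-congˡ {r} {u ++ r} {v ++ r} (Δ.∙-congʳ {r} {u} {v} eq)

    mirror-++ : ∀ u v → mirror (u ++ v) ≈Δ mirror u ++ mirror v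
    mirror-++ u v = solve 3 (λ r u v → r :∙ (u :∙ v :∙ r :⁻¹) := r :∙ (u :∙ r :⁻¹) :∙ (r :∙ (v :∙ r :⁻¹))) Δ.refl r u v

  F : ∀ h → H h → Carrier
  F h Hh = f (mirror h) (mirror∈ h Hh)

  F-resp : ∀ {u v} Hu Hv → u ≈Δ v → F u Hu ≈ F v Hv
  F-resp {u} {v} Hu Hv eq = f-resp (mirror u) (mirror v) (mirror∈ u Hu) (mirror∈ v Hv) (mirror-cong {u} {v} eq)

  F-++ : ∀ u v Hu Hv Huv → F (u ++ v) Huv ≈ F u Hu ∙ F v Hv
  F-++ u v Hu Hv Huv = trans (f-resp (mirror (u ++ v)) (mirror u ++ mirror v) (mirror∈ (u ++ v) Huv) p (mirror-++ u v))
    (hom (mirror u) (mirror v) (mirror∈ u Hu) (mirror∈ v Hv) p)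
    where
    p : (H ·ʳ) (mirror u ++ mirror v)
    p = [] , mirror u ++ mirror v , has-unit , (u ++ v , Huv , Δ.sym (mirror-++ u v)) , Δ.refl

  -- An element of H Hʳ is h₁ · `mirror h`; by normality of H it has the same coset as `mirror h`
  -- alone.
  F-surjective : ∀ c → Σ[ h ∈ Word ] Σ[ Hh ∈ H h ] F h Hh ≈ c
  F-surjective c with surjective c
  ... | w , p@(h₁ , k , Hh₁ , (h , Hh , k≈) , w≈) , fw≈c = h , Hh , trans (sym fw≈Fh) fw≈c
    where
    g = reverse (mirror h)
    fw≈Fh : f w p ≈ F h Hh
    fw≈Fh = Equivalence.from (ker w (mirror h) p (mirror∈ h Hh)) (resp′
      (Δ.trans {reverse w ++ mirror h} {reverse (h₁ ++ mirror h) ++ mirror h} {conj g (reverse h₁)}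
        (Δ.∙-congʳ {mirror h} {reverse w} {reverse (h₁ ++ mirror h)} (Δ.⁻¹-cong {w} {h₁ ++ mirror h}
          (Δ.trans {w} {h₁ ++ k} {h₁ ++ mirror h} w≈ (Δ.∙-congˡ {h₁} {k} {mirror h} k≈))))
        (solve 2 (λ h₁ k → (h₁ :∙ k) :⁻¹ :∙ k := k :⁻¹ :∙ (h₁ :⁻¹ :∙ k :⁻¹ :⁻¹)) Δ.refl h₁ (mirror h)))
      (normal′ g (even-reverse {mirror h} (even-mirror {h} (⊆Δ⁺ Hh))) (inv {h₁} Hh₁)))

  -- The mirror image of a conjugate by g is a conjugate by `mirror g`; normality of H under the
  -- latter keeps the two values equal.
  F-conj : ∀ g u v (eg : InΔ⁺ g) Hu Hv → F u Hu ≈ F v Hv →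
    F (conj g u) (normal′ g eg Hu) ≈ F (conj g v) (normal′ g eg Hv)
  F-conj g u v eg Hu Hv eq = Equivalence.from (ker _ _ (mirror∈ (conj g u) (normal′ g eg Hu)) (mirror∈ (conj g v) (normal′ g eg Hv))) (resp′
    (solve 4 (λ r g u v → (r :∙ ((g :∙ (u :∙ g :⁻¹)) :∙ r :⁻¹)) :⁻¹ :∙ (r :∙ ((g :∙ (v :∙ g :⁻¹)) :∙ r :⁻¹)) :=
       (r :∙ (g :∙ r :⁻¹)) :∙ (((r :∙ (u :∙ r :⁻¹)) :⁻¹ :∙ (r :∙ (v :∙ r :⁻¹))) :∙ (r :∙ (g :∙ r :⁻¹)) :⁻¹))
      Δ.refl r g u v)
    (normal′ (mirror g) (even-mirror {g} eg) (Equivalence.to (ker _ _ (mirror∈ u Hu) (mirror∈ v Hv)) eq)))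

  abstract
    private
      lift : Carrier → Word
      lift c = proj₁ (F-surjective c)

      lift∈ : ∀ c → H (lift c)
      lift∈ c = proj₁ (proj₂ (F-surjective c))

      F-lift : ∀ c → F (lift c) (lift∈ c) ≈ c
      F-lift c = proj₂ (proj₂ (F-surjective c))

    -- Conjugation by g, carried out on a chosen preimage under `F`; by `F-conj` any other preimage
    -- gives the same value.
    α : ∀ g → InΔ⁺ g → Carrier → Carrier
    α g eg c = F (conj g (lift c)) (normal′ g eg (lift∈ c))

    α-F : ∀ g eg h (Hh : H h) → α g eg (F h Hh) ≈ F (conj g h) (normal′ g eg Hh)
    α-F g eg h Hh = F-conj g (lift (F h Hh)) h eg (lift∈ (F h Hh)) Hh (F-lift (F h Hh))

    α-cong : ∀ g eg {c d} → c ≈ d → α g eg c ≈ α g eg d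
    α-cong g eg {c} {d} c≈d = F-conj g (lift c) (lift d) eg (lift∈ c) (lift∈ d) (trans (F-lift c) (trans c≈d (sym (F-lift d))))

    α-resp : ∀ {u v} eu ev c → u ≈Δ v → α u eu c ≈ α v ev c
    α-resp {u} {v} eu ev c u≈v = F-resp {conj u (lift c)} {conj v (lift c)} (normal′ u eu (lift∈ c)) (normal′ v ev (lift∈ c))
      (Δ.∙-cong {u} {v} {lift c ++ reverse u} {lift c ++ reverse v} u≈v
        (Δ.∙-congˡ {lift c} {reverse u} {reverse v} (Δ.⁻¹-cong {u} {v} u≈v)))

    α-∙ : ∀ g eg c d → α g eg (c ∙ d) ≈ α g eg c ∙ α g eg d
    α-∙ g eg c d = begin
      α g eg (c ∙ d)
        ≈⟨ F-conj g (lift (c ∙ d)) (lift c ++ lift d) eg (lift∈ (c ∙ d)) Hcd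
             (trans (F-lift (c ∙ d)) (sym (trans (F-++ (lift c) (lift d) (lift∈ c) (lift∈ d) Hcd) (∙-cong (F-lift c) (F-lift d))))) ⟩
      F (conj g (lift c ++ lift d)) (normal′ g eg Hcd)
        ≈⟨ F-resp {conj g (lift c ++ lift d)} {conj g (lift c) ++ conj g (lift d)} (normal′ g eg Hcd) Hcd′
             (solve 3 (λ g c d → g :∙ ((c :∙ d) :∙ g :⁻¹) := (g :∙ (c :∙ g :⁻¹)) :∙ (g :∙ (d :∙ g :⁻¹)))
               Δ.refl g (lift c) (lift d)) ⟩
      F (conj g (lift c) ++ conj g (lift d)) Hcd′
        ≈⟨ F-++ (conj g (lift c)) (conj g (lift d)) (normal′ g eg (lift∈ c)) (normal′ g eg (lift∈ d)) Hcd′ ⟩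
      α g eg c ∙ α g eg d ∎
      where
      Hcd : H (lift c ++ lift d)
      Hcd = mul (lift∈ c) (lift∈ d)
      Hcd′ : H (conj g (lift c) ++ conj g (lift d))
      Hcd′ = mul (normal′ g eg (lift∈ c)) (normal′ g eg (lift∈ d))

    α-++ : ∀ u v eu ev euv c → α (u ++ v) euv c ≈ α u eu (α v ev c)
    α-++ u v eu ev euv c = begin
      α (u ++ v) euv c
        ≈⟨ F-resp {conj (u ++ v) (lift c)} {conj u (conj v (lift c))} (normal′ (u ++ v) euv (lift∈ c))
             (normal′ u eu (normal′ v ev (lift∈ c)))
             (solve 3 (λ u v c → (u :∙ v) :∙ (c :∙ (u :∙ v) :⁻¹) := u :∙ ((v :∙ (c :∙ v :⁻¹)) :∙ u :⁻¹)) Δ.refl u v (lift c)) ⟩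
      F (conj u (conj v (lift c))) (normal′ u eu (normal′ v ev (lift∈ c)))
        ≈⟨ α-F u eu (conj v (lift c)) (normal′ v ev (lift∈ c)) ⟨
      α u eu (α v ev c) ∎

    α-[] : ∀ e c → α [] e c ≈ c
    α-[] e c = trans (F-resp {conj [] (lift c)} {lift c} (normal′ [] e (lift∈ c)) (lift∈ c) (Δ.identityʳ (lift c))) (F-lift c)

    -- The inner automorphism by `F h`, written without inverses because the target is only a magma
    -- here.
    α-inner : ∀ h eh (Hh : H h) c → α h eh c ∙ F h Hh ≈ F h Hh ∙ c
    α-inner h eh Hh c = begin
      α h eh c ∙ F h Hh                ≈⟨ F-++ (conj h (lift c)) h (normal′ h eh (lift∈ c)) Hh H₁ ⟨
      F (conj h (lift c) ++ h) H₁
        ≈⟨ F-resp {conj h (lift c) ++ h} {h ++ lift c} H₁ H₂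
             (solve 2 (λ h c → h :∙ (c :∙ h :⁻¹) :∙ h := h :∙ c) Δ.refl h (lift c)) ⟩
      F (h ++ lift c) H₂               ≈⟨ F-++ h (lift c) Hh (lift∈ c) H₂ ⟩
      F h Hh ∙ F (lift c) (lift∈ c)    ≈⟨ ∙-cong refl (F-lift c) ⟩
      F h Hh ∙ c                       ∎
      where
      H₁ : H (conj h (lift c) ++ h)
      H₁ = mul (normal′ h eh (lift∈ c)) Hh
      H₂ : H (h ++ lift c)
      H₂ = mul Hh (lift∈ c)

    -- H and Hʳ are both normal in Δ⁺, so their commutators lie in H ∩ Hʳ, the kernel of `F`.
    α-mirror : ∀ h e → H h → ∀ c → α (mirror h) e c ≈ c
    α-mirror h e Hh c = trans (Equivalence.from (ker _ _ (mirror∈ (conj (mirror h) (lift c)) (normal′ (mirror h) e (lift∈ c))) (mirror∈ (lift c) (lift∈ c))) (resp′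
      -- With k the mirror image of the lifted word, the element to be placed in H is h · k⁻¹ h⁻¹ k.
      (solve 3 (λ r h c → (r :⁻¹ :∙ (((r :∙ (h :∙ r :⁻¹)) :∙ (c :∙ (r :∙ (h :∙ r :⁻¹)) :⁻¹)) :∙ r)) :⁻¹ :∙ (r :⁻¹ :∙ (c :∙ r))
          := h :∙ ((r :⁻¹ :∙ (c :∙ r)) :⁻¹ :∙ (h :⁻¹ :∙ ((r :⁻¹ :∙ (c :∙ r)) :⁻¹) :⁻¹)))
        Δ.refl r h (lift c))
      (mul Hh (normal′ (reverse (mirror (lift c))) (even-reverse {mirror (lift c)} (even-mirror {lift c} (⊆Δ⁺ (lift∈ c)))) (inv {h} Hh)))))
      (F-lift c)

    α-inverse : ∀ g eg c → α (reverse g) (even-reverse {g} eg) (α g eg c) ≈ c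
    α-inverse g eg c = begin
      α (reverse g) eg⁻¹ (α g eg c)   ≈⟨ α-++ (reverse g) g eg⁻¹ eg e c ⟨
      α (reverse g ++ g) e c          ≈⟨ α-resp {reverse g ++ g} {[]} e (0 , ≡.refl) c (Δ.inverseˡ g) ⟩
      α [] (0 , ≡.refl) c             ≈⟨ α-[] (0 , ≡.refl) c ⟩
      c                               ∎
      where
      eg⁻¹ : InΔ⁺ (reverse g)
      eg⁻¹ = even-reverse {g} eg
      e : InΔ⁺ (reverse g ++ g)
      e = even-++ {reverse g} {g} eg⁻¹ eg

    α-injective : ∀ g eg {c d} → α g eg c ≈ α g eg d → c ≈ d
    α-injective g eg {c} {d} eq = begin
      c                               ≈⟨ α-inverse g eg c ⟨
      α (reverse g) eg⁻¹ (α g eg c)   ≈⟨ α-cong (reverse g) eg⁻¹ eq ⟩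
      α (reverse g) eg⁻¹ (α g eg d)   ≈⟨ α-inverse g eg d ⟩
      d                               ∎
      where
      eg⁻¹ : InΔ⁺ (reverse g)
      eg⁻¹ = even-reverse {g} eg

-- Affine groups and their automorphisms

module _ (F : Field 0ℓ 0ℓ) where
  open Field F hiding (zero)
  open FieldProperties F

  Units : AbelianGroup 0ℓ 0ℓ
  Units = record
    { Carrier = Σ[ x ∈ Carrier ] ¬ (x ≈ 0#)
    ; _≈_ = λ x y → proj₁ x ≈ proj₁ y
    ; _∙_ = λ { (x , x≉0) (y , y≉0) → x * y , *-nonzero x≉0 y≉0 }
    ; ε = 1# , 1≉0
    ; _⁻¹ = λ { (x , x≉0) → proj₁ (inverse x x≉0) , λ x⁻¹≈0 →
        1≉0 (trans (sym (proj₂ (inverse x x≉0))) (trans (*-congˡ x⁻¹≈0) (zeroʳ x))) }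
    ; isAbelianGroup = record
      { isGroup = record
        { isMonoid = record
          { isSemigroup = record
            { isMagma = record
              { isEquivalence = record { refl = refl ; sym = sym ; trans = trans }
              ; ∙-cong = *-cong
              }
            ; assoc = λ _ _ _ → *-assoc _ _ _
            }
          ; identity = (λ _ → *-identityˡ _) , (λ _ → *-identityʳ _)
          }
        ; inverse = (λ { (x , x≉0) → trans (*-comm _ _) (proj₂ (inverse x x≉0)) })
                  , (λ { (x , x≉0) → proj₂ (inverse x x≉0) })
        ; ⁻¹-cong = λ { {x , x≉0} {y , y≉0} x≈y → *-cancelˡ x x≉0
            (trans (proj₂ (inverse x x≉0)) (trans (sym (proj₂ (inverse y y≉0))) (*-congʳ (sym x≈y)))) }
        }
      ; comm = λ _ _ → *-comm _ _
      }
    }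

  AGL : Magma 0ℓ 0ℓ
  AGL = record
    { Carrier = X.Carrier
    ; _≈_ = X._≈_
    ; _∙_ = X._∙_
    ; isMagma = record
      { isEquivalence = record
        { refl = refl , refl
        ; sym = λ { (p , q) → sym p , sym q }
        ; trans = λ { (p , q) (p′ , q′) → trans p p′ , trans q q′ }
        }
      ; ∙-cong = λ { (p , q) (p′ , q′) → *-cong p p′ , +-cong (*-cong p q′) q }
      }
    }
    where module X = RawMagma (AGL₁ F)

  -- There are at most two nontrivial ℓ-th roots of unity, and two distinct ones are inverse to each
  -- other. So an automorphism of these roots either fixes or inverts them all, and no generator has
  -- to be named.
  SmallRoots : ℕ → Set
  SmallRoots ℓ = ∀ x y → x ^ ℓ ≈ 1# → y ^ ℓ ≈ 1# → ¬ (x ≈ 1#) → ¬ (y ≈ 1#) → (x ≈ y) ⊎ (x * y ≈ 1#)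

-- Here q = `suc n` and m = (q - 1)/ℓ, so m-th powers of units are ℓ-th roots of unity; x₀ witnesses
-- that not all of them are 1.
module Obstruction (F : Field 0ℓ 0ℓ) (n : ℕ)
  (card : Bijection (Field.setoid F) (≡.setoid (Fin (suc n))))
  (ℓ m : ℕ) (mℓ≡n : m ℕ.* ℓ ≡ n)
  (μ-small : SmallRoots F ℓ)
  (x₀ : Field.Carrier F) (x₀≉0 : ¬ Field._≈_ F x₀ (Field.0# F))
  (x₀^m≉1 : ¬ Field._≈_ F (FieldProperties._^_ F x₀ m) (Field.1# F))
  (H : Word → Set) (isH : HypermapSubgroup H) (iso : ChiralityIso H (AGL₁ F)) where

  open Field F hiding (zero)
  open FieldProperties F
  open FiniteField F n card using (_≟_; q·x≈0; x^[q-1]≈1; x^q≈x)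
  open import Algebra.Properties.Monoid.Mult +-monoid using () renaming (_×_ to _·_)
  open import Algebra.Properties.Group +-group using (∙-cancelˡ)
  open import Relation.Binary.Reasoning.Setoid setoid
  private
    module X = Magma (AGL F)
    module U = AbelianGroup (Units F)
  open ConjugationAction (AGL F) H isH iso renaming (F to Φ)
  open Dihedral (Units F)

  private
    slope offset : X.Carrier → Carrier
    slope x = proj₁ (proj₁ x)
    offset x = proj₂ (proj₁ x)

    translation : Carrier → X.Carrier
    translation b = (1# , b) , 1≉0

    scaling : U.Carrier → X.Carrier
    scaling (a , a≉0) = (a , 0#) , a≉0

    -- `pow⁺ k x` is the power x^(k+1), so `pow⁺ n` is the q-th power.
    pow⁺ : ℕ → X.Carrier → X.Carrier
    pow⁺ zero x = x
    pow⁺ (suc k) x = x X.∙ pow⁺ k x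

    slope-pow⁺ : ∀ k x → slope (pow⁺ k x) ≈ slope x ^ suc k
    slope-pow⁺ zero x = sym (*-identityʳ _)
    slope-pow⁺ (suc k) x = *-congˡ (slope-pow⁺ k x)

    pow⁺-translation : ∀ k b → pow⁺ k (translation b) X.≈ translation (suc k · b)
    pow⁺-translation zero b = refl , sym (+-identityʳ b)
    pow⁺-translation (suc k) b with pow⁺-translation k b
    ... | p , q = trans (*-identityˡ _) p , trans (+-congʳ (trans (*-identityˡ _) q)) (+-comm _ _)

  module _ (g : Word) (eg : InΔ⁺ g) where
    private
      αg = α g eg

    α-pow⁺ : ∀ k x → αg (pow⁺ k x) X.≈ pow⁺ k (αg x)
    α-pow⁺ zero x = X.refl {αg x}
    α-pow⁺ (suc k) x = X.trans {αg (x X.∙ pow⁺ k x)} {αg x X.∙ αg (pow⁺ k x)} {αg x X.∙ pow⁺ k (αg x)}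
      (α-∙ g eg x (pow⁺ k x)) (X.∙-cong {αg x} {αg x} {αg (pow⁺ k x)} {pow⁺ k (αg x)} (X.refl {αg x}) (α-pow⁺ k x))

    -- The image e of the identity is idempotent; comparing slopes and then offsets in e e = e gives
    -- slope 1 and offset 0.
    α-identity : αg (translation 0#) X.≈ translation 0#
    α-identity = slope≈1 , ∙-cancelˡ (offset e) _ _ (begin
        offset e + offset e              ≈⟨ +-congʳ (trans (*-congʳ slope≈1) (*-identityˡ _)) ⟨
        slope e * offset e + offset e    ≈⟨ proj₂ e∙e≈e ⟩
        offset e                         ≈⟨ +-identityʳ _ ⟨
        offset e + 0#                    ∎)
      where
      t₀ = translation 0#
      e = αg t₀
      e∙e≈e : e X.∙ e X.≈ e
      e∙e≈e = X.trans {e X.∙ e} {αg (t₀ X.∙ t₀)} {e} (X.sym {αg (t₀ X.∙ t₀)} {e X.∙ e} (α-∙ g eg t₀ t₀))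
        (α-cong g eg {t₀ X.∙ t₀} {t₀} (*-identityˡ 1# , trans (+-identityʳ _) (zeroʳ 1#)))
      slope≈1 : slope e ≈ 1#
      slope≈1 = *-cancelˡ _ (proj₂ e) (trans (proj₁ e∙e≈e) (sym (*-identityʳ _)))

    -- Translations are the elements whose q-th power is trivial.
    α-translation : ∀ b → slope (αg (translation b)) ≈ 1#
    α-translation b = begin
      slope y                             ≈⟨ x^q≈x _ ⟨
      slope y ^ suc n                     ≈⟨ slope-pow⁺ n y ⟨
      slope (pow⁺ n y)                    ≈⟨ proj₁ (α-pow⁺ n (translation b)) ⟨
      slope (αg (pow⁺ n (translation b)))
        ≈⟨ proj₁ (α-cong g eg {pow⁺ n (translation b)} {translation 0#}
             (X.trans {pow⁺ n (translation b)} {translation (suc n · b)} {translation 0#} (pow⁺-translation n b) (refl , q·x≈0 b))) ⟩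
      slope (αg (translation 0#))         ≈⟨ proj₁ α-identity ⟩
      1#                                  ∎
      where y = αg (translation b)

    β : Carrier → Carrier
    β b = offset (αg (translation b))

    τ : U.Carrier → Carrier
    τ a = slope (αg (scaling a))

    -- An affine map is its linear part followed by a translation, and translations keep slope 1
    -- under `αg`.
    slope-α : ∀ x → slope (αg x) ≈ τ (slope x , proj₂ x)
    slope-α x = begin
      slope (αg x)
        ≈⟨ proj₁ (α-cong g eg {x} {translation (offset x) X.∙ a}
             (sym (*-identityˡ _) , sym (trans (+-congʳ (zeroʳ 1#)) (+-identityˡ _)))) ⟩
      slope (αg (translation (offset x) X.∙ a))        ≈⟨ proj₁ (α-∙ g eg (translation (offset x)) a) ⟩
      slope (αg (translation (offset x))) * slope (αg a)  ≈⟨ *-congʳ (α-translation _) ⟩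
      1# * slope (αg a)                                 ≈⟨ *-identityˡ _ ⟩
      slope (αg a)                                      ∎
      where a = scaling (slope x , proj₂ x)

    τ-cong : ∀ {x y} → x U.≈ y → τ x ≈ τ y
    τ-cong {x} {y} x≈y = proj₁ (α-cong g eg {scaling x} {scaling y} (x≈y , refl))

    τ-* : ∀ x y → τ (x U.∙ y) ≈ τ x * τ y
    τ-* x y = trans (proj₁ (α-cong g eg {scaling (x U.∙ y)} {scaling x X.∙ scaling y}
      (refl , sym (trans (+-identityʳ _) (zeroʳ _))))) (proj₁ (α-∙ g eg (scaling x) (scaling y)))

    τ-1 : τ U.ε ≈ 1#
    τ-1 = proj₁ α-identity

    τ-^ : ∀ k x nz → τ (proj₁ x ^ k , nz) ≈ τ x ^ k
    τ-^ zero x nz = τ-1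
    τ-^ (suc k) x nz = begin
      τ (proj₁ x * proj₁ x ^ k , nz)        ≈⟨ τ-cong {_ , nz} {x U.∙ xᵏ} refl ⟩
      τ (x U.∙ xᵏ)                          ≈⟨ τ-* x xᵏ ⟩
      τ x * τ xᵏ                            ≈⟨ *-congˡ (τ-^ k x (proj₂ xᵏ)) ⟩
      τ x * τ x ^ k                         ∎
      where
      xᵏ : U.Carrier
      xᵏ = proj₁ x ^ k , ^-nonzero k (proj₂ x)

    -- Apply `αg` to the identity (t ↦ t + ab) ∘ (t ↦ at) = (t ↦ at) ∘ (t ↦ t + b) and compare
    -- offsets; that of the image of t ↦ at occurs on both sides.
    β-* : ∀ a b → β (proj₁ a * b) ≈ τ a * β b
    β-* a b = ∙-cancelˡ (offset s) _ _ (begin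
      offset s + β (proj₁ a * b)            ≈⟨ +-congʳ (trans (*-congʳ (α-translation _)) (*-identityˡ _)) ⟨
      slope (αg (translation (proj₁ a * b))) * offset s + β (proj₁ a * b)
        ≈⟨ proj₂ (α-∙ g eg (translation (proj₁ a * b)) (scaling a)) ⟨
      offset (αg (translation (proj₁ a * b) X.∙ scaling a))
        ≈⟨ proj₂ (α-cong g eg {translation (proj₁ a * b) X.∙ scaling a} {scaling a X.∙ translation b} (*-comm _ _ ,
             trans (+-congʳ (zeroʳ 1#)) (+-comm _ _))) ⟩
      offset (αg (scaling a X.∙ translation b)) ≈⟨ proj₂ (α-∙ g eg (scaling a) (translation b)) ⟩
      τ a * β b + offset s                      ≈⟨ +-comm _ _ ⟩
      offset s + τ a * β b                      ∎)
      where s = αg (scaling a)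

    β1≉0 : ¬ (β 1# ≈ 0#)
    β1≉0 β1≈0 = 1≉0 (proj₂ (α-injective g eg {translation 1#} {translation 0#}
      (X.trans {αg (translation 1#)} {translation 0#} {αg (translation 0#)} (α-translation 1# , β1≈0)
        (X.sym {αg (translation 0#)} {translation 0#} α-identity))))

    u : U.Carrier
    u = β 1# , β1≉0

  β-cong : ∀ g eg {x y} → x ≈ y → β g eg x ≈ β g eg y
  β-cong g eg {x} {y} x≈y = proj₂ (α-cong g eg {translation x} {translation y} (refl , x≈y))

  -- The crossed homomorphism property with respect to τ: β_g is applied to u(g′) = u(g′) · 1, and τ
  -- takes out the factor u(g′).
  u-++ : ∀ g g′ eg eg′ e → proj₁ (u (g ++ g′) e) ≈ τ g eg (u g′ eg′) * proj₁ (u g eg)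
  u-++ g g′ eg eg′ e = begin
    β (g ++ g′) e 1#                   ≈⟨ proj₂ (α-++ g g′ eg eg′ e (translation 1#)) ⟩
    offset (α g eg (α g′ eg′ (translation 1#)))
      ≈⟨ proj₂ (α-cong g eg {α g′ eg′ (translation 1#)} {translation (proj₁ (u g′ eg′))} (α-translation g′ eg′ 1# , refl)) ⟩
    β g eg (proj₁ (u g′ eg′))          ≈⟨ β-cong g eg (*-identityʳ _) ⟨
    β g eg (proj₁ (u g′ eg′) * 1#)     ≈⟨ β-* g eg (u g′ eg′) 1# ⟩
    τ g eg (u g′ eg′) * β g eg 1#      ∎

  τ-++ : ∀ g g′ eg eg′ e x → τ (g ++ g′) e x ≈ τ g eg (τ g′ eg′ x , proj₂ (α g′ eg′ (scaling x)))
  τ-++ g g′ eg eg′ e x = trans (proj₁ (α-++ g g′ eg eg′ e (scaling x))) (slope-α g eg _)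

  ζ : U.Carrier
  ζ = x₀ ^ m , ^-nonzero m x₀≉0

  ^m-root : ∀ x → ¬ (x ≈ 0#) → (x ^ m) ^ ℓ ≈ 1#
  ^m-root x x≉0 = begin
    (x ^ m) ^ ℓ     ≈⟨ ^-assocʳ x m ℓ ⟩
    x ^ (m ℕ.* ℓ)   ≡⟨ ≡.cong (x ^_) mℓ≡n ⟩
    x ^ n           ≈⟨ x^[q-1]≈1 x x≉0 ⟩
    1#              ∎

  private
    toSign : ∀ {P : Set} → Dec P → Sign
    toSign (yes _) = Sign.+
    toSign (no _) = Sign.-

  -- If ζ is its own inverse, as for ℓ = 2, fixing and inverting coincide and this choice always
  -- gives +.
  sign : ∀ g → InΔ⁺ g → Sign
  sign g eg = toSign (τ g eg ζ ≟ proj₁ ζ)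

  private
    inverse-unique : ∀ (x y : U.Carrier) → proj₁ x * proj₁ y ≈ 1# → proj₁ y ≈ proj₁ (x U.⁻¹)
    inverse-unique x y xy≈1 = *-cancelˡ _ (proj₂ x) (trans xy≈1 (sym (U.inverseʳ x)))

  module _ (g : Word) (eg : InΔ⁺ g) where

    -- τ ζ is again a nontrivial ℓ-th root of unity, so `SmallRoots` leaves only the inverse of ζ.
    τζ*ζ≈1 : ¬ (τ g eg ζ ≈ proj₁ ζ) → τ g eg ζ * proj₁ ζ ≈ 1#
    τζ*ζ≈1 τζ≉ζ = case (μ-small (τ g eg ζ) (proj₁ ζ) τζ-root (^m-root x₀ x₀≉0) τζ≉1 x₀^m≉1)
      where
      eg⁻¹ : InΔ⁺ (reverse g)
      eg⁻¹ = even-reverse {g} eg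
      case : (τ g eg ζ ≈ proj₁ ζ) ⊎ (τ g eg ζ * proj₁ ζ ≈ 1#) → τ g eg ζ * proj₁ ζ ≈ 1#
      case (inj₁ τζ≈ζ) = ⊥-elim (τζ≉ζ τζ≈ζ)
      case (inj₂ eq) = eq
      ζ^ℓ : U.Carrier
      ζ^ℓ = proj₁ ζ ^ ℓ , ^-nonzero ℓ (proj₂ ζ)
      τζ-root : τ g eg ζ ^ ℓ ≈ 1#
      τζ-root = begin
        τ g eg ζ ^ ℓ   ≈⟨ τ-^ g eg ℓ ζ (proj₂ ζ^ℓ) ⟨
        τ g eg ζ^ℓ     ≈⟨ τ-cong g eg {ζ^ℓ} {U.ε} (^m-root x₀ x₀≉0) ⟩
        τ g eg U.ε     ≈⟨ τ-1 g eg ⟩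
        1#             ∎
      τζ≉1 : ¬ (τ g eg ζ ≈ 1#)
      τζ≉1 τζ≈1 = x₀^m≉1 (begin
        proj₁ ζ        ≈⟨ proj₁ (α-inverse g eg (scaling ζ)) ⟨
        slope (α (reverse g) eg⁻¹ (α g eg (scaling ζ)))  ≈⟨ slope-α (reverse g) eg⁻¹ (α g eg (scaling ζ)) ⟩
        τ (reverse g) eg⁻¹ (τ g eg ζ , proj₂ (α g eg (scaling ζ)))
          ≈⟨ τ-cong (reverse g) eg⁻¹ {τ g eg ζ , proj₂ (α g eg (scaling ζ))} {U.ε} τζ≈1 ⟩
        τ (reverse g) eg⁻¹ U.ε              ≈⟨ τ-1 (reverse g) eg⁻¹ ⟩
        1#             ∎)

    -- The action on ζ decides the action on all ℓ-th roots of unity, each of which is 1, ζ or ζ⁻¹.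
    τ-sign : ∀ z → proj₁ z ^ ℓ ≈ 1# → τ g eg z ≈ proj₁ (z ^ˢ sign g eg)
    τ-sign z z^ℓ≈1 = go (proj₁ z ≟ 1#) (τ g eg ζ ≟ proj₁ ζ)
      where
      τz : U.Carrier
      τz = τ g eg z , proj₂ (α g eg (scaling z))
      go′ : (d : Dec (τ g eg ζ ≈ proj₁ ζ)) → (proj₁ z ≈ proj₁ ζ) ⊎ (proj₁ z * proj₁ ζ ≈ 1#) →
        τ g eg z ≈ proj₁ (z ^ˢ toSign d)
      go′ (yes τζ≈ζ) (inj₁ z≈ζ) = trans (τ-cong g eg {z} {ζ} z≈ζ) (trans τζ≈ζ (sym z≈ζ))
      go′ (yes τζ≈ζ) (inj₂ zζ≈1) = *-cancelˡ (proj₁ ζ) (proj₂ ζ) (begin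
        proj₁ ζ * τ g eg z         ≈⟨ *-comm _ _ ⟩
        τ g eg z * proj₁ ζ         ≈⟨ *-congˡ τζ≈ζ ⟨
        τ g eg z * τ g eg ζ        ≈⟨ τ-* g eg z ζ ⟨
        τ g eg (z U.∙ ζ)           ≈⟨ τ-cong g eg {z U.∙ ζ} {U.ε} zζ≈1 ⟩
        τ g eg U.ε                 ≈⟨ τ-1 g eg ⟩
        1#                         ≈⟨ trans (*-comm _ _) zζ≈1 ⟨
        proj₁ ζ * proj₁ z          ∎)
      go′ (no τζ≉ζ) (inj₁ z≈ζ) = inverse-unique z τz (begin
        proj₁ z * τ g eg z         ≈⟨ *-cong z≈ζ (τ-cong g eg {z} {ζ} z≈ζ) ⟩
        proj₁ ζ * τ g eg ζ         ≈⟨ *-comm _ _ ⟩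
        τ g eg ζ * proj₁ ζ         ≈⟨ τζ*ζ≈1 τζ≉ζ ⟩
        1#                         ∎)
      go′ (no τζ≉ζ) (inj₂ zζ≈1) = inverse-unique z τz (begin
        proj₁ z * τ g eg z         ≈⟨ *-identityʳ _ ⟨
        proj₁ z * τ g eg z * 1#    ≈⟨ *-congˡ (τζ*ζ≈1 τζ≉ζ) ⟨
        proj₁ z * τ g eg z * (τ g eg ζ * proj₁ ζ)
          ≈⟨ solve 4 (λ a b c d → a :* b :* (c :* d) := b :* c :* (a :* d)) refl _ _ _ _ ⟩
        τ g eg z * τ g eg ζ * (proj₁ z * proj₁ ζ)
          ≈⟨ *-cong (trans (sym (τ-* g eg z ζ)) (trans (τ-cong g eg {z U.∙ ζ} {U.ε} zζ≈1) (τ-1 g eg))) zζ≈1 ⟩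
        1# * 1#                    ≈⟨ *-identityʳ _ ⟩
        1#                         ∎)
      go : Dec (proj₁ z ≈ 1#) → (d : Dec (τ g eg ζ ≈ proj₁ ζ)) → τ g eg z ≈ proj₁ (z ^ˢ toSign d)
      go (yes z≈1) d = begin
        τ g eg z                 ≈⟨ τ-cong g eg {z} {U.ε} z≈1 ⟩
        τ g eg U.ε               ≈⟨ τ-1 g eg ⟩
        1#                       ≈⟨ ε^ˢ (toSign d) ⟨
        proj₁ (U.ε ^ˢ toSign d)  ≈⟨ ^ˢ-cong (toSign d) {U.ε} {z} (sym z≈1) ⟩
        proj₁ (z ^ˢ toSign d)    ∎
      go (no z≉1) d = go′ d (μ-small (proj₁ z) (proj₁ ζ) z^ℓ≈1 (^m-root x₀ x₀≉0) z≉1 x₀^m≉1)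

    -- Recognises the sign from the image of ζ. The last hypothesis excludes the ambiguity ζ⁻¹ = ζ,
    -- in which the value is +.
    sign-ζ : ∀ s → τ g eg ζ ≈ proj₁ (ζ ^ˢ s) → (s ≡ Sign.- → ¬ (proj₁ (ζ ^ˢ s) ≈ proj₁ ζ)) → sign g eg ≡ s
    sign-ζ s = go s (τ g eg ζ ≟ proj₁ ζ)
      where
      go : ∀ s (d : Dec (τ g eg ζ ≈ proj₁ ζ)) → τ g eg ζ ≈ proj₁ (ζ ^ˢ s) →
        (s ≡ Sign.- → ¬ (proj₁ (ζ ^ˢ s) ≈ proj₁ ζ)) → toSign d ≡ s
      go Sign.+ (yes _) eq neq = ≡.refl
      go Sign.- (yes p) eq neq = ⊥-elim (neq ≡.refl (trans (sym eq) p))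
      go Sign.+ (no ¬p) eq neq = ⊥-elim (¬p eq)
      go Sign.- (no _) eq neq = ≡.refl

    sign≡-⇒ζ⁻¹≉ζ : sign g eg ≡ Sign.- → ¬ (proj₁ (ζ U.⁻¹) ≈ proj₁ ζ)
    sign≡-⇒ζ⁻¹≉ζ = go (τ g eg ζ ≟ proj₁ ζ)
      where
      go : (d : Dec (τ g eg ζ ≈ proj₁ ζ)) → toSign d ≡ Sign.- → ¬ (proj₁ (ζ U.⁻¹) ≈ proj₁ ζ)
      go (no ¬p) s≡- eq = ¬p (trans (inverse-unique ζ (τ g eg ζ , proj₂ (α g eg (scaling ζ)))
        (trans (*-comm _ _) (τζ*ζ≈1 ¬p))) eq)

  sign-resp : ∀ {v w} ev ew → v ≈Δ w → sign v ev ≡ sign w ew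
  sign-resp {v} {w} ev ew v≈w = sign-ζ v ev (sign w ew)
    (trans (proj₁ (α-resp ev ew (scaling ζ) v≈w)) (τ-sign w ew ζ (^m-root x₀ x₀≉0)))
    (λ s≡- eq → sign≡-⇒ζ⁻¹≉ζ w ew s≡- (≡.subst (λ s → proj₁ (ζ ^ˢ s) ≈ proj₁ ζ) s≡- eq))

  private
    *≡- : ∀ s t → s Sign.* t ≡ Sign.- → (s ≡ Sign.-) ⊎ (t ≡ Sign.-)
    *≡- Sign.+ t eq = inj₂ eq
    *≡- Sign.- t eq = inj₁ ≡.refl

    ^ˢ-root : ∀ s z → proj₁ z ^ ℓ ≈ 1# → proj₁ (z ^ˢ s) ^ ℓ ≈ 1#
    ^ˢ-root Sign.+ z eq = eq
    ^ˢ-root Sign.- z eq = begin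
      z⁻¹ ^ ℓ                    ≈⟨ *-identityˡ _ ⟨
      1# * z⁻¹ ^ ℓ               ≈⟨ *-congʳ eq ⟨
      proj₁ z ^ ℓ * z⁻¹ ^ ℓ      ≈⟨ ^-distrib-* _ _ ℓ ⟨
      (proj₁ z * z⁻¹) ^ ℓ        ≈⟨ ^-congˡ ℓ (U.inverseʳ z) ⟩
      1# ^ ℓ                     ≈⟨ 1^n≈1 ℓ ⟩
      1#                         ∎
      where z⁻¹ = proj₁ (z U.⁻¹)

  sign-++ : ∀ v w ev ew e → sign (v ++ w) e ≡ sign v ev Sign.* sign w ew
  sign-++ v w ev ew e = sign-ζ (v ++ w) e (s Sign.* t)
    (begin
      τ (v ++ w) e ζ                 ≈⟨ τ-++ v w ev ew e ζ ⟩
      τ v ev (τ w ew ζ , proj₂ (α w ew (scaling ζ)))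
        ≈⟨ τ-cong v ev {_ , proj₂ (α w ew (scaling ζ))} {ζ ^ˢ t} (τ-sign w ew ζ (^m-root x₀ x₀≉0)) ⟩
      τ v ev (ζ ^ˢ t)                ≈⟨ τ-sign v ev (ζ ^ˢ t) (^ˢ-root t ζ (^m-root x₀ x₀≉0)) ⟩
      proj₁ ((ζ ^ˢ t) ^ˢ s)          ≈⟨ ^ˢ-* s t ζ ⟨
      proj₁ (ζ ^ˢ (s Sign.* t))      ∎)
    -- If the product of signs is -, one factor is -, and that factor certifies ζ⁻¹ ≠ ζ.
    (λ st≡- eq → case (*≡- s t st≡-) (≡.subst (λ s → proj₁ (ζ ^ˢ s) ≈ proj₁ ζ) st≡- eq))
    where
    s = sign v ev
    t = sign w ew
    case : (s ≡ Sign.-) ⊎ (t ≡ Sign.-) → ¬ (proj₁ (ζ U.⁻¹) ≈ proj₁ ζ)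
    case (inj₁ s≡-) = sign≡-⇒ζ⁻¹≉ζ v ev s≡-
    case (inj₂ t≡-) = sign≡-⇒ζ⁻¹≉ζ w ew t≡-

  c : ∀ g → InΔ⁺ g → U.Carrier
  c g eg = proj₁ (u g eg) ^ m , ^-nonzero m (proj₂ (u g eg))

  -- The m-th powers of `u` are ℓ-th roots of unity, on which τ acts through `sign`; the crossed
  -- homomorphism law thus becomes multiplication in the dihedral group.
  toDih : Δ⁺-Hom Dih
  toDih = record
    { φ = λ g eg → c g eg , sign g eg
    ; φ-resp = λ ev ew v≈w → ^-congˡ m (proj₂ (α-resp ev ew (translation 1#) v≈w)) , sign-resp ev ew v≈w
    ; φ-++ = λ v w ev ew e → (begin
        proj₁ (u (v ++ w) e) ^ m                                 ≈⟨ ^-congˡ m (u-++ v w ev ew e) ⟩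
        (τ v ev (u w ew) * proj₁ (u v ev)) ^ m                   ≈⟨ ^-distrib-* _ _ m ⟩
        τ v ev (u w ew) ^ m * proj₁ (u v ev) ^ m                 ≈⟨ *-comm _ _ ⟩
        proj₁ (u v ev) ^ m * τ v ev (u w ew) ^ m                 ≈⟨ *-congˡ (τ-^ v ev m (u w ew) (proj₂ (c w ew))) ⟨
        proj₁ (u v ev) ^ m * τ v ev (c w ew)
          ≈⟨ *-congˡ (τ-sign v ev (c w ew) (^m-root _ (proj₂ (u w ew)))) ⟩
        proj₁ (u v ev) ^ m * proj₁ (c w ew ^ˢ sign v ev)         ∎)
      , sign-++ v w ev ew e
    }

  contradiction : ⊥
  contradiction with Φ-surjective
    where Φ-surjective = F-surjective ((x₀ , 0#) , x₀≉0)
  ... | h , Hh , Φh≈ = x₀^m≉1 (begin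
    x₀ ^ m                  ≈⟨ ^-congˡ m u≈x₀ ⟨
    -- It is `mirror h` that acts trivially, so h is rewritten as the mirror image of `mirror h`.
    proj₁ (u h eh) ^ m      ≈⟨ ^-congˡ m (proj₂ (α-resp eh emm (translation 1#) (Δ.sym (mirror-mirror h)))) ⟩
    proj₁ (u (mirror (mirror h)) emm) ^ m
      ≈⟨ proj₁ (kernel-mirror toDih (mirror h) em emm trivial) ⟩
    1#                      ∎)
    where
    eh = HypermapSubgroup.⊆Δ⁺ isH Hh
    em = even-mirror {h} eh
    emm = even-mirror {mirror h} em
    trivial : (proj₁ (u (mirror h) em) ^ m ≈ 1#) × (sign (mirror h) em ≡ Sign.+)
    trivial = trans (^-congˡ m (proj₂ (α-mirror h em Hh (translation 1#)))) (1^n≈1 m)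
      , sign-ζ (mirror h) em Sign.+ (proj₁ (α-mirror h em Hh (scaling ζ))) (λ ())
    -- Conjugating t ↦ t + 1 by t ↦ x₀ t gives t ↦ t + x₀; here as the offsets in `α-inner`.
    u≈x₀ : proj₁ (u h eh) ≈ x₀
    u≈x₀ = begin
      β h eh 1#                                            ≈⟨ +-identityˡ _ ⟨
      0# + β h eh 1#                                       ≈⟨ +-congʳ (trans (*-congˡ (proj₂ Φh≈)) (zeroʳ _)) ⟨
      slope (α h eh (translation 1#)) * offset (Φ h Hh) + β h eh 1#
        ≈⟨ proj₂ (α-inner h eh Hh (translation 1#)) ⟩
      slope (Φ h Hh) * 1# + offset (Φ h Hh)                ≈⟨ +-cong (trans (*-identityʳ _) (proj₁ Φh≈)) (proj₂ Φh≈) ⟩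
      x₀ + 0#                                              ≈⟨ +-identityʳ _ ⟩
      x₀                                                   ∎

-- Arithmetic of q - 1 and the necessity of q = 2^e with e odd

even-or-odd : ∀ n → Even n ⊎ Odd n
even-or-odd zero = inj₁ (0 , ≡.refl)
even-or-odd (suc n) with even-or-odd n
... | inj₁ (k , eq) = inj₂ (k , ≡.cong suc eq)
... | inj₂ (k , eq) = inj₁ (suc k , ≡.cong suc (≡.trans eq (≡.sym (ℕₚ.+-suc k k))))

odd-* : ∀ {m n} → Odd m → Odd n → Odd (m ℕ.* n)
odd-* (k , ≡.refl) (l , ≡.refl) = k ℕ.+ l ℕ.+ (k ℕ.* l ℕ.+ k ℕ.* l) , lem k l
  where
  lem : ∀ k l → suc (k ℕ.+ k) ℕ.* suc (l ℕ.+ l) ≡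
    suc ((k ℕ.+ l ℕ.+ (k ℕ.* l ℕ.+ k ℕ.* l)) ℕ.+ (k ℕ.+ l ℕ.+ (k ℕ.* l ℕ.+ k ℕ.* l)))
  lem = solve-∀

odd-^ : ∀ {m} e → Odd m → Odd (m ℕ.^ e)
odd-^ zero _ = 0 , ≡.refl
odd-^ (suc e) om = odd-* om (odd-^ e om)

oddPrime : ∀ {p} → Prime p → p ≢ 2 → Odd p
oddPrime {p} pr p≢2 with even-or-odd p
... | inj₂ odd = odd
... | inj₁ (k , ≡.refl) with prime⇒irreducible pr (divides k (lem k))
  where
  lem : ∀ k → k ℕ.+ k ≡ k ℕ.* 2
  lem = solve-∀
...   | inj₂ 2≡p = ⊥-elim (p≢2 (≡.sym 2≡p))

-- Serves both directions: for even e it gives 3 ∣ q - 1, for odd e it gives q - 1 ≡ 1 modulo 6.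
4^k≡1+3m : ∀ k → Σ[ m ∈ ℕ ] 2 ℕ.^ (k ℕ.+ k) ≡ suc (m ℕ.* 3)
4^k≡1+3m zero = 0 , ≡.refl
4^k≡1+3m (suc k) with 4^k≡1+3m k
... | m , eq = suc (4 ℕ.* m) , (begin
  2 ℕ.^ (suc k ℕ.+ suc k)        ≡⟨ ≡.cong (λ e → 2 ℕ.^ suc e) (ℕₚ.+-suc k k) ⟩
  2 ℕ.* (2 ℕ.* 2 ℕ.^ (k ℕ.+ k))  ≡⟨ ≡.cong (λ e → 2 ℕ.* (2 ℕ.* e)) eq ⟩
  2 ℕ.* (2 ℕ.* suc (m ℕ.* 3))    ≡⟨ lem m ⟩
  suc (suc (4 ℕ.* m) ℕ.* 3)      ∎)
  where
  open ≡.≡-Reasoning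
  lem : ∀ m → 2 ℕ.* (2 ℕ.* suc (m ℕ.* 3)) ≡ suc (suc (4 ℕ.* m) ℕ.* 3)
  lem = solve-∀

module Necessity (F : Field 0ℓ 0ℓ) (n : ℕ)
  (card : Bijection (Field.setoid F) (≡.setoid (Fin (suc n)))) where
  open Field F hiding (zero)
  open FieldProperties F
  open FiniteField F n card
  open import Relation.Binary.Reasoning.Setoid setoid

  n≢0 : n ≢ 0
  n≢0 ≡.refl = 0≉1 (trans (sym (from∘to 0#)) (trans (reflexive (≡.cong from (to0≡to1 (to 0#) (to 1#)))) (from∘to 1#)))
    where
    to0≡to1 : (i j : Fin 1) → i ≡ j
    to0≡to1 Fin.zero Fin.zero = ≡.refl

  private
    cancel-root : ∀ x y → ¬ (x ≈ 1#) → (x - 1#) * y ≈ 0# → y ≈ 0#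
    cancel-root x y x≉1 eq = *-cancelˡ (x - 1#) (x≉1 ∘ -‿≈0⇒≈) (trans eq (sym (zeroʳ _)))

  μ₂-small : SmallRoots F 2
  μ₂-small x y x²≈1 y²≈1 x≉1 y≉1 = inj₁ (trans (root x x²≈1 x≉1) (sym (root y y²≈1 y≉1)))
    where
    root : ∀ x → x ^ 2 ≈ 1# → ¬ (x ≈ 1#) → x ≈ - 1#
    root x x²≈1 x≉1 = -‿≈0⇒≈ (cancel-root x _ x≉1 (begin
      (x - 1#) * (x - - 1#)  ≈⟨ solve 2 (λ x o → (x :- o) :* (x :- :- o) := x :* x :- o :* o) refl x 1# ⟩
      x * x - 1# * 1#        ≈⟨ ≈⇒-‿≈0 (trans (*-congˡ (sym (*-identityʳ x))) (trans x²≈1 (sym (*-identityʳ 1#)))) ⟩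
      0#                     ∎))

  -- Distinct nontrivial cube roots x, y of 1 are roots of Φ₃ = t² + t + 1. Subtracting and
  -- cancelling x - y gives x + y + 1 = 0, and then xy = 1 + x(x + y + 1) - Φ₃(x) = 1.
  μ₃-small : SmallRoots F 3
  μ₃-small x y x³≈1 y³≈1 x≉1 y≉1 with x ≟ y
  ... | yes x≈y = inj₁ x≈y
  ... | no x≉y = inj₂ (begin
    x * y                             ≈⟨ solve 3 (λ x y o → x :* y := o :+ (x :* (x :+ y :+ o)) :- (x :* x :+ x :* o :+ o)) refl x y 1# ⟩
    1# + x * (x + y + 1#) - Φ₃ x      ≈⟨ +-cong (+-congˡ (trans (*-congˡ x+y+1≈0) (zeroʳ x))) (-‿cong (Φ₃≈0 x x³≈1 x≉1)) ⟩
    1# + 0# - 0#                      ≈⟨ solve 2 (λ o z → o :+ z :- z := o) refl 1# 0# ⟩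
    1#                                ∎)
    where
    Φ₃ : Carrier → Carrier
    Φ₃ x = x * x + x * 1# + 1#
    Φ₃≈0 : ∀ x → x ^ 3 ≈ 1# → ¬ (x ≈ 1#) → Φ₃ x ≈ 0#
    Φ₃≈0 x x³≈1 x≉1 = cancel-root x _ x≉1 (begin
      (x - 1#) * Φ₃ x          ≈⟨ *-congˡ (+-congˡ (sym (*-identityʳ 1#))) ⟩
      (x - 1#) * (x * x + x * 1# + 1# * 1#)
        ≈⟨ solve 2 (λ x o → (x :- o) :* (x :* x :+ x :* o :+ o :* o) := x :* (x :* x) :- o :* (o :* o)) refl x 1# ⟩
      x * (x * x) - 1# * (1# * 1#)
        ≈⟨ ≈⇒-‿≈0 (trans (*-congˡ (*-congˡ (sym (*-identityʳ x)))) (trans x³≈1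
             (sym (trans (*-identityˡ _) (*-identityˡ _))))) ⟩
      0#                       ∎)
    x+y+1≈0 : x + y + 1# ≈ 0#
    x+y+1≈0 = *-cancelˡ (x - y) (x≉y ∘ -‿≈0⇒≈) (begin
      (x - y) * (x + y + 1#)
        ≈⟨ solve 3 (λ x y o → (x :- y) :* (x :+ y :+ o) := (x :* x :+ x :* o :+ o) :- (y :* y :+ y :* o :+ o)) refl x y 1# ⟩
      Φ₃ x - Φ₃ y              ≈⟨ ≈⇒-‿≈0 (trans (Φ₃≈0 x x³≈1 x≉1) (sym (Φ₃≈0 y y³≈1 y≉1))) ⟩
      0#                       ≈⟨ zeroʳ _ ⟨
      (x - y) * 0#             ∎)

  -- Because ℓ ≥ 2, m is smaller than q - 1, so some unit x₀ has x₀^m ≠ 1.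
  obstruct : IsChiralityGroup (AGL₁ F) → ∀ ℓ m → 2 ℕ.≤ ℓ → m ℕ.* ℓ ≡ n → SmallRoots F ℓ → ⊥
  obstruct _ ℓ zero _ mℓ≡n _ = n≢0 (≡.sym mℓ≡n)
  obstruct (H , isH , iso) ℓ@(suc (suc _)) (suc m) (s≤s (s≤s _)) mℓ≡n small with
    ∃x^m≉1 m (≡.subst (suc m ℕ.<_) mℓ≡n (ℕₚ.m<m*n (suc m) ℓ (s≤s (s≤s z≤n))))
  ... | x₀ , x₀≉0 , x₀^m≉1 = Obstruction.contradiction F n card ℓ (suc m) mℓ≡n small x₀ x₀≉0 x₀^m≉1 H isH iso

  necessity : IsPrimePower (suc n) → IsChiralityGroup (AGL₁ F) → Σ[ e ∈ ℕ ] (suc n ≡ 2 ℕ.^ e) × Odd e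
  necessity (p , e , p-prime , _ , q≡p^e) chir with p ℕ.≟ 2 | even-or-odd e
  ... | yes ≡.refl | inj₂ odd = e , q≡p^e , odd
  ... | yes ≡.refl | inj₁ (k , ≡.refl) with 4^k≡1+3m k
  ...   | m , eq = ⊥-elim (obstruct chir 3 m (s≤s (s≤s z≤n))
    (ℕₚ.suc-injective (≡.sym (≡.trans q≡p^e eq))) μ₃-small)
  necessity (p , e , p-prime , _ , q≡p^e) chir | no p≢2 | _ with odd-^ e (oddPrime p-prime p≢2)
  ...   | m , eq = ⊥-elim (obstruct chir 2 m (s≤s (s≤s z≤n))
    (ℕₚ.suc-injective (≡.sym (≡.trans q≡p^e (≡.trans eq (≡.cong suc (lem m)))))) μ₂-small)
    where
    lem : ∀ k → k ℕ.+ k ≡ k ℕ.* 2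
    lem = solve-∀

-- Existence of primitive elements

prime∤⇒coprime : ∀ {p k} → Prime p → ¬ (p ∣ k) → Coprime p k
prime∤⇒coprime {p} {k} pr p∤k with prime⇒irreducible pr (gcd[m,n]∣m p k)
... | inj₁ gcd≡1 = gcd≡1⇒coprime gcd≡1
... | inj₂ gcd≡p = ⊥-elim (p∤k (subst (_∣ k) gcd≡p (gcd[m,n]∣n p k)))

coprime-^ : ∀ {p m} → Coprime p m → ∀ a → Coprime (p ℕ.^ a) m
coprime-^ c zero = Coprime.1-coprimeTo _
coprime-^ {p} {m} c (suc a) {i} (i∣p^ , i∣m) = coprime-^ c a
  (coprime-divisor (λ { (j∣i , j∣p) → c (j∣p , ∣-trans j∣i i∣m) }) i∣p^ , i∣m)

-- Takes out the full power of one prime, so that the cofactor is prime to it; m < d lets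
-- `element-of-order` recurse.
prime-power-split : ∀ d → 2 ℕ.≤ d →
  Σ[ p ∈ ℕ ] Σ[ a ∈ ℕ ] Σ[ m ∈ ℕ ] Prime p × (d ≡ p ℕ.^ suc a ℕ.* m) × ¬ (p ∣ m) × (m ℕ.< d)
prime-power-split 1 (s≤s ())
prime-power-split d@(suc (suc _)) _ with factorise d
... | record { factors = [] ; isFactorisation = () }
... | record { factors = p ∷ ps ; isFactorisation = d≡ ; factorsPrime = pr ∷ _ } =
  let a , m , eq , p∤m = split d d ℕₚ.≤-refl (s≤s z≤n) in finish a m eq p∤m
  where
  p≥2 : 2 ℕ.≤ p
  p≥2 = ℕ.nonTrivial⇒n>1 p ⦃ prime⇒nonTrivial pr ⦄
  p∣d : p ∣ d
  p∣d = subst (p ∣_) (≡.sym d≡) (m∣m*n _)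
  -- `f` bounds the number still to be divided by p and makes the recursion structural.
  split : ∀ f d → d ℕ.≤ f → 1 ℕ.≤ d → Σ[ a ∈ ℕ ] Σ[ m ∈ ℕ ] (d ≡ p ℕ.^ a ℕ.* m) × ¬ (p ∣ m)
  split zero zero _ ()
  split (suc f) d d≤f d≥1 with p ∣? d
  ... | no p∤d = 0 , d , ≡.sym (ℕₚ.+-identityʳ d) , p∤d
  split (suc f) .(0 ℕ.* p) d≤f () | yes (divides zero ≡.refl)
  ... | yes (divides k@(suc _) ≡.refl) with split f k
          (ℕ.s≤s⁻¹ (ℕₚ.≤-trans (ℕₚ.m<m*n k p p≥2) d≤f)) (s≤s z≤n)
  ...   | a , m , eq , p∤m = suc a , m , ≡.trans (≡.cong (ℕ._* p) eq) (lem (p ℕ.^ a) m p) , p∤m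
    where
    lem : ∀ x m p → x ℕ.* m ℕ.* p ≡ p ℕ.* x ℕ.* m
    lem = solve-∀
  finish : ∀ a m → d ≡ p ℕ.^ a ℕ.* m → ¬ (p ∣ m) →
    Σ[ p ∈ ℕ ] Σ[ a ∈ ℕ ] Σ[ m ∈ ℕ ] Prime p × (d ≡ p ℕ.^ suc a ℕ.* m) × ¬ (p ∣ m) × (m ℕ.< d)
  finish zero m eq p∤m = ⊥-elim (p∤m (subst (p ∣_) (≡.trans eq (ℕₚ.+-identityʳ m)) p∣d))
  finish (suc a) zero eq p∤m = ⊥-elim (p∤m (divides 0 ≡.refl))
  finish (suc a) m@(suc _) eq p∤m = p , a , m , pr , eq , p∤m
    , subst (m ℕ.<_) (≡.trans (ℕₚ.*-comm m _) (≡.sym eq)) (ℕₚ.m<m*n m (p ℕ.^ suc a)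
        (ℕₚ.≤-trans p≥2 (ℕₚ.m≤m*n p (p ℕ.^ a) ⦃ ℕₚ.m^n≢0 p a ⦃ ℕ.>-nonZero (ℕₚ.≤-trans (s≤s z≤n) p≥2) ⦄ ⦄)))

module PrimitiveElement (F : Field 0ℓ 0ℓ) (n′ : ℕ)
  (card : Bijection (Field.setoid F) (≡.setoid (Fin (suc (suc n′))))) where
  open Field F hiding (zero)
  open FieldProperties F
  private
    n : ℕ
    n = suc n′
  open FiniteField F n card
  open import Relation.Binary.Reasoning.Setoid setoid

  private
    ^-≡1 : ∀ {x} i j → x ^ i ≈ 1# → x ^ (i ℕ.* j) ≈ 1#
    ^-≡1 {x} i j eq = trans (sym (^-assocʳ x i j)) (trans (^-congˡ j eq) (1^n≈1 j))

    ^-comm : ∀ x i j → (x ^ i) ^ j ≈ (x ^ j) ^ i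
    ^-comm x i j = trans (^-assocʳ x i j) (trans (^-congʳ x (ℕₚ.*-comm i j)) (sym (^-assocʳ x j i)))

  -- Bézout in the form 1 + b j = a i, or with i and j exchanged, so that all exponents stay
  -- natural.
  coprime-exponents : ∀ {x i j} → Coprime i j → x ^ i ≈ 1# → x ^ j ≈ 1# → x ≈ 1#
  coprime-exponents {x} {i} {j} c xi xj = go (coprime-Bézout c) 
    where
    bezout : ∀ i j a b → x ^ i ≈ 1# → x ^ j ≈ 1# → 1 ℕ.+ b ℕ.* j ≡ a ℕ.* i → x ≈ 1#
    bezout i j a b xi xj eq = begin
      x                     ≈⟨ *-identityʳ x ⟨
      x * 1#                ≈⟨ *-congˡ (trans (^-congʳ x (ℕₚ.*-comm b j)) (^-≡1 j b xj)) ⟨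
      x ^ suc (b ℕ.* j)     ≡⟨ ≡.cong (x ^_) eq ⟩
      x ^ (a ℕ.* i)         ≈⟨ trans (^-congʳ x (ℕₚ.*-comm a i)) (^-≡1 i a xi) ⟩
      1#                    ∎
    go : Bézout.Identity 1 i j → x ≈ 1#
    go (Bézout.+- a b eq) = bezout i j a b xi xj eq
    go (Bézout.-+ a b eq) = bezout j i b a xj xi eq

  HasOrder : Carrier → ℕ → Set
  HasOrder x d = (x ^ d ≈ 1#) × (∀ k → x ^ k ≈ 1# → d ∣ k)

  prime-order : ∀ {p x} → Prime p → x ^ p ≈ 1# → ¬ (x ≈ 1#) → HasOrder x p
  prime-order {p} {x} pr x^p≈1 x≉1 = x^p≈1 , divides′
    where
    divides′ : ∀ k → x ^ k ≈ 1# → p ∣ k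
    divides′ k x^k≈1 with p ∣? k
    ... | yes p∣k = p∣k
    ... | no p∤k = ⊥-elim (x≉1 (coprime-exponents {x} {p} {k} (prime∤⇒coprime pr p∤k) x^p≈1 x^k≈1))

  -- If x^k = 1, induction applied to x^p gives k = j p^(a+1); then x^(p^(a+1)), which has order p,
  -- forces p ∣ j.
  prime-power-order : ∀ {p} → Prime p → ∀ a x → x ^ (p ℕ.^ suc a) ≈ 1# → ¬ (x ^ (p ℕ.^ a) ≈ 1#) →
    HasOrder x (p ℕ.^ suc a)
  prime-power-order {p} pr zero x x^p≈1 x≉1 = subst (HasOrder x) (≡.sym (ℕₚ.*-identityʳ p))
    (prime-order pr (trans (^-congʳ x (≡.sym (ℕₚ.*-identityʳ p))) x^p≈1) (x≉1 ∘ trans (*-identityʳ x)))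
  prime-power-order {p} pr (suc a) x x^≈1 x^≉1 = x^≈1 , λ k x^k≈1 →
    let divides j k≡ = proj₂ (prime-power-order pr a (x ^ p)
          (trans (^-assocʳ x p (p ℕ.^ suc a)) x^≈1) (x^≉1 ∘ trans (sym (^-assocʳ x p (p ℕ.^ a)))))
          k (trans (^-comm x p k) (trans (^-congˡ p x^k≈1) (1^n≈1 p)))
        p∣j = proj₂ (prime-order {p} {x ^ (p ℕ.^ suc a)} pr
          (trans (^-comm x (p ℕ.^ suc a) p) (trans (^-assocʳ x p (p ℕ.^ suc a)) x^≈1)) x^≉1) j
          (trans (^-assocʳ x (p ℕ.^ suc a) j) (trans (^-congʳ x (≡.trans (ℕₚ.*-comm (p ℕ.^ suc a) j) (≡.sym k≡))) x^k≈1))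
    in subst (p ℕ.^ suc (suc a) ∣_) (≡.sym k≡) (*-monoˡ-∣ _ p∣j)

  -- Raising (xy)^k = 1 to the m-th power removes x, so l ∣ m k and hence l ∣ k; the argument for m
  -- is symmetric.
  product-order : ∀ {x y m l} → Coprime m l → HasOrder x m → HasOrder y l → HasOrder (x * y) (m ℕ.* l)
  product-order {x} {y} {m} {l} c (x^m , ox) (y^l , oy) =
    (begin
      (x * y) ^ (m ℕ.* l)               ≈⟨ ^-distrib-* x y (m ℕ.* l) ⟩
      x ^ (m ℕ.* l) * y ^ (m ℕ.* l)     ≈⟨ *-cong (^-≡1 m l x^m) (trans (^-congʳ y (ℕₚ.*-comm m l)) (^-≡1 l m y^l)) ⟩
      1# * 1#                           ≈⟨ *-identityˡ 1# ⟩
      1#                                ∎)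
    , λ k eq → combine k (divides-factor c x^m oy k eq)
        (divides-factor (Coprime.sym c) y^l ox k (trans (^-congˡ k (*-comm y x)) eq))
    where
    divides-factor : ∀ {x y m l} → Coprime m l → x ^ m ≈ 1# → (∀ k → y ^ k ≈ 1# → l ∣ k) →
      ∀ k → (x * y) ^ k ≈ 1# → l ∣ k
    divides-factor {x} {y} {m} {l} c x^m oy k eq = coprime-divisor (Coprime.sym c) (oy (m ℕ.* k) (begin
      y ^ (m ℕ.* k)                     ≈⟨ *-identityˡ _ ⟨
      1# * y ^ (m ℕ.* k)                ≈⟨ *-congʳ (^-≡1 m k x^m) ⟨
      x ^ (m ℕ.* k) * y ^ (m ℕ.* k)     ≈⟨ ^-distrib-* x y (m ℕ.* k) ⟨
      (x * y) ^ (m ℕ.* k)               ≈⟨ trans (^-congʳ (x * y) (ℕₚ.*-comm m k)) (^-≡1 k m eq) ⟩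
      1#                                ∎))
    combine : ∀ k → l ∣ k → m ∣ k → m ℕ.* l ∣ k
    combine .(j ℕ.* l) (divides j ≡.refl) m∣k =
      *-monoˡ-∣ l (coprime-divisor c (subst (m ∣_) (ℕₚ.*-comm j l) m∣k))

  -- Write d = p^(a+1) m and n = c d. If x^(n/p) ≠ 1, then x^(c m) has order p^(a+1); it is
  -- multiplied by an element of order m found recursively, with `f` bounding d.
  element-of-order : ∀ f d → d ℕ.≤ f → 1 ℕ.≤ d → d ∣ n → Σ[ x ∈ Carrier ] HasOrder x d
  element-of-order f 1 _ _ _ = 1# , *-identityʳ 1# , λ k _ → 1∣ k
  element-of-order zero (suc (suc d)) () _ _
  element-of-order (suc f) d@(suc (suc _)) d≤f _ (divides c n≡) with prime-power-split d (s≤s (s≤s z≤n))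
  ... | p , a , zero , pr , d≡ , _ = ⊥-elim (ℕₚ.1+n≢0 (≡.trans d≡ (ℕₚ.*-zeroʳ (p ℕ.^ suc a))))
  ... | p , a , m@(suc _) , pr , d≡ , p∤m , m<d
    with element-of-order f m (ℕ.s≤s⁻¹ (ℕₚ.≤-trans m<d d≤f)) (s≤s z≤n)
           (divides (c ℕ.* p ℕ.^ suc a) (≡.trans n≡ (≡.trans (≡.cong (c ℕ.*_) d≡) (≡.sym (ℕₚ.*-assoc c _ m)))))
       | nontrivial-power (c ℕ.* m ℕ.* p ℕ.^ a) p (ℕ.nonTrivial⇒n>1 p ⦃ prime⇒nonTrivial pr ⦄)
           (≡.trans n≡ (≡.trans (≡.cong (c ℕ.*_) d≡) (lem c p (p ℕ.^ a) m)))
    where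
    lem : ∀ c p x m → c ℕ.* (p ℕ.* x ℕ.* m) ≡ c ℕ.* m ℕ.* x ℕ.* p
    lem = solve-∀
    nontrivial-power : ∀ k p → 2 ℕ.≤ p → n ≡ k ℕ.* p → Σ[ x ∈ Carrier ] (¬ (x ≈ 0#)) × (¬ (x ^ k ≈ 1#))
    nontrivial-power zero p _ ()
    nontrivial-power (suc k) p p≥2 n≡ =
      ∃x^m≉1 k (subst (suc k ℕ.<_) (≡.sym n≡) (ℕₚ.m<m*n (suc k) p p≥2))
  ... | y , y-order | x , x≉0 , x^≉1 = (x ^ (c ℕ.* m)) * y ,
    subst (HasOrder _) (≡.sym d≡) (product-order
      (coprime-^ (prime∤⇒coprime pr p∤m) (suc a))
      (prime-power-order pr a (x ^ (c ℕ.* m))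
        (trans (^-assocʳ x (c ℕ.* m) _) (trans (^-congʳ x
          (≡.sym (≡.trans n≡ (≡.trans (≡.cong (c ℕ.*_) d≡) (lem′ c (p ℕ.^ suc a) m))))) (x^[q-1]≈1 x x≉0)))
        (x^≉1 ∘ trans (sym (^-assocʳ x (c ℕ.* m) _))))
      y-order)
    where
    lem′ : ∀ c x m → c ℕ.* (x ℕ.* m) ≡ c ℕ.* m ℕ.* x
    lem′ = solve-∀

  abstract
    primitive-element : Σ[ g ∈ Carrier ] HasOrder g n
    primitive-element = element-of-order n n ℕₚ.≤-refl (s≤s z≤n) ∣-refl

  primitive-≉0 : ∀ {g} → HasOrder g n → ¬ (g ≈ 0#)
  primitive-≉0 (g^n≈1 , _) g≈0 = 1≉0 (trans (sym g^n≈1) (trans (*-congʳ g≈0) (zeroˡ _)))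

  powers-distinct : ∀ {g} → HasOrder g n → ∀ i j → i ℕ.< j → j ℕ.< n → ¬ (g ^ i ≈ g ^ j)
  powers-distinct {g} o@(g^n≈1 , order) i j i<j j<n eq = ℕₚ.<⇒≱ (ℕₚ.≤-<-trans (ℕₚ.m∸n≤m j i) j<n)
    (∣⇒≤ ⦃ ℕ.>-nonZero (ℕₚ.m<n⇒0<n∸m i<j) ⦄ (order (j ℕ.∸ i) (sym (*-cancelˡ (g ^ i) (^-nonzero i (primitive-≉0 o)) (begin
      g ^ i * 1#                ≈⟨ *-identityʳ _ ⟩
      g ^ i                     ≈⟨ eq ⟩
      g ^ j                     ≡⟨ ≡.cong (g ^_) (ℕₚ.m+[n∸m]≡n (ℕₚ.<⇒≤ i<j)) ⟨
      g ^ (i ℕ.+ (j ℕ.∸ i))     ≈⟨ ^-homo-* g i _ ⟩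
      g ^ i * g ^ (j ℕ.∸ i)     ∎)))))

  -- The powers of g are already n distinct roots of x^n - 1, so a unit outside them would be one
  -- root too many.
  discrete-log : ∀ {g} → HasOrder g n → ∀ a → ¬ (a ≈ 0#) → Σ[ k ∈ ℕ ] g ^ k ≈ a
  discrete-log {g} o a a≉0 with Finₚ.any? (λ (i : Fin n) → g ^ toℕ i ≟ a)
  ... | yes (i , eq) = toℕ i , eq
  ... | no ¬power = ⊥-elim (ℕₚ.1+n≰n (subst (ℕ._≤ n) (≡.cong suc (Listₚ.length-tabulate power))
      (roots-of-unity-≤ n′ (a ∷ tabulate power)
        (Allₚ.tabulate⁺ (λ i a≈ → ¬power (i , sym a≈)) ∷ AllPairsₚ.tabulate⁺ distinct)
        (x^[q-1]≈1 a a≉0 ∷ Allₚ.tabulate⁺ (λ i → trans (^-comm g (toℕ i) n) (trans (^-congˡ (toℕ i) (proj₁ o)) (1^n≈1 (toℕ i))))))))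
    where
    power : Fin n → Carrier
    power i = g ^ toℕ i
    distinct : ∀ {i j} → i ≢ j → ¬ (power i ≈ power j)
    distinct {i} {j} i≢j eq with ℕₚ.<-cmp (toℕ i) (toℕ j)
    ... | tri< i<j _ _ = powers-distinct o _ _ i<j (Finₚ.toℕ<n j) eq
    ... | tri≈ _ i≡j _ = i≢j (Finₚ.toℕ-injective i≡j)
    ... | tri> _ _ j<i = powers-distinct o _ _ j<i (Finₚ.toℕ<n i) (sym eq)

-- Constructions

words≤ : ℕ → List Word
words≤ zero = [] ∷ []
words≤ (suc n) = [] ∷ cartesianProductWith _∷_ (allFin 3) (words≤ n)

∈-words≤ : ∀ n w → length w ℕ.≤ n → w ∈ words≤ n
∈-words≤ zero [] _ = here ≡.refl
∈-words≤ (suc n) [] _ = here ≡.refl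
∈-words≤ (suc n) (i ∷ w) (s≤s |w|≤n) = there (∈-cartesianProductWith⁺ _∷_ (∈-allFin i) (∈-words≤ n w |w|≤n))

length-cut : ∀ (w : Word) {i j} → i ℕ.< j → j ℕ.≤ length w → length (take i w ++ drop j w) ℕ.< length w
length-cut w {i} {j} i<j j≤ = begin-strict
  length (take i w ++ drop j w)            ≡⟨ Listₚ.length-++ (take i w) ⟩
  length (take i w) ℕ.+ length (drop j w)
    ≡⟨ ≡.cong₂ ℕ._+_ (≡.trans (Listₚ.length-take i w) (ℕₚ.m≤n⇒m⊓n≡m (ℕₚ.≤-trans (ℕₚ.<⇒≤ i<j) j≤)))
         (Listₚ.length-drop j w) ⟩
  i ℕ.+ (length w ℕ.∸ j)                   <⟨ ℕₚ.+-monoˡ-< _ i<j ⟩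
  j ℕ.+ (length w ℕ.∸ j)                   ≡⟨ ℕₚ.m+[n∸m]≡n j≤ ⟩
  length w                                 ∎
  where open ℕₚ.≤-Reasoning

-- Computes what `Even` states existentially; it also says whether a word exchanges the two halves
-- of Sign × S.
parity : Word → Sign
parity [] = Sign.+
parity (i ∷ w) = opposite (parity w)

opposite² : ∀ s → opposite (opposite s) ≡ s
opposite² Sign.+ = ≡.refl
opposite² Sign.- = ≡.refl

*-minus : ∀ s → s Sign.* Sign.- ≡ opposite s
*-minus Sign.+ = ≡.refl
*-minus Sign.- = ≡.refl

parity-resp : ∀ {u v} → u ≈Δ v → parity u ≡ parity v
parity-resp = EqC.gfold ≡.isEquivalence parity cancel-parity
  where
  cancel-parity : ∀ {u v} → Cancel u v → parity u ≡ parity v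
  cancel-parity (cancel [] i y) = opposite² (parity y)
  cancel-parity (cancel (j ∷ x) i y) = ≡.cong opposite (cancel-parity (cancel x i y))

parity⇒even : ∀ w → parity w ≡ Sign.+ → InΔ⁺ w
parity⇒even [] _ = 0 , ≡.refl
parity⇒even (i ∷ j ∷ w) eq with parity⇒even w (≡.trans (≡.sym (opposite² _)) eq)
... | k , |w|≡2k = suc k , ≡.cong suc (≡.trans (≡.cong suc |w|≡2k) (≡.sym (ℕₚ.+-suc k k)))

even⇒parity : ∀ w → InΔ⁺ w → parity w ≡ Sign.+
even⇒parity [] _ = ≡.refl
even⇒parity (i ∷ []) (suc zero , ())
even⇒parity (i ∷ []) (suc (suc k) , ())
even⇒parity (i ∷ j ∷ w) e = ≡.trans (opposite² _) (even⇒parity w (even-tail e))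

even-resp : ∀ {u v} → u ≈Δ v → InΔ⁺ u → InΔ⁺ v
even-resp {u} {v} u≈v eu = parity⇒even v (≡.trans (≡.sym (parity-resp u≈v)) (even⇒parity u eu))

-- Two permutations x, y of a finite set S give a hypermap on the first half of Sign × S and its
-- mirror image on the second half: the full triangle group acts, with r₂ exchanging the halves,
-- r₁ r₂ acting as x and r₂ r₀ as y on the first half.
module Mirrored (S : Setoid 0ℓ 0ℓ) {N : ℕ} (card : Bijection S (≡.setoid (Fin N)))
  (X Y : Inverse S S) where

  private
    module S = Setoid S
    module P = Setoid (×-setoid (≡.setoid Sign) S)
    module FS = FiniteSetoid S card
  open P using () renaming (_≈_ to _≈ₚ_) public
  open Inverse X using () renaming (to to x; from to x⁻¹; to-cong to x-cong; from-cong to x⁻¹-cong;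
    strictlyInverseˡ to xx⁻¹; strictlyInverseʳ to x⁻¹x)
  open Inverse Y using () renaming (to to y; from to y⁻¹; to-cong to y-cong; from-cong to y⁻¹-cong;
    strictlyInverseˡ to yy⁻¹; strictlyInverseʳ to y⁻¹y)
  open import Relation.Binary.Reasoning.Setoid (×-setoid (≡.setoid Sign) S)

  -- `step i s` leads from half s to the other half. Leaving the two halves by inverse maps makes
  -- each letter an involution, and makes r₁ r₂ and r₂ r₀ act as x⁻¹ and y⁻¹ on the second half.
  step : Fin 3 → Sign → S.Carrier → S.Carrier
  step 𝟘 Sign.+ = y
  step 𝟘 Sign.- = y⁻¹
  step 𝟙 Sign.+ = x⁻¹
  step 𝟙 Sign.- = x
  step 𝟚 _ t = t

  step-cong : ∀ i s {t t′} → t S.≈ t′ → step i s t S.≈ step i s t′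
  step-cong 𝟘 Sign.+ = y-cong
  step-cong 𝟘 Sign.- = y⁻¹-cong
  step-cong 𝟙 Sign.+ = x⁻¹-cong
  step-cong 𝟙 Sign.- = x-cong
  step-cong 𝟚 _ eq = eq

  step-inverse : ∀ i s t → step i (opposite s) (step i s t) S.≈ t
  step-inverse 𝟘 Sign.+ = y⁻¹y
  step-inverse 𝟘 Sign.- = yy⁻¹
  step-inverse 𝟙 Sign.+ = xx⁻¹
  step-inverse 𝟙 Sign.- = x⁻¹x
  step-inverse 𝟚 _ _ = S.refl

  act : Word → P.Carrier → P.Carrier
  act [] p = p
  act (i ∷ w) p with act w p
  ... | s , t = opposite s , step i s t

  act-cong : ∀ w {p p′} → p ≈ₚ p′ → act w p ≈ₚ act w p′
  act-cong [] eq = eq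
  act-cong (i ∷ w) {p} {p′} eq with act w p | act w p′ | act-cong w eq
  ... | s , t | .s , t′ | ≡.refl , t≈t′ = ≡.refl , step-cong i s t≈t′

  act-++ : ∀ u v p → act (u ++ v) p ≡ act u (act v p)
  act-++ [] v p = ≡.refl
  act-++ (i ∷ u) v p rewrite act-++ u v p = ≡.refl

  act-resp : ∀ {u v} → u ≈Δ v → ∀ p → act u p ≈ₚ act v p
  act-resp = EqC.fold record
      { refl = λ p → P.refl
      ; sym = λ eq p → P.sym (eq p)
      ; trans = λ eq eq′ p → P.trans (eq p) (eq′ p)
      } cancel-act
    where
    cancel-act : ∀ {u v} → Cancel u v → ∀ p → act u p ≈ₚ act v p
    cancel-act (cancel u i v) p = begin
      act (u ++ i ∷ i ∷ v) p     ≡⟨ act-++ u (i ∷ i ∷ v) p ⟩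
      act u (act (i ∷ i ∷ v) p)  ≈⟨ act-cong u (opposite² _ , step-inverse i _ _) ⟩
      act u (act v p)            ≡⟨ act-++ u v p ⟨
      act (u ++ v) p             ∎

  act-inverse : ∀ w p → act (reverse w) (act w p) ≈ₚ p
  act-inverse w p = P.trans (P.reflexive (≡.sym (act-++ (reverse w) w p))) (act-resp (Δ.inverseˡ w) p)

  act-side : ∀ w s t → proj₁ (act w (s , t)) ≡ parity w Sign.* s
  act-side [] s t = ≡.refl
  act-side (i ∷ w) s t = ≡.trans (≡.cong opposite (act-side w s t)) (lem (parity w) s)
    where
    lem : ∀ r s → opposite (r Sign.* s) ≡ opposite r Sign.* s
    lem Sign.+ s = ≡.refl
    lem Sign.- s = opposite² s

  act-even : ∀ w → InΔ⁺ w → ∀ s t → act w (s , t) ≡ (s , proj₂ (act w (s , t)))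
  act-even w e s t = ≡.cong (_, proj₂ (act w (s , t)))
    (≡.trans (act-side w s t) (≡.cong (Sign._* s) (even⇒parity w e)))

  Acts : Sign → Word → (S.Carrier → S.Carrier) → Set
  Acts s w f = ∀ t → act w (s , t) ≈ₚ (s , f t)

  Fixes : Sign → Word → Set
  Fixes s w = Acts s w (λ t → t)

  acts-∘ : ∀ s u v f g → Acts s u f → Acts s v g → Acts s (u ++ v) (f ∘ g)
  acts-∘ s u v f g au av t = begin
    act (u ++ v) (s , t)     ≡⟨ act-++ u v _ ⟩
    act u (act v (s , t))    ≈⟨ act-cong u (av t) ⟩
    act u (s , g t)          ≈⟨ au (g t) ⟩
    s , f (g t)              ∎

  acts-reverse : ∀ s w f f⁻¹ → (∀ t → f (f⁻¹ t) S.≈ t) → Acts s w f → Acts s (reverse w) f⁻¹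
  acts-reverse s w f f⁻¹ ff⁻¹ aw t = begin
    act (reverse w) (s , t)                   ≈⟨ act-cong (reverse w) (≡.refl , S.sym (ff⁻¹ t)) ⟩
    act (reverse w) (s , f (f⁻¹ t))           ≈⟨ act-cong (reverse w) (aw (f⁻¹ t)) ⟨
    act (reverse w) (act w (s , f⁻¹ t))       ≈⟨ act-inverse w _ ⟩
    s , f⁻¹ t                                 ∎

  fixes-conj : ∀ s g u → InΔ⁺ g → Fixes s u → Fixes s (g ++ (u ++ reverse g))
  fixes-conj s g u eg fu t = begin
    act (g ++ (u ++ reverse g)) (s , t)      ≡⟨ act-++ g (u ++ reverse g) _ ⟩
    act g (act (u ++ reverse g) (s , t))     ≡⟨ ≡.cong (act g) (act-++ u (reverse g) _) ⟩
    act g (act u (act (reverse g) (s , t)))  ≡⟨ ≡.cong (act g ∘ act u) eq ⟩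
    act g (act u (s , t′))                   ≈⟨ act-cong g (fu t′) ⟩
    act g (s , t′)                           ≡⟨ ≡.cong (act g) eq ⟨
    act g (act (reverse g) (s , t))          ≡⟨ act-++ g (reverse g) _ ⟨
    act (g ++ reverse g) (s , t)             ≈⟨ act-resp (Δ.inverseʳ g) _ ⟩
    s , t                                    ∎
    where
    t′ = proj₂ (act (reverse g) (s , t))
    eq = act-even (reverse g) (even-reverse {g} eg) s t

  acts-mirror : ∀ s w f → Acts s w f → Acts (opposite s) (mirror w) f
  acts-mirror s w f aw t = begin
    act (mirror w) (opposite s , t)             ≡⟨ act-++ (r₂ ∷ []) (w ++ r₂ ∷ []) _ ⟩
    act (r₂ ∷ []) (act (w ++ r₂ ∷ []) (opposite s , t)) ≡⟨ ≡.cong (act (r₂ ∷ [])) (act-++ w (r₂ ∷ []) _) ⟩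
    act (r₂ ∷ []) (act w (opposite (opposite s) , t))
      ≡⟨ ≡.cong (λ s → act (r₂ ∷ []) (act w (s , t))) (opposite² s) ⟩
    act (r₂ ∷ []) (act w (s , t))               ≈⟨ act-cong (r₂ ∷ []) (aw t) ⟩
    opposite s , f t                            ∎

  -- The kernel of Δ⁺ on the first half; Hʳ is then its kernel on the second half, and H Hʳ / H is
  -- the group of actions on the first half of words that fix the second.
  H : Word → Set
  H w = InΔ⁺ w × Fixes Sign.+ w

  private
    infix 4 _~_
    record _~_ (u v : Word) : Set where
      constructor _,_
      field
        same-parity : parity u ≡ parity v
        same-action : ∀ t → act u (Sign.+ , t) ≈ₚ act v (Sign.+ , t)

    ~-trans : ∀ {u v w} → u ~ v → v ~ w → u ~ w
    ~-trans (p , eq) (p′ , eq′) = ≡.trans p p′ , λ t → P.trans (eq t) (eq′ t)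

    ~-prepend : ∀ u {v w} → v ~ w → u ++ v ~ u ++ w
    ~-prepend [] v~w = v~w
    ~-prepend (i ∷ u) v~w with ~-prepend u v~w
    ... | p , eq = ≡.cong opposite p , λ t → act-cong (i ∷ []) (eq t)

    side : Sign → Fin 2
    side Sign.+ = zero
    side Sign.- = suc zero

    side-injective : ∀ s s′ → side s ≡ side s′ → s ≡ s′
    side-injective Sign.+ Sign.+ _ = ≡.refl
    side-injective Sign.- Sign.- _ = ≡.refl

    -- The number of pairs of a parity and a self-map of `Fin N`, hence a bound on the number of
    -- classes of `_~_` and on the length of shortest representatives.
    M : ℕ
    M = 2 ℕ.* (N ℕ.^ N)

    perm-code : Word → Fin N → Fin N
    perm-code w i = FS.to (proj₂ (act w (Sign.+ , FS.from i)))

    code : Word → Fin M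
    code w = Fin.combine (side (parity w)) (Fin.funToFin (perm-code w))

    code-injective : ∀ u v → code u ≡ code v → u ~ v
    code-injective u v eq with Finₚ.combine-injective (side (parity u)) (Fin.funToFin (perm-code u)) _ _ eq
    ... | eq₁ , eq₂ = par , λ t → begin
        act u (Sign.+ , t)                   ≈⟨ act-cong u (≡.refl , FS.from∘to t) ⟨
        act u (Sign.+ , FS.from (FS.to t))   ≈⟨ lem (FS.to t) ⟩
        act v (Sign.+ , FS.from (FS.to t))   ≈⟨ act-cong v (≡.refl , FS.from∘to t) ⟩
        act v (Sign.+ , t)                   ∎
      where
      par : parity u ≡ parity v
      par = side-injective _ _ eq₁
      lem : ∀ i → act u (Sign.+ , FS.from i) ≈ₚ act v (Sign.+ , FS.from i)
      lem i = ≡.trans (act-side u _ _) (≡.trans (≡.cong (Sign._* Sign.+) par) (≡.sym (act-side v _ _)))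
        , FS.to-injective (≡.trans (≡.sym (Finₚ.finToFun-funToFin (perm-code u) i))
            (≡.trans (≡.cong (λ k → Fin.finToFun k i) eq₂) (Finₚ.finToFun-funToFin (perm-code v) i)))

    -- Two suffixes of a long word act in the same way, so that the letters between them can be cut out.
    shorten : ∀ w → M ℕ.< suc (length w) → Σ[ w′ ∈ Word ] (length w′ ℕ.< length w) × (w ~ w′)
    shorten w M< with Finₚ.pigeonhole M< (λ i → code (drop (toℕ i) w))
    ... | i , j , i<j , eq = take (toℕ i) w ++ drop (toℕ j) w
        , length-cut w i<j (ℕ.s≤s⁻¹ (Finₚ.toℕ<n j))
        , subst (_~ take (toℕ i) w ++ drop (toℕ j) w) (Listₚ.take++drop≡id (toℕ i) w)
            (~-prepend (take (toℕ i) w) (code-injective (drop (toℕ i) w) (drop (toℕ j) w) eq))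

    short-rep : ∀ n w → length w ℕ.≤ n → Σ[ w′ ∈ Word ] (length w′ ℕ.≤ M) × (w ~ w′)
    short-rep n w |w|≤n with length w ℕ.≤? M
    ... | yes |w|≤M = w , |w|≤M , ≡.refl , λ t → P.refl
    short-rep zero w |w|≤n | no |w|≰M = ⊥-elim (|w|≰M (ℕₚ.≤-trans |w|≤n z≤n))
    short-rep (suc n) w |w|≤n | no |w|≰M with shorten w (ℕₚ.m≤n⇒m≤1+n (ℕₚ.≰⇒> |w|≰M))
    ... | w′ , w′<w , w~w′ with short-rep n w′ (ℕ.s≤s⁻¹ (ℕₚ.≤-trans w′<w |w|≤n))
    ...   | w″ , |w″|≤M , w′~w″ = w″ , |w″|≤M , ~-trans w~w′ w′~w″

    ~⇒H : ∀ {w w′} → InΔ⁺ w → w ~ w′ → InΔ⁺ w′ × H (reverse w′ ++ w)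
    ~⇒H {w} {w′} ew (p , eq) = ew′ , even-++ {reverse w′} (even-reverse {w′} ew′) ew , λ t → begin
        act (reverse w′ ++ w) (Sign.+ , t)        ≡⟨ act-++ (reverse w′) w _ ⟩
        act (reverse w′) (act w (Sign.+ , t))     ≈⟨ act-cong (reverse w′) (eq t) ⟩
        act (reverse w′) (act w′ (Sign.+ , t))    ≈⟨ act-inverse w′ _ ⟩
        Sign.+ , t                                ∎
      where ew′ = parity⇒even w′ (≡.trans (≡.sym p) (even⇒parity w ew))

  isHypermapSubgroup : HypermapSubgroup H
  isHypermapSubgroup = record
    { resp = λ { u≈v (eu , fu) → even-resp u≈v eu , λ t → P.trans (P.sym (act-resp u≈v _)) (fu t) }
    ; ⊆Δ⁺ = proj₁
    ; has-unit = (0 , ≡.refl) , λ t → P.refl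
    ; mul = λ { {u} {v} (eu , fu) (ev , fv) → even-++ {u} eu ev , acts-∘ Sign.+ u v (λ t → t) (λ t → t) fu fv }
    ; inv = λ { {u} (eu , fu) → even-reverse {u} eu , acts-reverse Sign.+ u (λ t → t) (λ t → t) (λ t → S.refl) fu }
    ; normal = λ { {g} {u} eg (eu , fu) →
        even-++ {g} eg (even-++ {u} eu (even-reverse {g} eg)) , fixes-conj Sign.+ g u eg fu }
    ; finite-index = words≤ M , λ w ew → let w′ , |w′|≤M , w~w′ = short-rep (length w) w ℕₚ.≤-refl in
        lose (∈-words≤ M w′ |w′|≤M) (~⇒H ew w~w′)
    }

  -- In terms of the hypermap, Realised f says that f is a word in x, y whose mirror image
  -- (the same word in x⁻¹, y⁻¹) is trivial.
  Realised : (S.Carrier → S.Carrier) → Set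
  Realised f = Σ[ w ∈ Word ] InΔ⁺ w × Fixes Sign.- w × Acts Sign.+ w f

  realised-cong : ∀ {f g} → (∀ t → f t S.≈ g t) → Realised f → Realised g
  realised-cong f≈g (w , e , fix , acts) = w , e , fix , λ t → P.trans (acts t) (≡.refl , f≈g t)

  realised-id : Realised (λ t → t)
  realised-id = [] , (0 , ≡.refl) , (λ t → P.refl) , (λ t → P.refl)

  realised-∘ : ∀ {f g} → Realised f → Realised g → Realised (f ∘ g)
  realised-∘ {f} {g} (u , eu , fu , au) (v , ev , fv , av) =
    u ++ v , even-++ {u} eu ev , acts-∘ Sign.- u v (λ t → t) (λ t → t) fu fv , acts-∘ Sign.+ u v f g au av

  realised-inverse : ∀ {f} f⁻¹ → (∀ t → f (f⁻¹ t) S.≈ t) → Realised f → Realised f⁻¹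
  realised-inverse {f} f⁻¹ ff⁻¹ (w , e , fix , acts) =
    reverse w , even-reverse {w} e , acts-reverse Sign.- w (λ t → t) (λ t → t) (λ t → S.refl) fix
    , acts-reverse Sign.+ w f f⁻¹ ff⁻¹ acts

  -- The words fixing the second half are normalised by r₂ r₀, which acts as y on the first.
  realised-conj : ∀ {f} → Realised f → Realised (y ∘ f ∘ y⁻¹)
  realised-conj {f} (w , e , fix , acts) =
    r₂r₀ ++ (w ++ reverse r₂r₀)
    , even-++ {r₂r₀} {w ++ reverse r₂r₀} (1 , ≡.refl) (even-++ {w} {reverse r₂r₀} e (1 , ≡.refl))
    , fixes-conj Sign.- r₂r₀ w (1 , ≡.refl) fix
    , acts-∘ Sign.+ r₂r₀ (w ++ reverse r₂r₀) y (f ∘ y⁻¹) acts-y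
        (acts-∘ Sign.+ w (reverse r₂r₀) f y⁻¹ acts (acts-reverse Sign.+ r₂r₀ y y⁻¹ yy⁻¹ acts-y))
    where
    r₂r₀ : Word
    r₂r₀ = 𝟚 ∷ 𝟘 ∷ []
    acts-y : Acts Sign.+ r₂r₀ y
    acts-y t = P.refl

  -- G acts faithfully through `ι`; `detect` and `realise` say that its image is exactly the set of
  -- actions on the first half of words fixing the second.
  module _ (G : RawMagma 0ℓ 0ℓ)
    (ι : RawMagma.Carrier G → S.Carrier → S.Carrier)
    (ι-cong : ∀ {c d} → RawMagma._≈_ G c d → ∀ t → ι c t S.≈ ι d t)
    (ι-injective : ∀ {c d} → (∀ t → ι c t S.≈ ι d t) → RawMagma._≈_ G c d)
    (ι-∙ : ∀ c d t → ι (RawMagma._∙_ G c d) t S.≈ ι c (ι d t))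
    (detect : ∀ w → InΔ⁺ w → Fixes Sign.- w → Σ[ c ∈ RawMagma.Carrier G ] Acts Sign.+ w (ι c))
    (realise : ∀ c → Realised (ι c)) where

    private
      module G = RawMagma G

      fixes-mirror : ∀ h → H h → Fixes Sign.- (mirror h)
      fixes-mirror h (_ , fh) = acts-mirror Sign.+ h (λ t → t) fh

      -- In w = h k the factor h of H is invisible on the first half, and k, a mirror image, fixes
      -- the second half, so `detect` applies to k.
      value : ∀ w → (H ·ʳ) w → Σ[ c ∈ G.Carrier ] Acts Sign.+ w (ι c)
      value w (h , k , (eh , fh) , (h′ , Hh′ , k≈) , w≈)
        with detect (mirror h′) (even-mirror {h′} (proj₁ Hh′)) (fixes-mirror h′ Hh′)
      ... | c , acts = c , λ t → begin
        act w (Sign.+ , t)              ≈⟨ act-resp w≈ _ ⟩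
        act (h ++ k) (Sign.+ , t)       ≡⟨ act-++ h k _ ⟩
        act h (act k (Sign.+ , t))      ≈⟨ act-cong h (P.trans (act-resp k≈ _) (acts t)) ⟩
        act h (Sign.+ , ι c t)          ≈⟨ fh (ι c t) ⟩
        Sign.+ , ι c t                  ∎

      even : ∀ w → (H ·ʳ) w → InΔ⁺ w
      even w (h , k , (eh , _) , (h′ , Hh′ , k≈) , w≈) =
        even-resp (Δ.sym w≈) (even-++ {h} eh (even-resp (Δ.sym k≈) (even-mirror {h′} (proj₁ Hh′))))

      acts-unique : ∀ w {f g} → Acts Sign.+ w f → Acts Sign.+ w g → ∀ t → f t S.≈ g t
      acts-unique w af ag t = proj₂ (P.trans (P.sym (af t)) (ag t))

    isChiralityGroup : IsChiralityGroup G
    isChiralityGroup = H , isHypermapSubgroup , record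
      { f = λ w p → proj₁ (value w p)
      ; ker = λ u v pu pv → mk⇔
          (λ fu≈fv → proj₂ (~⇒H {v} {u} (even v pv)
            ( ≡.trans (even⇒parity v (even v pv)) (≡.sym (even⇒parity u (even u pu)))
            , λ t → P.trans (proj₂ (value v pv) t)
                (P.trans (≡.refl , S.sym (ι-cong fu≈fv t)) (P.sym (proj₂ (value u pu) t))))))
          (λ { (_ , fix) → ι-injective (acts-unique v
            (λ t → begin
              act v (Sign.+ , t)                        ≈⟨ act-resp (Δ.trans (Δ.∙-congʳ (Δ.inverseʳ u)) (Δ.identityˡ v)) _ ⟨
              act ((u ++ reverse u) ++ v) (Sign.+ , t)  ≡⟨ ≡.cong (λ w → act w (Sign.+ , t)) (Listₚ.++-assoc u _ v) ⟩
              act (u ++ (reverse u ++ v)) (Sign.+ , t)  ≡⟨ act-++ u _ _ ⟩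
              act u (act (reverse u ++ v) (Sign.+ , t)) ≈⟨ act-cong u (fix t) ⟩
              act u (Sign.+ , t)                        ≈⟨ proj₂ (value u pu) t ⟩
              Sign.+ , ι (proj₁ (value u pu)) t         ∎)
            (proj₂ (value v pv))) })
      ; hom = λ u v pu pv puv → ι-injective (acts-unique (u ++ v) (proj₂ (value (u ++ v) puv))
          (λ t → P.trans (acts-∘ Sign.+ u v (ι (proj₁ (value u pu))) (ι (proj₁ (value v pv)))
              (proj₂ (value u pu)) (proj₂ (value v pv)) t)
            (≡.refl , S.sym (ι-∙ _ _ t))))
      ; surjective = λ c → let w , e , fix , acts = realise c in
          w , realised∈ w e fix
          , ι-injective (acts-unique w (proj₂ (value w (realised∈ w e fix))) acts)
      }
      where
      realised∈ : ∀ w → InΔ⁺ w → Fixes Sign.- w → (H ·ʳ) w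
      realised∈ w e fix = [] , w , ((0 , ≡.refl) , λ t → P.refl)
        , (mirror w , (even-mirror {w} e , acts-mirror Sign.- w (λ t → t) fix) , Δ.sym (mirror-mirror w))
        , Δ.refl

-- The construction for q = 2^e with e ≥ 3 odd

module OddExponent (F : Field 0ℓ 0ℓ) (m : ℕ)
  (card : Bijection (Field.setoid F) (≡.setoid (Fin (suc (suc (suc m ℕ.* 6))))))
  (d : ℕ) (q≡2^e : suc (suc (suc m ℕ.* 6)) ≡ 2 ℕ.^ suc d) where
  open Field F hiding (zero)
  open FieldProperties F
  private
    -- This form of q - 1 shows at once that it is prime to 6 and at least 7.
    n : ℕ
    n = suc (suc m ℕ.* 6)
  open FiniteField F n card
  open PrimitiveElement F (suc m ℕ.* 6) card
  open import Algebra.Properties.Semiring.Mult semiring using (×1-homo-*) renaming (_×_ to _·_)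
  open import Relation.Binary.Reasoning.Setoid setoid

  -- q · 1 = 0 reads (1 + 1)^e = 0, and a field has no nonzero nilpotents.
  1+1≈0 : 1# + 1# ≈ 0#
  1+1≈0 with (1# + 1#) ≟ 0#
  ... | yes eq = eq
  ... | no neq = ⊥-elim (^-nonzero (suc d) neq (begin
    (1# + 1#) ^ suc d         ≈⟨ 2^· (suc d) ⟨
    (2 ℕ.^ suc d) · 1#        ≡⟨ ≡.cong (_· 1#) q≡2^e ⟨
    suc n · 1#                ≈⟨ q·x≈0 1# ⟩
    0#                        ∎))
    where
    2^· : ∀ e → (2 ℕ.^ e) · 1# ≈ (1# + 1#) ^ e
    2^· zero = +-identityʳ 1#
    2^· (suc e) = trans (×1-homo-* 2 (2 ℕ.^ e)) (*-cong (+-congˡ (+-identityʳ 1#)) (2^· e))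

  x+x≈0 : ∀ x → x + x ≈ 0#
  x+x≈0 x = begin
    x + x             ≈⟨ +-cong (*-identityʳ x) (*-identityʳ x) ⟨
    x * 1# + x * 1#   ≈⟨ distribˡ x 1# 1# ⟨
    x * (1# + 1#)     ≈⟨ *-congˡ 1+1≈0 ⟩
    x * 0#            ≈⟨ zeroʳ x ⟩
    0#                ∎

  x+y+y≈x : ∀ x y → x + y + y ≈ x
  x+y+y≈x x y = trans (+-assoc x y y) (trans (+-congˡ (x+x≈0 y)) (+-identityʳ x))

  frob : ℕ → Carrier → Carrier
  frob k t = t ^ (2 ℕ.^ k)

  frob-cong : ∀ k {s t} → s ≈ t → frob k s ≈ frob k t
  frob-cong k = ^-congˡ (2 ℕ.^ k)

  frob-∘ : ∀ k l t → frob k (frob l t) ≈ frob (k ℕ.+ l) t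
  frob-∘ k l t = trans (^-assocʳ t (2 ℕ.^ l) (2 ℕ.^ k))
    (^-congʳ t (≡.trans (ℕₚ.*-comm (2 ℕ.^ l) (2 ℕ.^ k)) (≡.sym (ℕₚ.^-distribˡ-+-* 2 k l))))

  frob-suc : ∀ k t → frob (suc k) t ≈ frob k (t ^ 2)
  frob-suc k t = sym (^-assocʳ t 2 (2 ℕ.^ k))

  frob-+ : ∀ k s t → frob k (s + t) ≈ frob k s + frob k t
  frob-+ zero s t = trans (*-identityʳ _) (sym (+-cong (*-identityʳ s) (*-identityʳ t)))
  frob-+ (suc k) s t = begin
    frob (suc k) (s + t)              ≈⟨ frob-suc k _ ⟩
    frob k ((s + t) ^ 2)              ≈⟨ frob-cong k square ⟩
    frob k (s ^ 2 + t ^ 2)            ≈⟨ frob-+ k _ _ ⟩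
    frob k (s ^ 2) + frob k (t ^ 2)   ≈⟨ +-cong (frob-suc k s) (frob-suc k t) ⟨
    frob (suc k) s + frob (suc k) t   ∎
    where
    square : (s + t) ^ 2 ≈ s ^ 2 + t ^ 2
    square = begin
      (s + t) * ((s + t) * 1#)
        ≈⟨ solve 3 (λ s t o → (s :+ t) :* ((s :+ t) :* o) := s :* (s :* o) :+ t :* (t :* o) :+ s :* t :* o :+ s :* t :* o) refl s t 1# ⟩
      s ^ 2 + t ^ 2 + s * t * 1# + s * t * 1#  ≈⟨ x+y+y≈x _ _ ⟩
      s ^ 2 + t ^ 2                            ∎

  frob-1 : ∀ k → frob k 1# ≈ 1#
  frob-1 k = 1^n≈1 (2 ℕ.^ k)

  frob-0 : ∀ k → frob k 0# ≈ 0#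
  frob-0 zero = *-identityʳ 0#
  frob-0 (suc k) = trans (frob-suc k 0#) (trans (frob-cong k (zeroˡ _)) (frob-0 k))

  -- Amounts to e ∣ k, but is stated for the map itself, which avoids calculating with exponents
  -- modulo e.
  Trivial : ℕ → Set
  Trivial k = ∀ t → frob k t ≈ t

  trivial-e : Trivial (suc d)
  trivial-e t = trans (^-congʳ t (≡.sym q≡2^e)) (x^q≈x t)

  trivial-+ : ∀ {k l} → Trivial k → Trivial l → Trivial (k ℕ.+ l)
  trivial-+ {k} {l} tk tl t = trans (sym (frob-∘ k l t)) (trans (tk _) (tl t))

  frob-square : ∀ t → frob d t ^ 2 ≈ t
  frob-square t = begin
    frob d t ^ 2          ≈⟨ ^-assocʳ t (2 ℕ.^ d) 2 ⟩
    t ^ (2 ℕ.^ d ℕ.* 2)   ≈⟨ ^-congʳ t (ℕₚ.*-comm (2 ℕ.^ d) 2) ⟩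
    frob (suc d) t        ≈⟨ trivial-e t ⟩
    t                     ∎

  private
    g : Carrier
    g = proj₁ primitive-element
    g-order : HasOrder g n
    g-order = proj₂ primitive-element
    g≉0 : ¬ (g ≈ 0#)
    g≉0 = primitive-≉0 g-order
    g⁻¹ : Carrier
    g⁻¹ = proj₁ (inverse g g≉0)
    gg⁻¹ : g * g⁻¹ ≈ 1#
    gg⁻¹ = proj₂ (inverse g g≉0)
    gg⁻¹t : ∀ t → g * (g⁻¹ * t) ≈ t
    gg⁻¹t t = trans (sym (*-assoc g g⁻¹ t)) (trans (*-congʳ gg⁻¹) (*-identityˡ t))
    g⁻¹gt : ∀ t → g⁻¹ * (g * t) ≈ t
    g⁻¹gt t = trans (sym (*-assoc g⁻¹ g t)) (trans (*-congʳ (trans (*-comm g⁻¹ g) gg⁻¹)) (*-identityˡ t))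
    g⁻¹≉0 : ¬ (g⁻¹ ≈ 0#)
    g⁻¹≉0 eq = 1≉0 (trans (sym gg⁻¹) (trans (*-congˡ eq) (zeroʳ g)))

    x x⁻¹ : Carrier → Carrier
    x t = t ^ 2 + 1#
    x⁻¹ t = frob d (t + 1#)

    x-cong : ∀ {s t} → s ≈ t → x s ≈ x t
    x-cong eq = +-congʳ (^-congˡ 2 eq)

    x⁻¹-cong : ∀ {s t} → s ≈ t → x⁻¹ s ≈ x⁻¹ t
    x⁻¹-cong eq = frob-cong d (+-congʳ eq)

    xx⁻¹ : ∀ t → x (x⁻¹ t) ≈ t
    xx⁻¹ t = trans (+-congʳ (frob-square (t + 1#))) (x+y+y≈x t 1#)

    x⁻¹x : ∀ t → x⁻¹ (x t) ≈ t
    x⁻¹x t = trans (frob-cong d (x+y+y≈x (t ^ 2) 1#)) (trans (sym (frob-suc d t)) (trivial-e t))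

    x-inverse y-inverse : Inverse setoid setoid
    x-inverse = record
      { to = x ; from = x⁻¹ ; to-cong = x-cong ; from-cong = x⁻¹-cong
      ; inverse = (λ eq → trans (x-cong eq) (xx⁻¹ _)) , (λ eq → trans (x⁻¹-cong eq) (x⁻¹x _))
      }
    y-inverse = record
      { to = g *_ ; from = g⁻¹ *_ ; to-cong = *-congˡ ; from-cong = *-congˡ
      ; inverse = (λ eq → trans (*-congˡ eq) (gg⁻¹t _)) , (λ eq → trans (*-congˡ eq) (g⁻¹gt _))
      }

  open Mirrored setoid card x-inverse y-inverse

  Semiaffine : ℕ → (Carrier → Carrier) → Set
  Semiaffine k f = Σ[ a ∈ Carrier ] Σ[ b ∈ Carrier ] (¬ (a ≈ 0#)) × (∀ t → f t ≈ a * frob k t + b)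

  semiaffine-id : Semiaffine 0 (λ t → t)
  semiaffine-id = 1# , 0# , 1≉0 , λ t → sym (trans (+-identityʳ _) (trans (*-identityˡ _) (*-identityʳ t)))

  semiaffine-∘ : ∀ {k l f h} → (∀ {s t} → s ≈ t → f s ≈ f t) →
    Semiaffine k f → Semiaffine l h → Semiaffine (k ℕ.+ l) (f ∘ h)
  semiaffine-∘ {k} {l} {f} {h} f-cong (a , b , a≉0 , f≈) (a′ , b′ , a′≉0 , h≈) =
    a * frob k a′ , a * frob k b′ + b , *-nonzero a≉0 (^-nonzero (2 ℕ.^ k) a′≉0) , λ t → begin
      f (h t)                                            ≈⟨ f-cong (h≈ t) ⟩
      f (a′ * frob l t + b′)                             ≈⟨ f≈ _ ⟩
      a * frob k (a′ * frob l t + b′) + b                ≈⟨ +-congʳ (*-congˡ (trans (frob-+ k _ _) (+-congʳ (^-distrib-* a′ _ (2 ℕ.^ k))))) ⟩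
      a * (frob k a′ * frob k (frob l t) + frob k b′) + b
        ≈⟨ solve 5 (λ a a′ t b′ b → a :* (a′ :* t :+ b′) :+ b := a :* a′ :* t :+ (a :* b′ :+ b)) refl a _ _ _ b ⟩
      a * frob k a′ * frob k (frob l t) + (a * frob k b′ + b)  ≈⟨ +-congʳ (*-congˡ (frob-∘ k l t)) ⟩
      a * frob k a′ * frob (k ℕ.+ l) t + (a * frob k b′ + b)   ∎

  semiaffine-resp : ∀ {k f h} → (∀ t → f t ≈ h t) → Semiaffine k f → Semiaffine k h
  semiaffine-resp f≈h (a , b , a≉0 , f≈) = a , b , a≉0 , λ t → trans (sym (f≈h t)) (f≈ t)

  -- The number of squarings in a step; undoing a squaring counts as d = e - 1 squarings.
  shift : Fin 3 → Sign → ℕ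
  shift 𝟙 Sign.+ = d
  shift 𝟙 Sign.- = 1
  shift _ _ = 0

  semiaffine-step : ∀ i s → Semiaffine (shift i s) (step i s)
  semiaffine-step 𝟘 Sign.+ = g , 0# , g≉0 , λ t → sym (trans (+-identityʳ _) (*-congˡ (*-identityʳ t)))
  semiaffine-step 𝟘 Sign.- = g⁻¹ , 0# , g⁻¹≉0 , λ t → sym (trans (+-identityʳ _) (*-congˡ (*-identityʳ t)))
  semiaffine-step 𝟙 Sign.+ = 1# , 1# , 1≉0 , λ t → trans (frob-+ d t 1#) (+-cong (sym (*-identityˡ _)) (frob-1 d))
  semiaffine-step 𝟙 Sign.- = 1# , 1# , 1≉0 , λ t → +-congʳ (sym (*-identityˡ _))
  semiaffine-step 𝟚 Sign.+ = semiaffine-id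
  semiaffine-step 𝟚 Sign.- = semiaffine-id

  shift-trivial : ∀ i s → Trivial (shift i s ℕ.+ shift i (opposite s))
  shift-trivial 𝟘 Sign.+ t = *-identityʳ t
  shift-trivial 𝟘 Sign.- t = *-identityʳ t
  shift-trivial 𝟙 Sign.+ t = trans (^-congʳ t (≡.cong (2 ℕ.^_) (ℕₚ.+-comm d 1))) (trivial-e t)
  shift-trivial 𝟙 Sign.- t = trivial-e t
  shift-trivial 𝟚 Sign.+ t = *-identityʳ t
  shift-trivial 𝟚 Sign.- t = *-identityʳ t

  action : Word → Sign → Carrier → Carrier
  action w s t = proj₂ (act w (s , t))

  -- The two halves act by mutually inverse steps, so their Frobenius exponents add up to a multiple
  -- of e. This invariant forces the action on the first half to be affine when the one on the
  -- second is trivial.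
  action-semiaffine : ∀ w → Σ[ k ∈ ℕ ] Σ[ l ∈ ℕ ]
    Semiaffine k (action w Sign.+) × Semiaffine l (action w Sign.-) × Trivial (k ℕ.+ l)
  action-semiaffine [] = 0 , 0 , semiaffine-id , semiaffine-id , *-identityʳ
  action-semiaffine (i ∷ w) = extend (action-semiaffine w)
    where
    s s′ : Sign
    s = parity w
    s′ = opposite (parity w)
    lem : ∀ a k b l → a ℕ.+ k ℕ.+ (b ℕ.+ l) ≡ a ℕ.+ b ℕ.+ (k ℕ.+ l)
    lem = solve-∀
    next : ∀ s r {k} → parity w Sign.* s ≡ r → Semiaffine k (action w s) →
      Semiaffine (shift i r ℕ.+ k) (action (i ∷ w) s)
    next s r {k} eq aff = semiaffine-resp {shift i r ℕ.+ k}
      (λ t → reflexive (≡.sym (≡.cong (λ r → step i r (action w s t)) (≡.trans (act-side w s t) eq))))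
      (semiaffine-∘ {shift i r} {k} (step-cong i r) (semiaffine-step i r) aff)
    extend : (Σ[ k ∈ ℕ ] Σ[ l ∈ ℕ ]
        Semiaffine k (action w Sign.+) × Semiaffine l (action w Sign.-) × Trivial (k ℕ.+ l)) →
      Σ[ k ∈ ℕ ] Σ[ l ∈ ℕ ]
        Semiaffine k (action (i ∷ w) Sign.+) × Semiaffine l (action (i ∷ w) Sign.-) × Trivial (k ℕ.+ l)
    extend (k , l , f⁺ , f⁻ , triv) = shift i s ℕ.+ k , shift i s′ ℕ.+ l
      , next Sign.+ s (Signₚ.*-identityʳ s) f⁺ , next Sign.- s′ (*-minus s) f⁻
      , λ t → trans (^-congʳ t (≡.cong (2 ℕ.^_) (lem (shift i s) k (shift i s′) l)))
          (trivial-+ {shift i s ℕ.+ shift i s′} {k ℕ.+ l} (shift-trivial i s) triv t)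

  private
    module X = RawMagma (AGL₁ F)

  ι : X.Carrier → Carrier → Carrier
  ι ((a , b) , _) t = a * t + b

  -- Evaluating the identity action on the second half at 0 and at 1 gives b′ = 0 and a′ = 1; what
  -- remains is a trivial Frobenius power there, and hence one on the first half.
  detect : ∀ w → InΔ⁺ w → Fixes Sign.- w → Σ[ c ∈ X.Carrier ] Acts Sign.+ w (ι c)
  detect w ew fix = go (action-semiaffine w)
    where
    go : (Σ[ k ∈ ℕ ] Σ[ l ∈ ℕ ]
        Semiaffine k (action w Sign.+) × Semiaffine l (action w Sign.-) × Trivial (k ℕ.+ l)) →
      Σ[ c ∈ X.Carrier ] Acts Sign.+ w (ι c)
    go (k , l , (a , b , a≉0 , f⁺) , (a′ , b′ , _ , f⁻) , triv) = ((a , b) , a≉0) , λ t →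
        ≡.cong proj₁ (act-even w ew Sign.+ t) , trans (f⁺ t) (+-congʳ (*-congˡ (trivial-k t)))
      where
      f⁻≈id : ∀ t → a′ * frob l t + b′ ≈ t
      f⁻≈id t = trans (sym (f⁻ t)) (proj₂ (fix t))
      b′≈0 : b′ ≈ 0#
      b′≈0 = begin
        b′                     ≈⟨ +-identityˡ b′ ⟨
        0# + b′                ≈⟨ +-congʳ (trans (*-congˡ (frob-0 l)) (zeroʳ a′)) ⟨
        a′ * frob l 0# + b′    ≈⟨ f⁻≈id 0# ⟩
        0#                     ∎
      f⁻≈ : ∀ t → a′ * frob l t ≈ t
      f⁻≈ t = trans (sym (trans (+-congˡ b′≈0) (+-identityʳ _))) (f⁻≈id t)
      a′≈1 : a′ ≈ 1#
      a′≈1 = trans (sym (trans (*-congˡ (frob-1 l)) (*-identityʳ a′))) (f⁻≈ 1#)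
      trivial-l : Trivial l
      trivial-l t = trans (sym (trans (*-congʳ a′≈1) (*-identityˡ _))) (f⁻≈ t)
      trivial-k : Trivial k
      trivial-k t = begin
        frob k t                ≈⟨ frob-cong k (trivial-l t) ⟨
        frob k (frob l t)       ≈⟨ frob-∘ k l t ⟩
        frob (k ℕ.+ l) t        ≈⟨ triv t ⟩
        t                       ∎

  private
    power≉1 : ∀ i → suc i ℕ.< 7 → ¬ (g ^ suc i ≈ 1#)
    power≉1 i i<7 eq = ℕₚ.<⇒≱ (ℕₚ.<-≤-trans i<7 (ℕₚ.+-monoʳ-≤ 7 z≤n)) (∣⇒≤ (proj₂ g-order (suc i) eq))

    +1≉0 : ∀ {t} → ¬ (t ≈ 1#) → ¬ (t + 1# ≈ 0#)
    +1≉0 {t} t≉1 eq = t≉1 (trans (sym (x+y+y≈x t 1#)) (trans (+-congʳ eq) (+-identityˡ 1#)))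

    -- The relation x⁻¹ y⁻² x y = translation (of order 2) mirrors to x y² x⁻¹ y⁻¹ : t ↦ g³ t + g⁴ + 1.
    relator : Word
    relator = 𝟙 ∷ 𝟚 ∷ 𝟚 ∷ 𝟘 ∷ 𝟚 ∷ 𝟘 ∷ 𝟚 ∷ 𝟙 ∷ 𝟘 ∷ 𝟚 ∷ []

    relator⁻ : ∀ t → action relator Sign.- t ≈ t + frob d (g⁻¹ * (g⁻¹ * 1#) + 1#)
    relator⁻ t = begin
      frob d (g⁻¹ * (g⁻¹ * ((g * t) ^ 2 + 1#)) + 1#)
        ≈⟨ frob-cong d (solve 4 (λ g⁻¹ g t o → g⁻¹ :* (g⁻¹ :* ((g :* t) :* ((g :* t) :* o) :+ o)) :+ o
             := (g⁻¹ :* (g :* (g⁻¹ :* (g :* (t :* (t :* o)))))) :+ (g⁻¹ :* (g⁻¹ :* o) :+ o)) refl g⁻¹ g t 1#) ⟩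
      frob d (g⁻¹ * (g * (g⁻¹ * (g * t ^ 2))) + (g⁻¹ * (g⁻¹ * 1#) + 1#))
        ≈⟨ frob-cong d (+-congʳ (trans (g⁻¹gt _) (g⁻¹gt _))) ⟩
      frob d (t ^ 2 + (g⁻¹ * (g⁻¹ * 1#) + 1#))     ≈⟨ frob-+ d _ _ ⟩
      frob d (t ^ 2) + frob d (g⁻¹ * (g⁻¹ * 1#) + 1#)
        ≈⟨ +-congʳ (trans (sym (frob-suc d t)) (trivial-e t)) ⟩
      t + frob d (g⁻¹ * (g⁻¹ * 1#) + 1#)           ∎

    relator⁺ : ∀ t → action relator Sign.+ t ≈ g ^ 3 * t + (g ^ 4 + 1#)
    relator⁺ t = begin
      (g * (g * frob d (g⁻¹ * t + 1#))) ^ 2 + 1#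
        ≈⟨ solve 3 (λ g s o → (g :* (g :* s)) :* ((g :* (g :* s)) :* o) :+ o := g :* (g :* (g :* (g :* (s :* (s :* o))))) :+ o)
             refl g _ 1# ⟩
      g * (g * (g * (g * frob d (g⁻¹ * t + 1#) ^ 2))) + 1#  ≈⟨ +-congʳ (*-congˡ (*-congˡ (*-congˡ (*-congˡ (frob-square _))))) ⟩
      g * (g * (g * (g * (g⁻¹ * t + 1#)))) + 1#
        ≈⟨ solve 4 (λ g g⁻¹ t o → g :* (g :* (g :* (g :* (g⁻¹ :* t :+ o)))) :+ o
             := g :* (g :* (g :* (g :* (g⁻¹ :* t)))) :+ (g :* (g :* (g :* (g :* o))) :+ o)) refl g g⁻¹ t 1# ⟩
      g * (g * (g * (g * (g⁻¹ * t)))) + (g ^ 4 + 1#)        ≈⟨ +-congʳ (*-congˡ (*-congˡ (*-congˡ (gg⁻¹t t)))) ⟩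
      g * (g * (g * t)) + (g ^ 4 + 1#)
        ≈⟨ +-congʳ (trans (*-congˡ (sym (*-assoc g g t))) (trans (sym (*-assoc g (g * g) t))
             (*-congʳ (*-congˡ (*-congˡ (sym (*-identityʳ g))))))) ⟩
      g ^ 3 * t + (g ^ 4 + 1#)                              ∎

    -- Slope and offset of the square of t ↦ g³ t + g⁴ + 1. Squaring the relator kills its mirror
    -- image, a translation in characteristic 2.
    h c₀ : Carrier
    h = g ^ 6
    c₀ = (g ^ 3 + 1#) * (g ^ 4 + 1#)

    h≉0 : ¬ (h ≈ 0#)
    h≉0 = ^-nonzero 6 g≉0

    h⁻¹ : Carrier
    h⁻¹ = proj₁ (inverse h h≉0)

    hh⁻¹t : ∀ t → h * (h⁻¹ * t) ≈ t
    hh⁻¹t t = trans (sym (*-assoc h h⁻¹ t)) (trans (*-congʳ (proj₂ (inverse h h≉0))) (*-identityˡ t))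

    realised-h : Realised (λ t → h * t + c₀)
    realised-h = relator ++ relator , (10 , ≡.refl)
      , (λ t → ≡.refl , trans (relator⁻ _) (trans (+-congʳ (relator⁻ t)) (x+y+y≈x _ _)))
      , (λ t → ≡.refl , (begin
          action relator Sign.+ (action relator Sign.+ t)        ≈⟨ relator⁺ _ ⟩
          g ^ 3 * action relator Sign.+ t + (g ^ 4 + 1#)         ≈⟨ +-congʳ (*-congˡ (relator⁺ t)) ⟩
          g ^ 3 * (g ^ 3 * t + (g ^ 4 + 1#)) + (g ^ 4 + 1#)
            ≈⟨ solve 3 (λ a b t → a :* (a :* t :+ b) :+ b := a :* a :* t :+ (a :* b :+ b)) refl (g ^ 3) (g ^ 4 + 1#) t ⟩
          g ^ 3 * g ^ 3 * t + (g ^ 3 * (g ^ 4 + 1#) + (g ^ 4 + 1#))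
            ≈⟨ +-cong (*-congʳ (sym (^-homo-* g 3 3)))
                 (trans (+-congˡ (sym (*-identityˡ _))) (sym (distribʳ (g ^ 4 + 1#) (g ^ 3) 1#))) ⟩
          h * t + c₀                                             ∎))

    -- The commutator of t ↦ g t with t ↦ h t + c₀ is the translation by (g + 1) c₀ = (g + 1)(g³ +
    -- 1)(g⁴ + 1), nonzero because g has order at least 7.
    τ₀ : Carrier
    τ₀ = c₀ + g * c₀

    τ₀≉0 : ¬ (τ₀ ≈ 0#)
    τ₀≉0 eq = *-nonzero (+1≉0 (power≉1 0 (ℕₚ.+-monoʳ-≤ 2 z≤n) ∘ trans (*-identityʳ g)))
      (*-nonzero (+1≉0 (power≉1 2 (ℕₚ.+-monoʳ-≤ 4 z≤n))) (+1≉0 (power≉1 3 (ℕₚ.+-monoʳ-≤ 5 z≤n))))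
      (trans (trans (distribʳ c₀ g 1#) (trans (+-comm _ _) (+-congʳ (*-identityˡ c₀)))) eq)

    realised-τ₀ : Realised (λ t → t + τ₀)
    realised-τ₀ = realised-cong
      (λ t → begin
        g * (h * (g⁻¹ * (h⁻¹ * (t + c₀))) + c₀)
          ≈⟨ solve 5 (λ g g⁻¹ h s c → g :* (h :* (g⁻¹ :* s) :+ c) := h :* (g :* (g⁻¹ :* s)) :+ g :* c) refl g g⁻¹ h _ c₀ ⟩
        h * (g * (g⁻¹ * (h⁻¹ * (t + c₀)))) + g * c₀   ≈⟨ +-congʳ (trans (*-congˡ (gg⁻¹t _)) (hh⁻¹t _)) ⟩
        t + c₀ + g * c₀                               ≈⟨ +-assoc t c₀ _ ⟩
        t + τ₀                                        ∎)
      (realised-∘ (realised-conj realised-h)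
        (realised-inverse (λ t → h⁻¹ * (t + c₀)) (λ t → trans (+-congʳ (hh⁻¹t _)) (x+y+y≈x t c₀)) realised-h))

    -- Conjugation by y multiplies the translation length by g, so from τ₀ all g^k τ₀ are reached,
    -- that is, every nonzero element.
    realised-translation : ∀ b → Realised (λ t → t + b)
    realised-translation b = go (b ≟ 0#)
      where
      go : Dec (b ≈ 0#) → Realised (λ t → t + b)
      go (yes b≈0) = realised-cong (λ t → sym (trans (+-congˡ b≈0) (+-identityʳ t))) realised-id
      go (no b≉0) = multiple (discrete-log g-order (b * τ₀⁻¹)
          (*-nonzero b≉0 (λ eq → 1≉0 (trans (sym ττ⁻¹) (trans (*-congˡ eq) (zeroʳ τ₀))))))
        where
        τ₀⁻¹ : Carrier
        τ₀⁻¹ = proj₁ (inverse τ₀ τ₀≉0)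
        ττ⁻¹ : τ₀ * τ₀⁻¹ ≈ 1#
        ττ⁻¹ = proj₂ (inverse τ₀ τ₀≉0)
        multiples : ∀ k → Realised (λ t → t + g ^ k * τ₀)
        multiples zero = realised-cong (λ t → +-congˡ (sym (*-identityˡ τ₀))) realised-τ₀
        multiples (suc k) = realised-cong
          (λ t → trans (distribˡ g _ _) (+-cong (gg⁻¹t t) (sym (*-assoc g (g ^ k) τ₀))))
          (realised-conj (multiples k))
        multiple : (Σ[ k ∈ ℕ ] g ^ k ≈ b * τ₀⁻¹) → Realised (λ t → t + b)
        multiple (k , eq) = realised-cong (λ t → +-congˡ (begin
          g ^ k * τ₀        ≈⟨ *-congʳ eq ⟩
          b * τ₀⁻¹ * τ₀     ≈⟨ *-assoc b τ₀⁻¹ τ₀ ⟩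
          b * (τ₀⁻¹ * τ₀)   ≈⟨ *-congˡ (trans (*-comm τ₀⁻¹ τ₀) ττ⁻¹) ⟩
          b * 1#            ≈⟨ *-identityʳ b ⟩
          b                 ∎)) (multiples k)

    realised-powers : ∀ k → Σ[ c ∈ Carrier ] Realised (λ t → h ^ k * t + c)
    realised-powers zero = 0# , realised-cong (λ t → sym (trans (+-identityʳ _) (*-identityˡ t))) realised-id
    realised-powers (suc k) = next (realised-powers k)
      where
      next : (Σ[ c ∈ Carrier ] Realised (λ t → h ^ k * t + c)) → Σ[ c ∈ Carrier ] Realised (λ t → h ^ suc k * t + c)
      next (c , r) = h * c + c₀ , realised-cong
        (λ t → solve 5 (λ h hᵏ t c c₀ → h :* (hᵏ :* t :+ c) :+ c₀ := h :* hᵏ :* t :+ (h :* c :+ c₀)) refl h (h ^ k) t c c₀)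
        (realised-∘ realised-h r)

    n-coprime-6 : Coprime n 6
    n-coprime-6 {i} (i∣n , i∣6) = ∣1⇒≡1 (∣m+n∣m⇒∣n (subst (i ∣_) (ℕₚ.+-comm 1 (suc m ℕ.* 6)) i∣n) (∣n⇒∣m*n (suc m) i∣6))

    -- As 6 is prime to n, the sixth power of g is again primitive, so the slopes h^k exhaust the
    -- units.
    h-order : HasOrder h n
    h-order = trans (^-assocʳ g 6 n) (trans (^-congʳ g (ℕₚ.*-comm 6 n))
        (trans (sym (^-assocʳ g n 6)) (trans (^-congˡ 6 (proj₁ g-order)) (1^n≈1 6))))
      , λ k h^k≈1 → coprime-divisor n-coprime-6 (proj₂ g-order (6 ℕ.* k) (trans (sym (^-assocʳ g 6 k)) h^k≈1))

  realise : ∀ c → Realised (ι c)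
  realise ((a , b) , a≉0) = go (discrete-log h-order a a≉0)
    where
    go : (Σ[ k ∈ ℕ ] h ^ k ≈ a) → Realised (ι ((a , b) , a≉0))
    go (k , hᵏ≈a) = realised-cong
      (λ t → begin
        -- The offset c that comes with the slope h^k is unknown; translating by c + b cancels it,
        -- since c + c = 0.
        h ^ k * t + c + (c + b)     ≈⟨ +-assoc _ c b ⟨
        h ^ k * t + c + c + b       ≈⟨ +-congʳ (x+y+y≈x _ c) ⟩
        h ^ k * t + b               ≈⟨ +-congʳ (*-congʳ hᵏ≈a) ⟩
        a * t + b                   ∎)
      (realised-∘ (realised-translation (c + b)) (proj₂ (realised-powers k)))
      where c = proj₁ (realised-powers k)

  chirality-group : IsChiralityGroup (AGL₁ F)
  chirality-group = isChiralityGroup (AGL₁ F) ι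
    (λ { (p , q) t → +-cong (*-congʳ p) q })
    (λ {c} {c′} eq → let
        b≈b′ = trans (sym (trans (+-congʳ (zeroʳ _)) (+-identityˡ _))) (trans (eq 0#) (trans (+-congʳ (zeroʳ _)) (+-identityˡ _)))
      in trans (sym (*-identityʳ _)) (trans (trans (sym (x+y+y≈x _ _)) (trans (+-congʳ (eq 1#))
           (trans (+-congˡ b≈b′) (x+y+y≈x _ _)))) (*-identityʳ _)) , b≈b′)
    (λ { ((a , b) , _) ((c , d) , _) t →
      solve 5 (λ a b c d t → a :* c :* t :+ (a :* d :+ b) := a :* (c :* t :+ d) :+ b) refl a b c d t })
    detect realise

-- For x : t ↦ 3 t and y : t ↦ t + 1 on ℤ/16, mirroring x y x⁻¹ = y³ gives x⁻¹ y x = y³, whereas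
-- x⁻¹ y x = y¹¹; hence the chirality group is generated by y⁸ : t ↦ t + 8.
module OrderTwo where
  affine : ℕ → ℕ → Fin 16 → Fin 16
  affine a b t = (a ℕ.* toℕ t ℕ.+ b) mod 16

  private
    x x⁻¹ y y⁻¹ shift₈ : Fin 16 → Fin 16
    x = affine 3 0
    -- 3 · 11 = 33 ≡ 1 modulo 16.
    x⁻¹ = affine 11 0
    y = affine 1 1
    y⁻¹ = affine 1 15
    shift₈ = affine 1 8

    inverse : ∀ (f g : Fin 16 → Fin 16) → {_ : True (Finₚ.all? λ t → f (g t) Finₚ.≟ t)} → ∀ t → f (g t) ≡ t
    inverse f g {p} = toWitness p

  open Mirrored (≡.setoid (Fin 16)) (bijection (≡.setoid (Fin 16)))
    (mk↔ₛ′ x x⁻¹ (inverse x x⁻¹) (inverse x⁻¹ x)) (mk↔ₛ′ y y⁻¹ (inverse y y⁻¹) (inverse y⁻¹ y))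

  -- (k , b , j) stands for t ↦ 3ᵏ t + b together with t ↦ 3⁻ᵏ t − b + 8 j, the actions of a word and of its
  -- mirror image.
  State : Set
  State = Fin 4 × Fin 16 × Fin 2

  ⟦_⟧ : State → Sign → Fin 16 → Fin 16
  ⟦ k , b , j ⟧ Sign.+ = affine (3 ℕ.^ toℕ k) (toℕ b)
  ⟦ k , b , j ⟧ Sign.- = affine (11 ℕ.^ toℕ k) (15 ℕ.* toℕ b ℕ.+ 8 ℕ.* toℕ j)

  -- The letter r₁ multiplies by 3 on one half and by 11 on the other. As 3 b and 11 b differ by 8
  -- b, the parity of b is added to j. The exponent k lives modulo 4 because 3⁴ = 81 ≡ 1.
  next : Fin 3 → Sign → State → State
  next 𝟘 Sign.+ (k , b , j) = k , y b , j
  next 𝟘 Sign.- (k , b , j) = k , y⁻¹ b , j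
  next 𝟙 Sign.+ (k , b , j) = (toℕ k ℕ.+ 3) mod 4 , x⁻¹ b , (toℕ j ℕ.+ toℕ b) mod 2
  next 𝟙 Sign.- (k , b , j) = (toℕ k ℕ.+ 1) mod 4 , x b , (toℕ j ℕ.+ toℕ b) mod 2
  next 𝟚 _ st = st

  Next-correct : Fin 3 → Sign → Set
  Next-correct i s = ∀ k b j t →
    (step i s (⟦ k , b , j ⟧ Sign.+ t) ≡ ⟦ next i s (k , b , j) ⟧ Sign.+ t) ×
    (step i (opposite s) (⟦ k , b , j ⟧ Sign.- t) ≡ ⟦ next i s (k , b , j) ⟧ Sign.- t)

  next-correct? : ∀ i s → Dec (Next-correct i s)
  next-correct? i s = Finₚ.all? λ k → Finₚ.all? λ b → Finₚ.all? λ j → Finₚ.all? λ t →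
    (_ Finₚ.≟ _) ×-dec (_ Finₚ.≟ _)

  -- An affine map fixing 0 and 1 is the identity; here this means b = 8 j and k = 0, so the first
  -- map is t or t + 8.
  Trivial-mirror : Fin 4 → Fin 16 → Fin 2 → Set
  Trivial-mirror k b j = (⟦ k , b , j ⟧ Sign.- Fin.zero ≡ Fin.zero) × (⟦ k , b , j ⟧ Sign.- 𝟙 ≡ 𝟙) →
    (∀ t → ⟦ k , b , j ⟧ Sign.+ t ≡ t) ⊎ (∀ t → ⟦ k , b , j ⟧ Sign.+ t ≡ shift₈ t)

  trivial-mirror? : Dec (∀ k b j → Trivial-mirror k b j)
  trivial-mirror? = Finₚ.all? λ k → Finₚ.all? λ b → Finₚ.all? λ j →
    ((⟦ k , b , j ⟧ Sign.- Fin.zero Finₚ.≟ Fin.zero) ×-dec (⟦ k , b , j ⟧ Sign.- 𝟙 Finₚ.≟ 𝟙)) →-dec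
    ((Finₚ.all? λ t → ⟦ k , b , j ⟧ Sign.+ t Finₚ.≟ t) ⊎-dec (Finₚ.all? λ t → ⟦ k , b , j ⟧ Sign.+ t Finₚ.≟ shift₈ t))

  abstract
    next-correct : ∀ i s → Next-correct i s
    next-correct 𝟘 Sign.+ = from-yes (next-correct? 𝟘 Sign.+)
    next-correct 𝟘 Sign.- = from-yes (next-correct? 𝟘 Sign.-)
    next-correct 𝟙 Sign.+ = from-yes (next-correct? 𝟙 Sign.+)
    next-correct 𝟙 Sign.- = from-yes (next-correct? 𝟙 Sign.-)
    next-correct 𝟚 s k b j t = ≡.refl , ≡.refl

    trivial-mirror : ∀ k b j → Trivial-mirror k b j
    trivial-mirror = from-yes trivial-mirror?

  action : Word → Sign → Fin 16 → Fin 16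
  action w s t = proj₂ (act w (s , t))

  state : Word → State
  state [] = Fin.zero , Fin.zero , Fin.zero
  state (i ∷ w) = next i (parity w) (state w)

  state-correct : ∀ w s t → action w s t ≡ ⟦ state w ⟧ s t
  state-correct [] Sign.+ = from-yes (Finₚ.all? λ t → t Finₚ.≟ ⟦ state [] ⟧ Sign.+ t)
  state-correct [] Sign.- = from-yes (Finₚ.all? λ t → t Finₚ.≟ ⟦ state [] ⟧ Sign.- t)
  state-correct (i ∷ w) Sign.+ t = ≡.trans
    (≡.cong₂ (step i) (≡.trans (act-side w Sign.+ t) (Signₚ.*-identityʳ _)) (state-correct w Sign.+ t))
    (proj₁ (next-correct i (parity w) (proj₁ (state w)) (proj₁ (proj₂ (state w))) (proj₂ (proj₂ (state w))) t))
  state-correct (i ∷ w) Sign.- t = ≡.trans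
    (≡.cong₂ (step i) (≡.trans (act-side w Sign.- t) (*-minus (parity w))) (state-correct w Sign.- t))
    (proj₂ (next-correct i (parity w) (proj₁ (state w)) (proj₁ (proj₂ (state w))) (proj₂ (proj₂ (state w))) t))

  dichotomy : ∀ w → InΔ⁺ w → Fixes Sign.- w → Fixes Sign.+ w ⊎ Acts Sign.+ w shift₈
  dichotomy w ew fix = go (trivial-mirror k b j
      ( ≡.trans (≡.sym (state-correct w Sign.- Fin.zero)) (proj₂ (fix Fin.zero))
      , ≡.trans (≡.sym (state-correct w Sign.- 𝟙)) (proj₂ (fix 𝟙))))
    where
    k = proj₁ (state w)
    b = proj₁ (proj₂ (state w))
    j = proj₂ (proj₂ (state w))
    lift : ∀ {f} → (∀ t → ⟦ state w ⟧ Sign.+ t ≡ f t) → Acts Sign.+ w f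
    lift p t = ≡.cong proj₁ (act-even w ew Sign.+ t) , ≡.trans (state-correct w Sign.+ t) (p t)
    go : (∀ t → ⟦ state w ⟧ Sign.+ t ≡ t) ⊎ (∀ t → ⟦ state w ⟧ Sign.+ t ≡ shift₈ t) →
      Fixes Sign.+ w ⊎ Acts Sign.+ w shift₈
    go (inj₁ p) = inj₁ (lift p)
    go (inj₂ p) = inj₂ (lift p)

  realised-shift₈ : Realised shift₈
  realised-shift₈ = w , (8 , ≡.refl)
    , (λ t → ≡.refl , from-yes (Finₚ.all? λ t → action w Sign.- t Finₚ.≟ t) t)
    , (λ t → ≡.refl , from-yes (Finₚ.all? λ t → action w Sign.+ t Finₚ.≟ shift₈ t) t)
    where
    w : Word
    -- The word x y x⁻¹ y⁵: it acts as y³ y⁵ = y⁸ on the first half and as y⁻¹¹ y⁻⁵ = 1 on the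
    -- second.
    w = 𝟙 ∷ 𝟚 ∷ 𝟚 ∷ 𝟘 ∷ 𝟚 ∷ 𝟙 ∷ 𝟚 ∷ 𝟘 ∷ 𝟚 ∷ 𝟘 ∷ 𝟚 ∷ 𝟘 ∷ 𝟚 ∷ 𝟘 ∷ 𝟚 ∷ 𝟘 ∷ []

  module _ (F : Field 0ℓ 0ℓ) (card : Bijection (Field.setoid F) (≡.setoid (Fin 2))) where
    open Field F hiding (zero; inverse)
    open FieldProperties F
    open FiniteField F 1 card
    private
      module X = RawMagma (AGL₁ F)

    nonzero≈1 : ∀ {a} → ¬ (a ≈ 0#) → a ≈ 1#
    nonzero≈1 {a} a≉0 = trans (sym (*-identityʳ a)) (x^[q-1]≈1 a a≉0)

    1+1≈0 : 1# + 1# ≈ 0#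
    1+1≈0 = trans (+-congˡ (sym (+-identityʳ 1#))) (q·x≈0 1#)

    choose : ∀ {b} → Dec (b ≈ 0#) → Fin 16 → Fin 16
    choose (yes _) t = t
    choose (no _) t = shift₈ t

    -- Over the field with two elements the slope is always 1, so the offset alone decides the image
    -- in the group generated by t ↦ t + 8.
    ι : X.Carrier → Fin 16 → Fin 16
    ι ((a , b) , _) = choose (b ≟ 0#)

    choose-cong : ∀ {b b′} (p : Dec (b ≈ 0#)) (q : Dec (b′ ≈ 0#)) → b ≈ b′ → ∀ t → choose p t ≡ choose q t
    choose-cong (yes _) (yes _) eq t = ≡.refl
    choose-cong (no _) (no _) eq t = ≡.refl
    choose-cong (yes b≈0) (no b′≉0) eq t = ⊥-elim (b′≉0 (trans (sym eq) b≈0))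
    choose-cong (no b≉0) (yes b′≈0) eq t = ⊥-elim (b≉0 (trans eq b′≈0))

    choose-injective : ∀ {b b′} (p : Dec (b ≈ 0#)) (q : Dec (b′ ≈ 0#)) → (∀ t → choose p t ≡ choose q t) → b ≈ b′
    choose-injective (yes b≈0) (yes b′≈0) eq = trans b≈0 (sym b′≈0)
    choose-injective (no b≉0) (no b′≉0) eq = trans (nonzero≈1 b≉0) (sym (nonzero≈1 b′≉0))
    choose-injective (yes _) (no _) eq with () ← eq Fin.zero
    choose-injective (no _) (yes _) eq with () ← eq Fin.zero

    choose-+ : ∀ {b b′ c} (p : Dec (b ≈ 0#)) (q : Dec (b′ ≈ 0#)) (r : Dec (c ≈ 0#)) → c ≈ b′ + b →
      ∀ t → choose r t ≡ choose p (choose q t)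
    choose-+ (yes b≈0) q r eq = choose-cong r q (trans eq (trans (+-congˡ b≈0) (+-identityʳ _)))
    choose-+ p@(no _) (yes b′≈0) r eq = choose-cong r p (trans eq (trans (+-congʳ b′≈0) (+-identityˡ _)))
    choose-+ (no _) (no _) (yes _) eq = from-yes (Finₚ.all? λ t → t Finₚ.≟ shift₈ (shift₈ t))
    choose-+ (no b≉0) (no b′≉0) (no c≉0) eq t =
      ⊥-elim (c≉0 (trans eq (trans (+-cong (nonzero≈1 b′≉0) (nonzero≈1 b≉0)) 1+1≈0)))

    choose-realised : ∀ {b} (p : Dec (b ≈ 0#)) → Realised (choose p)
    choose-realised (yes _) = realised-id
    choose-realised (no _) = realised-shift₈

    choose-0 : (p : Dec (0# ≈ 0#)) → ∀ t → t ≡ choose p t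
    choose-0 (yes _) t = ≡.refl
    choose-0 (no 0≉0) t = ⊥-elim (0≉0 refl)

    choose-1 : (p : Dec (1# ≈ 0#)) → ∀ t → shift₈ t ≡ choose p t
    choose-1 (yes 1≈0) t = ⊥-elim (1≉0 1≈0)
    choose-1 (no _) t = ≡.refl

    detect : ∀ w → InΔ⁺ w → Fixes Sign.- w → Σ[ c ∈ X.Carrier ] Acts Sign.+ w (ι c)
    detect w ew fix = go (dichotomy w ew fix)
      where
      go : Fixes Sign.+ w ⊎ Acts Sign.+ w shift₈ → Σ[ c ∈ X.Carrier ] Acts Sign.+ w (ι c)
      go (inj₁ p) = ((1# , 0#) , 1≉0) , λ t → proj₁ (p t) , ≡.trans (proj₂ (p t)) (choose-0 (0# ≟ 0#) t)
      go (inj₂ p) = ((1# , 1#) , 1≉0) , λ t → proj₁ (p t) , ≡.trans (proj₂ (p t)) (choose-1 (1# ≟ 0#) t)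

    ι-cong : ∀ {c d} → c X.≈ d → ∀ t → ι c t ≡ ι d t
    ι-cong {(_ , b) , _} {(_ , b′) , _} (_ , eq) = choose-cong (b ≟ 0#) (b′ ≟ 0#) eq

    ι-injective : ∀ {c d} → (∀ t → ι c t ≡ ι d t) → c X.≈ d
    ι-injective {(_ , b) , a≉0} {(_ , b′) , a′≉0} eq =
      trans (nonzero≈1 a≉0) (sym (nonzero≈1 a′≉0)) , choose-injective (b ≟ 0#) (b′ ≟ 0#) eq

    ι-∙ : ∀ c d t → ι (c X.∙ d) t ≡ ι c (ι d t)
    ι-∙ ((a , b) , a≉0) ((_ , b′) , _) = choose-+ (b ≟ 0#) (b′ ≟ 0#) (a * b′ + b ≟ 0#)
      (+-congʳ (trans (*-congʳ (nonzero≈1 a≉0)) (*-identityˡ b′)))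

    realise : ∀ c → Realised (ι c)
    realise ((_ , b) , _) = choose-realised (b ≟ 0#)

    chirality-group : IsChiralityGroup (AGL₁ F)
    chirality-group = isChiralityGroup (AGL₁ F) ι (λ {c} {d} → ι-cong {c} {d}) (λ {c} {d} → ι-injective {c} {d})
      ι-∙ detect realise

-- For e = 2k + 1 with k ≥ 1, writing 4^k = 1 + 3(m + 1) gives q = 2 + 6(m + 1), the shape required
-- by `OddExponent`; k = 0 is the case q = 2.
sufficiency : ∀ n (F : Field 0ℓ 0ℓ) → Bijection (Field.setoid F) (≡.setoid (Fin (suc n))) →
  ∀ e → suc n ≡ 2 ℕ.^ e → Odd e → IsChiralityGroup (AGL₁ F)
sufficiency n F card _ q≡2^e (zero , ≡.refl) with ℕₚ.suc-injective q≡2^e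
... | ≡.refl = OrderTwo.chirality-group F card
sufficiency n F card _ q≡2^e (suc j , ≡.refl) with 4^k≡1+3m (suc j)
... | zero , eq with () ← ℕₚ.m*n≡1⇒m≡1 2 (2 ℕ.^ (j ℕ.+ suc j)) eq
... | suc m , eq with ℕₚ.suc-injective (≡.trans q≡2^e (≡.trans (≡.cong (2 ℕ.*_) eq) (lem m)))
  where
  lem : ∀ m → 2 ℕ.* suc (suc m ℕ.* 3) ≡ suc (suc (suc m ℕ.* 6))
  lem = solve-∀
...   | ≡.refl = OddExponent.chirality-group F m card (suc j ℕ.+ suc j) q≡2^e

open import Data.Nat using (_^_)

theorem26 : (q : ℕ) → IsPrimePower q →
    (F : Field 0ℓ 0ℓ) → Bijection (Field.setoid F) (≡.setoid (Fin q)) →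
    (IsChiralityGroup (AGL₁ F) ⇔ Σ ℕ (λ e → (q ≡ 2 ^ e) × Odd e))
theorem26 zero _ F card with () ← Bijection.to card (Field.0# F)
theorem26 (suc n) prime-power F card = mk⇔ (Necessity.necessity F n card prime-power)
  (λ { (e , q≡2^e , odd) → sufficiency n F card e q≡2^e odd })
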